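{- Let $\Sigma$ be a finite alphabet and let $L\subseteq\Sigma^{\circledast}$ be a regular language of countable words. The following are equivalent. (1) $L$ is recognized by a finite shuffle-power-trivial $\circledast$-algebra. (2) $L$ is recognized by the quotient morphism $h_n:\Sigma^{\circledast}\to\mathbf{S_n}$ for some $n\in\mathbb N$ (that is, $L=h_n^{ -1}(h_n(L))$). (3) $L$ is definable in $B(\exists^*)$, the boolean closure of existential first-order logic. (4) The syntactic $\circledast$-algebra of $L$ is shuffle-power-trivial.
   Context: Words. A (countable) word over a set $A$ is a map $w$ from a countable, possibly empty, linear ordering $\mathrm{dom}(w)$ to $A$, taken up to isomorphism; $A^{\circledast}$ is the set of all such words (including the empty word $\varepsilon$). A subword of $w$ is the restriction of $w$ to an arbitrary subset of $\mathrm{dom}(w)$. For words $(w_i)_{i\in\alpha}$ indexed by a countable linear ordering $\alpha$, $\prod_{i\in\alpha}w_i$ is their generalized concatenation. $w^{\omega}$ and $w^{\omega^*}$ are the concatenations of copies of $w$ indexed by $(\mathbb N,<)$ and $(-\mathbb N,<)$. For a finite nonempty set $E$, the perfect shuffle $E^{\eta}$ is the (unique up to isomorphism) word of domain $(\mathbb Q,<)$ using only letters of $E$ in which every nonempty non-singleton interval contains every letter of $E$. Algebra. A $\circledast$-monoid $(M,\mathrm{id},\pi)$ is a set $M$ with a map $\pi:M^{\circledast}\to M$ such that $\pi(a)=a$ for $a\in M$, $\pi(\prod_{i\in\alpha}u_i)=\pi(\prod_{i\in\alpha}\pi(u_i))$ for all countable linear orderings $\alpha$ and words $u_i$ over $M$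 (generalized associativity), and $\mathrm{id}=\pi(\varepsilon)$. It induces the $\circledast$-algebra $(M,\mathrm{id},\cdot,\tau,\tau^*,\kappa)$ with $a\cdot b=\pi(ab)$, $a^{\tau}=\pi(a^{\omega})$, $a^{\tau^*}=\pi(a^{\omega^*})$, $E^{\kappa}=\pi(E^{\eta})$ for nonempty finite $E\subseteq M$. A finite $\circledast$-monoid is determined by its $\circledast$-algebra, and the two are identified. A morphism $h:M\to M'$ satisfies $h(\pi(w))=\pi'(\bar h(w))$, where $\bar h$ is the letterwise extension of $h$. $\Sigma^{\circledast}$ with generalized concatenation is the free $\circledast$-monoid over $\Sigma$. $L\subseteq\Sigma^{\circledast}$ is recognized by $M$ if there is a morphism $h:\Sigma^{\circledast}\to M$ with $L=h^{ -1}(h(L))$. $L$ is regular if it is recognized by some finite $\circledast$-monoid (equivalently, MSO-definable). $M$ divides $M'$ if $M$ is the image under a surjective morphism of a sub-$\circledast$-monoid of $M'$. The syntactic $\circledast$-algebra of a regular $L$ is its canonical (minimal) finite recognizing $\circledast$-algebra; it recognizes $L$ and divides every $\circledast$-algebra recognizing $L$. For $m$ in a finite $\circledast$-algebra, $m^{!}$ denotes the unique idempotent among the powers $m,m^2,m^3,\dots$ (with respect to $\cdot$). A finite $\circledast$-algebra is shuffle-power-trivial if $\{x_1,\dots,x_p\}^{\kappa}=(x_1\cdot x_2\cdots x_p)^{!}$ for all $p\ge1$ and all $x_1,\dots,x_p\in M$. For $n\in\mathbb N$ and $u,v\in\Sigma^{\circledast}$, $u\sim_n v$ means that $u$ and $v$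 have the same set of subwords of length at most $n$. This is an equivalence relation of finite index; $[w]_n$ is the class of $w$, $S_n=\Sigma^{\circledast}/\!\sim_n$, and $\mathbf{S_n}=(S_n,[\varepsilon]_n,\pi)$ is the $\circledast$-monoid with $\pi(\prod_{i\in\alpha}[w_i]_n)=[\prod_{i\in\alpha}w_i]_n$. The map $h_n(w)=[w]_n$ is a morphism. Logic. First-order logic FO over words: formulas are built from $x<y$, $a(x)$ ($a\in\Sigma$; "position $x$ carries letter $a$"), boolean connectives, and $\exists x$, with variables ranging over positions. $B(\exists^*)$ consists of boolean combinations of sentences $\exists x_1\cdots\exists x_k\,\varphi(x_1,\dots,x_k)$ with $\varphi$ quantifier-free. A language is definable in a logic if it is the set of words satisfying some sentence of the logic. -}

module Defs where

open import Level using (Level; 0ℓ; _⊔_) renaming (suc to lsuc)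
open import Algebra.Bundles.Raw using (RawMonoid)
import Algebra.Definitions
import Algebra.Definitions.RawMonoid
open import Data.Empty using (⊥-elim)
open import Data.Fin.Base as Fin using (Fin; zero; suc; toℕ)
import Data.Fin.Properties as Fin
open import Data.Integer.Base as ℤ using (ℤ; +_; -[1+_])
import Data.Integer.Divisibility.Signed as ℤ∣
import Data.Integer.DivMod as ℤ
import Data.Integer.Properties as ℤ
open import Data.Integer.Tactic.RingSolver using (solve-∀)
open import Data.Irrelevant using ([_])
open import Data.Nat.Base as ℕ using (ℕ; zero; suc; NonZero)
import Data.Nat.Coprimality as ℕ
import Data.Nat.Divisibility as ℕ
import Data.Nat.DivMod as ℕ
open import Data.Nat.Logarithm using (⌊log₂_⌋; ⌊log₂[2^n]⌋≡n)
import Data.Nat.Properties as ℕ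
open import Data.Product.Base using (Σ; ∃; ∃-syntax; _×_; _,_; proj₁; proj₂)
open import Data.Product.Properties using (,-injectiveˡ)
open import Data.Rational.Base as ℚ using (ℚ; mkℚ; ↥_; ↧_; ↧ₙ_)
import Data.Rational.Properties as ℚ
open import Data.Refinement using (Refinement; _,_; value)
open import Data.Refinement.Properties using (value-injective)
open import Data.Sum.Base using (_⊎_)
open import Data.Vec.Functional using (Vector; []; _∷_)
open import Function.Base using (_∘_; id)
open import Function.Bundles using (Inverse; _↣_; mk↣; Injection; _⇔_; mk⇔; Equivalence)
open import Function.Construct.Composition using (_↣-∘_)
import Function.Properties.Equivalence as ⇔
open import Function.Definitions using (Injective; Surjective)
open import Relation.Binary.Bundles using (Setoid)
open import Relation.Binary.Core using (Rel)
open import Relation.Binary.Definitions using (Trichotomous; tri<; tri≈; tri>; Transitive)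
open import Relation.Binary.Morphism.Structures using (IsOrderIsomorphism)
open import Relation.Binary.PropositionalEquality
  using (_≡_; refl; sym; trans; cong; subst; subst₂; module ≡-Reasoning)
import Relation.Binary.PropositionalEquality as ≡
open import Relation.Binary.Structures using (IsStrictTotalOrder)
open import Relation.Binary.Structures.Biased using (isStrictTotalOrderᶜ)
open import Relation.Nullary using (¬_)
open import Relation.Unary using (Pred; _≐_; _⊢_)

record CountableOrder : Set₁ where
  infix 4 _<_
  field
    Carrier            : Set
    _<_                : Rel Carrier 0ℓ
    isStrictTotalOrder : IsStrictTotalOrder _≡_ _<_
    countable          : Carrier ↣ ℕ

  open IsStrictTotalOrder isStrictTotalOrder public
    using (compare; irrefl; asym) renaming (trans to <-trans)

open CountableOrder public using () renaming (Carrier to Pos)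

-- An injective pairing function, (m , n) ↦ 2ᵐ (1 + 2n).
pair : ℕ → ℕ → ℕ
pair zero    n = suc (2 ℕ.* n)
pair (suc m) n = 2 ℕ.* pair m n

pair-injective : ∀ m n m′ n′ → pair m n ≡ pair m′ n′ → m ≡ m′ × n ≡ n′
pair-injective zero    n zero     n′ eq = refl , ℕ.*-cancelˡ-≡ n n′ 2 (ℕ.suc-injective eq)
pair-injective zero    n (suc m′) n′ eq = ⊥-elim (ℕ.even≢odd (pair m′ n′) n (sym eq))
pair-injective (suc m) n zero     n′ eq = ⊥-elim (ℕ.even≢odd (pair m n) n′ eq)
pair-injective (suc m) n (suc m′) n′ eq with pair-injective m n m′ n′ (ℕ.*-cancelˡ-≡ (pair m n) (pair m′ n′) 2 eq)
... | refl , n≡n′ = refl , n≡n′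

finOrder : ℕ → CountableOrder
finOrder n = record
  { Carrier            = Fin n
  ; _<_                = Fin._<_
  ; isStrictTotalOrder = Fin.<-isStrictTotalOrder
  ; countable          = mk↣ {to = toℕ} Fin.toℕ-injective
  }

ℤ→ℕ : ℤ → ℕ
ℤ→ℕ (+ n)    = 2 ℕ.* n
ℤ→ℕ -[1+ n ] = suc (2 ℕ.* n)

ℤ→ℕ-injective : ∀ i j → ℤ→ℕ i ≡ ℤ→ℕ j → i ≡ j
ℤ→ℕ-injective (+ m)    (+ n)    eq = cong +_ (ℕ.*-cancelˡ-≡ m n 2 eq)
ℤ→ℕ-injective (+ m)    -[1+ n ] eq = ⊥-elim (ℕ.even≢odd m n eq)
ℤ→ℕ-injective -[1+ m ] (+ n)    eq = ⊥-elim (ℕ.even≢odd n m (sym eq))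
ℤ→ℕ-injective -[1+ m ] -[1+ n ] eq = cong -[1+_] (ℕ.*-cancelˡ-≡ m n 2 (ℕ.suc-injective eq))

ℚ→ℕ : ℚ → ℕ
ℚ→ℕ q = pair (ℤ→ℕ (↥ q)) (↧ₙ q)

ℚ→ℕ-injective : Injective _≡_ _≡_ ℚ→ℕ
ℚ→ℕ-injective {p@record{}} {q@record{}} eq
  with pair-injective (ℤ→ℕ (↥ p)) (↧ₙ p) (ℤ→ℕ (↥ q)) (↧ₙ q) eq
... | i , j with ℤ→ℕ-injective (↥ p) (↥ q) i | j
...   | refl | refl = refl

ℚ-order : CountableOrder
ℚ-order = record
  { Carrier            = ℚ
  ; _<_                = ℚ._<_
  ; isStrictTotalOrder = ℚ.<-isStrictTotalOrder
  ; countable          = mk↣ ℚ→ℕ-injective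
  }

-- The order induced on a subset.  Membership proofs are irrelevant, so that
-- two positions of the subset are equal as soon as their values are.
infixl 8 _↾ᵒ_

_↾ᵒ_ : (α : CountableOrder) → Pred (Pos α) 0ℓ → CountableOrder
α ↾ᵒ P = record
  { Carrier            = Refinement α.Carrier P
  ; _<_                = λ x y → value x α.< value y
  ; isStrictTotalOrder = isStrictTotalOrderᶜ record
      { isEquivalence = ≡.isEquivalence
      ; trans         = α.<-trans
      ; compare       = cmp
      }
  ; countable          = α.countable ↣-∘ mk↣ {to = value} value-injective
  }
  where
  module α = CountableOrder α
  cmp : Trichotomous _≡_ (λ x y → value x α.< value y)
  cmp x y with α.compare (value x) (value y)
  ... | tri< a b c = tri< a (b ∘ cong value) c
  ... | tri≈ a b c = tri≈ a (value-injective b) c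
  ... | tri> a b c = tri> a (b ∘ cong value) c

module _ (α : CountableOrder) (β : Pos α → CountableOrder) where
  private
    module α = CountableOrder α
    module β (i : Pos α) = CountableOrder (β i)

  data _<ˡᵉˣ_ : Rel (Σ (Pos α) (λ i → Pos (β i))) 0ℓ where
    outer : ∀ {i j x y} → i α.< j → (i , x) <ˡᵉˣ (j , y)
    inner : ∀ {i x y} → β._<_ i x y → (i , x) <ˡᵉˣ (i , y)

  ∑-trans : Transitive _<ˡᵉˣ_
  ∑-trans (outer p) (outer q) = outer (α.<-trans p q)
  ∑-trans (outer p) (inner q) = outer p
  ∑-trans (inner p) (outer q) = outer q
  ∑-trans (inner p) (inner q) = inner (β.<-trans _ p q)

  ∑-compare : Trichotomous _≡_ _<ˡᵉˣ_
  ∑-compare (i , x) (j , y) with α.compare i j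
  ... | tri< a b c = tri< (outer a) (b ∘ cong proj₁)
                       (λ { (outer d) → c d ; (inner _) → b refl })
  ... | tri> a b c = tri> (λ { (outer d) → a d ; (inner _) → b refl })
                       (b ∘ cong proj₁) (outer c)
  ... | tri≈ a refl c with β.compare i x y
  ...   | tri< a′ b′ c′ = tri< (inner a′) (λ { refl → b′ refl })
                            (λ { (outer d) → a d ; (inner d) → c′ d })
  ...   | tri≈ a′ b′ c′ = tri≈ (λ { (outer d) → a d ; (inner d) → a′ d })
                            (cong (i ,_) b′)
                            (λ { (outer d) → a d ; (inner d) → c′ d })
  ...   | tri> a′ b′ c′ = tri> (λ { (outer d) → a d ; (inner d) → a′ d })
                            (λ { refl → b′ refl }) (inner c′)

  ∑ᵒ : CountableOrder
  ∑ᵒ = record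
    { Carrier            = Σ (Pos α) (λ i → Pos (β i))
    ; _<_                = _<ˡᵉˣ_
    ; isStrictTotalOrder = isStrictTotalOrderᶜ record
        { isEquivalence = ≡.isEquivalence
        ; trans         = ∑-trans
        ; compare       = ∑-compare
        }
    ; countable          = mk↣ {to = code} code-injective
    }
    where
    code : Σ (Pos α) (λ i → Pos (β i)) → ℕ
    code (i , x) = pair (Injection.to α.countable i) (Injection.to (β.countable i) x)

    code-injective : Injective _≡_ _≡_ code
    code-injective {i , x} {j , y} eq with pair-injective _ _ _ _ eq
    ... | p , q with Injection.injective α.countable p
    ...   | refl = cong (i ,_) (Injection.injective (β.countable i) q)

-- Words are compared up to the isomorphisms WordIso below, never by _≡_.
record Word {a} (A : Set a) : Set (lsuc 0ℓ ⊔ a) where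
  constructor word
  field
    dom    : CountableOrder
    letter : Pos dom → A

open Word public

mapʷ : ∀ {a b} {A : Set a} {B : Set b} → (A → B) → Word A → Word B
mapʷ f w = word (dom w) (f ∘ letter w)

module _ {a ℓ} (S : Setoid a ℓ) where
  private module S = Setoid S

  record WordIso (u v : Word S.Carrier) : Set ℓ where
    private
      module u = CountableOrder (dom u)
      module v = CountableOrder (dom v)
    field
      to                 : u.Carrier → v.Carrier
      isOrderIsomorphism : IsOrderIsomorphism _≡_ _≡_ u._<_ v._<_ to
      letters            : ∀ x → letter u x S.≈ letter v (to x)

    open IsOrderIsomorphism isOrderIsomorphism public
      using (mono; cancel; injective; surjective)

    from : v.Carrier → u.Carrier
    from y = proj₁ (surjective y)

    to∘from : ∀ y → to (from y) ≡ y
    to∘from y = proj₂ (surjective y) refl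

  -- On linear orders, a strictly increasing surjection is an isomorphism.
  mkIso : ∀ {u v : Word S.Carrier} (f : Pos (dom u) → Pos (dom v)) →
          (∀ {x y} → CountableOrder._<_ (dom u) x y → CountableOrder._<_ (dom v) (f x) (f y)) →
          (∀ y → ∃ λ x → f x ≡ y) →
          (∀ x → letter u x S.≈ letter v (f x)) → WordIso u v
  mkIso {u} {v} f f-mono f-surj f-letters = record
    { to                 = f
    ; isOrderIsomorphism = record
        { isOrderMonomorphism = record
            { isOrderHomomorphism = record { cong = cong f ; mono = f-mono }
            ; injective           = inj
            ; cancel              = can
            }
        ; surjective          = λ y → proj₁ (f-surj y) , λ { refl → proj₂ (f-surj y) }
        }
    ; letters            = f-letters
    }
    where
    module u = CountableOrder (dom u)
    module v = CountableOrder (dom v)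
    inj : Injective _≡_ _≡_ f
    inj {x} {y} eq with u.compare x y
    ... | tri< a _ _ = ⊥-elim (v.irrefl eq (f-mono a))
    ... | tri≈ _ b _ = b
    ... | tri> _ _ c = ⊥-elim (v.irrefl (sym eq) (f-mono c))
    can : Injective u._<_ v._<_ f
    can {x} {y} lt with u.compare x y
    ... | tri< a _ _ = a
    ... | tri≈ _ b _ = ⊥-elim (v.irrefl (cong f b) lt)
    ... | tri> _ _ c = ⊥-elim (v.asym lt (f-mono c))

  ≅-refl : ∀ {u} → WordIso u u
  ≅-refl = mkIso id id (λ y → y , refl) (λ _ → S.refl)

  ≅-trans : ∀ {u v w} → WordIso u v → WordIso v w → WordIso u w
  ≅-trans p q = mkIso (q.to ∘ p.to) (q.mono ∘ p.mono)
    (λ z → p.from (q.from z) , trans (cong q.to (p.to∘from _)) (q.to∘from z))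
    (λ x → S.trans (p.letters x) (q.letters (p.to x)))
    where
    module p = WordIso p
    module q = WordIso q

  ≅-sym : ∀ {u v} → WordIso u v → WordIso v u
  ≅-sym {u} {v} p = mkIso p.from
    (λ {x} {y} lt → p.cancel (subst₂ (CountableOrder._<_ (dom v))
       (sym (p.to∘from x)) (sym (p.to∘from y)) lt))
    (λ x → p.to x , p.injective (p.to∘from (p.to x)))
    (λ y → S.trans (S.reflexive (cong (letter v) (sym (p.to∘from y))))
                   (S.sym (p.letters (p.from y))))
    where module p = WordIso p

  wordSetoid : Setoid (lsuc 0ℓ ⊔ a) ℓ
  wordSetoid = record
    { Carrier       = Word S.Carrier
    ; _≈_           = WordIso
    ; isEquivalence = record { refl = ≅-refl ; sym = ≅-sym ; trans = ≅-trans }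
    }

infix 4 _≅_

_≅_ : ∀ {a} {A : Set a} → Rel (Word A) a
_≅_ {A = A} = WordIso (≡.setoid A)

finWord : ∀ {a} {A : Set a} {n} → Vector A n → Word A
finWord {n = n} xs = word (finOrder n) xs

ε : ∀ {a} {A : Set a} → Word A
ε = finWord []

∏ : ∀ {a} {A : Set a} (α : CountableOrder) → (Pos α → Word A) → Word A
∏ α w = word (∑ᵒ α (dom ∘ w)) (λ (i , x) → letter (w i) x)

concat : ∀ {a} {A : Set a} → Word (Word A) → Word A
concat W = ∏ (dom W) (letter W)

infixl 8 _↾_

_↾_ : ∀ {a} {A : Set a} (w : Word A) → Pred (Pos (dom w)) 0ℓ → Word A
w ↾ P = word (dom w ↾ᵒ P) (letter w ∘ value)

infix 4 _⊑_ _∼[_]_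

_⊑_ : ∀ {a} {A : Set a} → Word A → Word A → Set (lsuc 0ℓ ⊔ a)
s ⊑ w = ∃[ P ] s ≅ w ↾ P

-- A word has length at most n when its domain injects into Fin n.
length≤ : ∀ {a} {A : Set a} → Word A → ℕ → Set
length≤ s n = Pos (dom s) ↣ Fin n

_∼[_]_ : ∀ {a} {A : Set a} → Word A → ℕ → Word A → Set (lsuc 0ℓ ⊔ a)
u ∼[ n ] v = ∀ s → length≤ s n → s ⊑ u ⇔ s ⊑ v

module _ {a} {A : Set a} where

  concat-cong : ∀ {U V : Word (Word A)} →
                WordIso (wordSetoid (≡.setoid A)) U V → concat U ≅ concat V
  concat-cong {U} {V} p = mkIso _ f f-mono f-surj (λ (i , x) → WordIso.letters (p.letters i) x)
    where
    module p = WordIso p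
    f : Pos (dom (concat U)) → Pos (dom (concat V))
    f (i , x) = p.to i , WordIso.to (p.letters i) x

    f-mono : ∀ {x y} → CountableOrder._<_ (dom (concat U)) x y →
             CountableOrder._<_ (dom (concat V)) (f x) (f y)
    f-mono (outer q) = outer (p.mono q)
    f-mono (inner {i} q) = inner (WordIso.mono (p.letters i) q)

    f-surj : ∀ y → ∃ λ x → f x ≡ y
    f-surj (j , y) with p.from j | p.to∘from j
    ... | i | refl = (i , WordIso.from (p.letters i) y) ,
                     cong (p.to i ,_) (WordIso.to∘from (p.letters i) y)

  concat-singleton : (w : Word A) → concat (finWord (w ∷ [])) ≅ w
  concat-singleton w = mkIso _ f f-mono (λ x → (zero , x) , refl) (λ { (zero , x) → refl })
    where
    f : Pos (dom (concat (finWord (w ∷ [])))) → Pos (dom w)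
    f (zero , x) = x
    f-mono : ∀ {x y} → CountableOrder._<_ (dom (concat (finWord (w ∷ [])))) x y →
             CountableOrder._<_ (dom w) (f x) (f y)
    f-mono (outer {zero} {zero} ())
    f-mono (inner {zero} q) = q

  concat-∏ : (α : CountableOrder) (U : Pos α → Word (Word A)) →
             concat (∏ α U) ≅ concat (word α (concat ∘ U))
  concat-∏ α U = mkIso _ (λ ((i , j) , x) → i , j , x) f-mono
                   (λ (i , j , x) → ((i , j) , x) , refl) (λ _ → refl)
    where
    f-mono : ∀ {x y} → CountableOrder._<_ (dom (concat (∏ α U))) x y →
             CountableOrder._<_ (dom (concat (word α (concat ∘ U))))
               (proj₁ (proj₁ x) , proj₂ (proj₁ x) , proj₂ x)
               (proj₁ (proj₁ y) , proj₂ (proj₁ y) , proj₂ y)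
    f-mono (outer (outer q)) = outer q
    f-mono (outer (inner q)) = inner (outer q)
    f-mono (inner q)         = inner (inner q)

module _ {a} {A : Set a} where

  ⊑-resp-≅ : ∀ {s u v : Word A} → u ≅ v → s ⊑ u → s ⊑ v
  ⊑-resp-≅ {s} {u} {v} p (P , q) = P ∘ p.from , ≅-trans _ q (mkIso _ f p.mono f-surj (p.letters ∘ value))
    where
    module p = WordIso p
    f : Pos (dom (u ↾ P)) → Pos (dom (v ↾ (P ∘ p.from)))
    f (x , [ h ]) = p.to x , [ subst P (sym (p.injective (p.to∘from (p.to x)))) h ]

    f-surj : ∀ y → ∃ λ x → f x ≡ y
    f-surj (y , [ h ]) = (p.from y , [ h ]) , value-injective (p.to∘from y)

  ≅⇒∼ : ∀ n {u v : Word A} → u ≅ v → u ∼[ n ] v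
  ≅⇒∼ n p s _ = mk⇔ (⊑-resp-≅ p) (⊑-resp-≅ (≅-sym _ p))

  ∼-setoid : ℕ → Setoid (lsuc 0ℓ ⊔ a) (lsuc 0ℓ ⊔ a)
  ∼-setoid n = record
    { Carrier       = Word A
    ; _≈_           = _∼[ n ]_
    ; isEquivalence = record
        { refl  = λ s _ → ⇔.refl
        ; sym   = λ p s l → ⇔.sym (p s l)
        ; trans = λ p q s l → ⇔.trans (p s l) (q s l)
        }
    }

  -- The factors of a short subword of a product are short subwords of the
  -- factors; replace each of them.
  concat-⊑ : ∀ n {U V : Word (Word A)} → WordIso (∼-setoid n) U V →
             ∀ {s} → length≤ s n → s ⊑ concat U → s ⊑ concat V
  concat-⊑ n {U} {V} p {s} len (P , q) = Q , ≅-trans _ q (mkIso _ f f-mono f-surj f-letters)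
    where
    module p = WordIso p
    module q = WordIso q

    part : Pos (dom U) → Word A
    part i = letter U i ↾ (λ x → P (i , x))

    include : ∀ i → Pos (dom (part i)) → Pos (dom (concat U ↾ P))
    include i (x , h) = (i , x) , h

    include-injective : ∀ i → Injective _≡_ _≡_ (include i)
    include-injective i {x , _} {.x , _} refl = refl

    part-len : ∀ i → length≤ (part i) n
    part-len i = len ↣-∘ mk↣ {to = q.from ∘ include i} λ {x} {y} eq →
      include-injective i
        (trans (sym (q.to∘from _)) (trans (cong q.to eq) (q.to∘from _)))

    part-⊑ : ∀ i → part i ⊑ letter V (p.to i)
    part-⊑ i = Equivalence.to (p.letters i (part i) (part-len i))
                 ((λ x → P (i , x)) , ≅-refl _)

    R : ∀ i → Pred (Pos (dom (letter V (p.to i)))) 0ℓ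
    R i = proj₁ (part-⊑ i)

    module r i = WordIso (proj₂ (part-⊑ i))

    Q : Pred (Pos (dom (concat V))) 0ℓ
    Q z = ∃ λ i → ∃ λ y → R i y × z ≡ (p.to i , y)

    f : Pos (dom (concat U ↾ P)) → Pos (dom (concat V ↾ Q))
    f ((i , x) , h) with r.to i (x , h)
    ... | y , [ k ] = (p.to i , y) , [ i , y , k , refl ]

    f-value : ∀ i x h → value (f ((i , x) , h)) ≡ (p.to i , value (r.to i (x , h)))
    f-value i x h with r.to i (x , h)
    ... | y , [ k ] = refl

    f-mono : ∀ {x y} → CountableOrder._<_ (dom (concat U ↾ P)) x y →
             CountableOrder._<_ (dom (concat V ↾ Q)) (f x) (f y)
    f-mono {(i , x) , h} {(j , y) , k} lt =
      subst₂ (CountableOrder._<_ (dom (concat V))) (sym (f-value i x h)) (sym (f-value j y k)) (go lt)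
      where
      go : CountableOrder._<_ (dom (concat U)) (i , x) (j , y) →
           CountableOrder._<_ (dom (concat V))
             (p.to i , value (r.to i (x , h))) (p.to j , value (r.to j (y , k)))
      go (outer lt) = outer (p.mono lt)
      go (inner lt) = inner (r.mono i lt)

    unQ : ∀ i y → Q (p.to i , y) → R i y
    unQ i y (i′ , y′ , k , eq) with p.injective (,-injectiveˡ eq)
    unQ i y (.i , .y , k , refl) | refl = k

    f-surj : ∀ y → ∃ λ x → f x ≡ y
    f-surj ((j , y) , [ k ]) with p.from j | p.to∘from j
    ... | i | refl with r.from i (y , [ unQ i y k ]) in eq
    ...   | x , h = ((i , x) , h) ,
      value-injective (trans (f-value i x h)
        (cong (λ t → p.to i , value t)
          (trans (cong (r.to i) (sym eq)) (r.to∘from i (y , [ unQ i y k ])))))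

    f-letters : ∀ x → letter (concat U ↾ P) x ≡ letter (concat V ↾ Q) (f x)
    f-letters ((i , x) , h) =
      trans (r.letters i (x , h)) (cong (letter (concat V)) (sym (f-value i x h)))

  concat-∼ : ∀ n {U V : Word (Word A)} → WordIso (∼-setoid n) U V →
             concat U ∼[ n ] concat V
  concat-∼ n p s len =
    mk⇔ (concat-⊑ n p len) (concat-⊑ n (≅-sym (∼-setoid n) p) len)

-- The perfect shuffle {x₀,…,xₚ₋₁}^η, as an explicit word of domain ℚ: the
-- reduced fraction n/d carries x_c, where c = ⌊log₂ d⌋ mod p.  Any other
-- perfect shuffle of the same letters is isomorphic to this one.
shuffle : ∀ {a} {A : Set a} {p} .{{_ : NonZero p}} → Vector A p → Word A
shuffle {p = p} x = word ℚ-order (λ q → x (⌊log₂ ↧ₙ q ⌋ ℕ.mod p))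

private
  odd-coprime-2^ : ∀ {a} → ¬ (2 ℕ.∣ a) → ∀ k → ℕ.Coprime a (2 ℕ.^ k)
  odd-coprime-2^ odd zero    (_ , d∣1) = ℕ.∣1⇒≡1 d∣1
  odd-coprime-2^ {a} odd (suc k) {d} (d∣a , d∣2^) =
    odd-coprime-2^ odd k (d∣a , ℕ.coprime-divisor coprime₂ d∣2^)
    where
    coprime₂ : ℕ.Coprime d 2
    coprime₂ {zero}            (_ , 0∣2) with ℕ.0∣⇒≡0 0∣2
    ... | ()
    coprime₂ {suc zero}        _         = refl
    coprime₂ {suc (suc zero)}  (2∣d , _) = ⊥-elim (odd (ℕ.∣-trans 2∣d d∣a))
    coprime₂ {suc (suc (suc _))} (_ , e∣2) with ℕ.∣⇒≤ e∣2
    ... | ℕ.s≤s (ℕ.s≤s ())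

  2b+3-odd : ∀ b → ¬ (2 ℕ.∣ ℤ.∣ + 2 ℤ.* b ℤ.+ + 3 ∣)
  2b+3-odd b h with ℤ∣.∣⇒∣ᵤ (ℤ∣.∣m+n∣m⇒∣n {+ 2} {+ 2 ℤ.* b} {+ 3}
                     (ℤ∣.∣ᵤ⇒∣ h) (ℤ∣.∣m⇒∣m*n {+ 2} {+ 2} b ℤ∣.∣-refl))
  ... | d = ℕ.even≢odd (ℕ.quotient d) 1
              (trans (ℕ.*-comm 2 (ℕ.quotient d)) (sym (ℕ._∣_.equality d)))

  n<2^n : ∀ n → n ℕ.< 2 ℕ.^ n
  n<2^n zero    = ℕ.s≤s ℕ.z≤n
  n<2^n (suc n) = begin-strict
    suc n                     ≡⟨ ℕ.+-comm 1 n ⟩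
    n ℕ.+ 1                   <⟨ ℕ.+-mono-<-≤ (n<2^n n) (ℕ.m^n>0 2 n) ⟩
    2 ℕ.^ n ℕ.+ 2 ℕ.^ n       ≡⟨ cong (2 ℕ.^ n ℕ.+_) (ℕ.+-identityʳ _) ⟨
    2 ℕ.^ suc n               ∎
    where open ℕ.≤-Reasoning

  module Between (n n′ : ℤ) (d d′ : ℕ) .{{_ : NonZero d}} .{{_ : NonZero d′}} (K : ℕ)
                 (n/d<n′/d′ : n ℤ.* + d′ ℤ.< n′ ℤ.* + d) (large : 3 ℕ.* (d ℕ.* d′) ℕ.< 2 ℕ.* K) where
    ρ : ℕ
    ρ = (n ℤ.* + K) ℤ.%ℕ d

    b : ℤ
    b = (n ℤ.* + K) ℤ./ℕ d

    div : n ℤ.* + K ≡ + ρ ℤ.+ b ℤ.* + d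
    div = ℤ.a≡a%ℕn+[a/ℕn]*n (n ℤ.* + K) d

    a : ℤ
    a = + 2 ℤ.* b ℤ.+ + 3

    lower : n ℤ.* + (2 ℕ.* K) ℤ.< a ℤ.* + d
    lower = begin-strict
      n ℤ.* + (2 ℕ.* K)                           ≡⟨ cong (n ℤ.*_) (ℤ.pos-* 2 K) ⟩
      n ℤ.* (+ 2 ℤ.* + K)                         ≡⟨ eq₁ n (+ K) ⟩
      + 2 ℤ.* (n ℤ.* + K)                         ≡⟨ cong (+ 2 ℤ.*_) div ⟩
      + 2 ℤ.* (+ ρ ℤ.+ b ℤ.* + d)                 ≡⟨ eq₂ (+ ρ) b (+ d) ⟩
      + 2 ℤ.* + ρ ℤ.+ + 2 ℤ.* b ℤ.* + d           ≡⟨ cong (ℤ._+ + 2 ℤ.* b ℤ.* + d) (ℤ.pos-* 2 ρ) ⟨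
      + (2 ℕ.* ρ) ℤ.+ + 2 ℤ.* b ℤ.* + d           <⟨ ℤ.+-monoˡ-< (+ 2 ℤ.* b ℤ.* + d) (ℤ.+<+ 2ρ<3d) ⟩
      + (3 ℕ.* d) ℤ.+ + 2 ℤ.* b ℤ.* + d           ≡⟨ cong (ℤ._+ + 2 ℤ.* b ℤ.* + d) (ℤ.pos-* 3 d) ⟩
      + 3 ℤ.* + d ℤ.+ + 2 ℤ.* b ℤ.* + d           ≡⟨ eq₃ b (+ d) ⟩
      a ℤ.* + d                                   ∎
      where
      open ℤ.≤-Reasoning
      2ρ<3d : 2 ℕ.* ρ ℕ.< 3 ℕ.* d
      2ρ<3d = ℕ.<-≤-trans (ℕ.*-monoʳ-< 2 (ℤ.n%ℕd<d (n ℤ.* + K) d)) (ℕ.*-monoˡ-≤ d (ℕ.n≤1+n 2))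
      eq₁ : ∀ x y → x ℤ.* (+ 2 ℤ.* y) ≡ + 2 ℤ.* (x ℤ.* y)
      eq₁ = solve-∀
      eq₂ : ∀ r b d → + 2 ℤ.* (r ℤ.+ b ℤ.* d) ≡ + 2 ℤ.* r ℤ.+ + 2 ℤ.* b ℤ.* d
      eq₂ = solve-∀
      eq₃ : ∀ b d → + 3 ℤ.* d ℤ.+ + 2 ℤ.* b ℤ.* d ≡ (+ 2 ℤ.* b ℤ.+ + 3) ℤ.* d
      eq₃ = solve-∀

    upper : a ℤ.* + d′ ℤ.< n′ ℤ.* + (2 ℕ.* K)
    upper = ℤ.*-cancelʳ-<-nonNeg (+ d) (begin-strict
      a ℤ.* + d′ ℤ.* + d                                          ≡⟨ eq₁ b (+ d) (+ d′) ⟩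
      B ℤ.+ + 3 ℤ.* (+ d ℤ.* + d′)                                ≡⟨ cong (λ t → B ℤ.+ + 3 ℤ.* t) (ℤ.pos-* d d′) ⟨
      B ℤ.+ + 3 ℤ.* + (d ℕ.* d′)                                  ≡⟨ cong (λ t → B ℤ.+ t) (ℤ.pos-* 3 (d ℕ.* d′)) ⟨
      B ℤ.+ + (3 ℕ.* (d ℕ.* d′))                                  <⟨ ℤ.+-monoʳ-< B (ℤ.+<+ (ℕ.<-≤-trans large (ℕ.m≤m+n _ _))) ⟩
      B ℤ.+ (+ (2 ℕ.* K) ℤ.+ + (2 ℕ.* ρ ℕ.* d′))                  ≡⟨ cong (λ t → B ℤ.+ (+ (2 ℕ.* K) ℤ.+ t)) (trans (ℤ.pos-* (2 ℕ.* ρ) d′) (cong (ℤ._* + d′) (ℤ.pos-* 2 ρ))) ⟩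
      B ℤ.+ (+ (2 ℕ.* K) ℤ.+ + 2 ℤ.* + ρ ℤ.* + d′)                ≡⟨ cong (λ t → B ℤ.+ (t ℤ.+ + 2 ℤ.* + ρ ℤ.* + d′)) (ℤ.pos-* 2 K) ⟩
      B ℤ.+ (+ 2 ℤ.* + K ℤ.+ + 2 ℤ.* + ρ ℤ.* + d′)                ≡⟨ eq₂ b (+ d) (+ d′) (+ K) (+ ρ) ⟩
      + 2 ℤ.* (+ ρ ℤ.+ b ℤ.* + d) ℤ.* + d′ ℤ.+ + 2 ℤ.* + K        ≡⟨ cong (λ t → + 2 ℤ.* t ℤ.* + d′ ℤ.+ + 2 ℤ.* + K) div ⟨
      + 2 ℤ.* (n ℤ.* + K) ℤ.* + d′ ℤ.+ + 2 ℤ.* + K                ≡⟨ eq₃ n (+ d′) (+ K) ⟩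
      + 2 ℤ.* + K ℤ.* (+ 1 ℤ.+ n ℤ.* + d′)                        ≡⟨ cong (ℤ._* (+ 1 ℤ.+ n ℤ.* + d′)) (ℤ.pos-* 2 K) ⟨
      + (2 ℕ.* K) ℤ.* (+ 1 ℤ.+ n ℤ.* + d′)                        ≤⟨ ℤ.*-monoˡ-≤-nonNeg (+ (2 ℕ.* K)) (ℤ.i<j⇒suc[i]≤j n/d<n′/d′) ⟩
      + (2 ℕ.* K) ℤ.* (n′ ℤ.* + d)                                ≡⟨ eq₄ n′ (+ d) (+ (2 ℕ.* K)) ⟩
      n′ ℤ.* + (2 ℕ.* K) ℤ.* + d                                  ∎)
      where
      open ℤ.≤-Reasoning
      B : ℤ
      B = + 2 ℤ.* (b ℤ.* + d) ℤ.* + d′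
      eq₁ : ∀ b d d′ → (+ 2 ℤ.* b ℤ.+ + 3) ℤ.* d′ ℤ.* d ≡ + 2 ℤ.* (b ℤ.* d) ℤ.* d′ ℤ.+ + 3 ℤ.* (d ℤ.* d′)
      eq₁ = solve-∀
      eq₂ : ∀ b d d′ K ρ → + 2 ℤ.* (b ℤ.* d) ℤ.* d′ ℤ.+ (+ 2 ℤ.* K ℤ.+ + 2 ℤ.* ρ ℤ.* d′)
                         ≡ + 2 ℤ.* (ρ ℤ.+ b ℤ.* d) ℤ.* d′ ℤ.+ + 2 ℤ.* K
      eq₂ = solve-∀
      eq₃ : ∀ n d′ K → + 2 ℤ.* (n ℤ.* K) ℤ.* d′ ℤ.+ + 2 ℤ.* K ≡ + 2 ℤ.* K ℤ.* (+ 1 ℤ.+ n ℤ.* d′)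
      eq₃ = solve-∀
      eq₄ : ∀ n d K → K ℤ.* (n ℤ.* d) ≡ n ℤ.* K ℤ.* d
      eq₄ = solve-∀

-- Every interval with at least two points contains every letter.
shuffle-dense : ∀ {a} {A : Set a} {p} .{{_ : NonZero p}} (x : Vector A p) {q r : ℚ} → q ℚ.< r →
                ∀ i → ∃ λ s → q ℚ.< s × s ℚ.< r × letter (shuffle x) s ≡ x i
shuffle-dense {p = p@(suc p′)} x {q} {r} (ℚ.*<* lt) i = s , ℚ.*<* lower′ , ℚ.*<* upper′ , cong x colour
  where
  d = ↧ₙ q
  d′ = ↧ₙ r
  N = 3 ℕ.* (d ℕ.* d′)
  m = p′ ℕ.+ N ℕ.* p ℕ.+ toℕ i
  k = suc m
  K = 2 ℕ.^ m

  N≤k : N ℕ.≤ k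
  N≤k = begin
    N                             ≤⟨ ℕ.m≤m*n N p ⟩
    N ℕ.* p                       ≤⟨ ℕ.m≤n+m (N ℕ.* p) p ⟩
    p ℕ.+ N ℕ.* p                 ≤⟨ ℕ.m≤m+n (p ℕ.+ N ℕ.* p) (toℕ i) ⟩
    k                             ∎
    where open ℕ.≤-Reasoning

  open Between (↥ q) (↥ r) d d′ K lt (ℕ.≤-<-trans N≤k (n<2^n k))

  2K≡ : suc (ℕ.pred (2 ℕ.* K)) ≡ 2 ℕ.* K
  2K≡ = ℕ.suc-pred (2 ℕ.* K) {{ℕ.m^n≢0 2 k}}

  s : ℚ
  s = mkℚ a (ℕ.pred (2 ℕ.* K)) (subst (ℕ.Coprime ℤ.∣ a ∣) (sym 2K≡) (odd-coprime-2^ (2b+3-odd b) k))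

  lower′ : ↥ q ℤ.* ↧ s ℤ.< a ℤ.* ↧ q
  lower′ = subst (λ t → ↥ q ℤ.* + t ℤ.< a ℤ.* ↧ q) (sym 2K≡) lower

  upper′ : a ℤ.* ↧ r ℤ.< ↥ r ℤ.* ↧ s
  upper′ = subst (λ t → a ℤ.* ↧ r ℤ.< ↥ r ℤ.* + t) (sym 2K≡) upper

  colour : ⌊log₂ ↧ₙ s ⌋ ℕ.mod p ≡ i
  colour = Fin.toℕ-injective (begin
    toℕ (⌊log₂ ↧ₙ s ⌋ ℕ.mod p)         ≡⟨ Fin.toℕ-fromℕ< _ ⟩
    ⌊log₂ ↧ₙ s ⌋ ℕ.% p                 ≡⟨ cong (λ t → ⌊log₂ t ⌋ ℕ.% p) 2K≡ ⟩
    ⌊log₂ 2 ℕ.^ k ⌋ ℕ.% p              ≡⟨ cong (ℕ._% p) (⌊log₂[2^n]⌋≡n k) ⟩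
    k ℕ.% p                            ≡⟨ cong (ℕ._% p) (ℕ.+-comm (suc N ℕ.* p) (toℕ i)) ⟩
    (toℕ i ℕ.+ suc N ℕ.* p) ℕ.% p      ≡⟨ ℕ.[m+kn]%n≡m%n (toℕ i) (suc N) p ⟩
    toℕ i ℕ.% p                        ≡⟨ ℕ.m<n⇒m%n≡m (Fin.toℕ<n i) ⟩
    toℕ i                              ∎)
    where open ≡-Reasoning

-- A finite ⊛-algebra and the ⊛-monoid inducing it determine each other, so
-- notions about finite ⊛-algebras are stated for ⊛-monoids.
record ⊛Monoid (c ℓ : Level) : Set (lsuc (c ⊔ ℓ ⊔ lsuc 0ℓ)) where
  field
    setoid : Setoid c ℓ
  open Setoid setoid public using (Carrier; _≈_)
  field
    π           : Word Carrier → Carrier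
    π-cong      : ∀ {u v} → WordIso setoid u v → π u ≈ π v
    π-singleton : ∀ a → π (finWord (a ∷ [])) ≈ a
    π-assoc     : ∀ (α : CountableOrder) (u : Pos α → Word Carrier) →
                  π (∏ α u) ≈ π (word α (π ∘ u))

  rawMonoid : RawMonoid c ℓ
  rawMonoid = record
    { Carrier = Carrier
    ; _≈_     = _≈_
    ; _∙_     = λ a b → π (finWord (a ∷ b ∷ []))
    ; ε       = π ε
    }
  open RawMonoid rawMonoid public using (_∙_) renaming (ε to identity)
  open Algebra.Definitions.RawMonoid rawMonoid public using ()
    renaming (_×_ to power; sum to product)
  open Algebra.Definitions _≈_ public using (_IdempotentOn_)

  -- {x₀,…,xₚ₋₁}^κ; repetitions in x are allowed.
  κ : ∀ {p} .{{_ : NonZero p}} → Vector Carrier p → Carrier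
  κ x = π (shuffle x)

  -- e is m^!, the idempotent among m, m², m³, …
  record IsIdempotentPower (m e : Carrier) : Set ℓ where
    field
      exponent   : ℕ
      isPower    : e ≈ power (suc exponent) m
      idempotent : _∙_ IdempotentOn e

  ShufflePowerTrivial : Set (c ⊔ ℓ)
  ShufflePowerTrivial = ∀ {p} .{{_ : NonZero p}} (x : Vector Carrier p) →
                        IsIdempotentPower (product x) (κ x)

IsFinite : ∀ {c ℓ} → Setoid c ℓ → Set (c ⊔ ℓ)
IsFinite S = ∃[ n ] Inverse S (≡.setoid (Fin n))

record Morphism {c₁ ℓ₁ c₂ ℓ₂} (M : ⊛Monoid c₁ ℓ₁) (N : ⊛Monoid c₂ ℓ₂) :
                Set (lsuc 0ℓ ⊔ c₁ ⊔ ℓ₁ ⊔ c₂ ⊔ ℓ₂) where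
  private
    module M = ⊛Monoid M
    module N = ⊛Monoid N
  field
    ⟦_⟧     : M.Carrier → N.Carrier
    ⟦⟧-cong : ∀ {x y} → x M.≈ y → ⟦ x ⟧ N.≈ ⟦ y ⟧
    π-homo  : ∀ w → ⟦ M.π w ⟧ N.≈ N.π (mapʷ ⟦_⟧ w)

Free : ∀ {a} → Set a → ⊛Monoid (lsuc 0ℓ ⊔ a) a
Free A = record
  { setoid      = wordSetoid (≡.setoid A)
  ; π           = concat
  ; π-cong      = concat-cong
  ; π-singleton = concat-singleton
  ; π-assoc     = concat-∏
  }

𝐒 : ∀ {a} → Set a → ℕ → ⊛Monoid (lsuc 0ℓ ⊔ a) (lsuc 0ℓ ⊔ a)
𝐒 A n = record
  { setoid      = ∼-setoid {A = A} n
  ; π           = concat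
  ; π-cong      = concat-∼ n
  ; π-singleton = λ w → ≅⇒∼ n (concat-singleton w)
  ; π-assoc     = λ α U → ≅⇒∼ n (concat-∏ α U)
  }

quotientMorphism : ∀ {a} (A : Set a) n → Morphism (Free A) (𝐒 A n)
quotientMorphism A n = record
  { ⟦_⟧     = id
  ; ⟦⟧-cong = ≅⇒∼ n
  ; π-homo  = λ w → ≅⇒∼ n (≅-refl _)
  }

record Sub⊛Monoid {c ℓ} (M : ⊛Monoid c ℓ) p : Set (lsuc (0ℓ ⊔ p) ⊔ c ⊔ ℓ) where
  open ⊛Monoid M
  field
    member   : Pred Carrier p
    respects : ∀ {x y} → x ≈ y → member x → member y
    π-closed : ∀ w → (∀ i → member (letter w i)) → member (π w)

  ⊛monoid : ⊛Monoid (c ⊔ p) ℓ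
  ⊛monoid = record
    { setoid      = record
        { Carrier       = ∃ member
        ; _≈_           = λ x y → proj₁ x ≈ proj₁ y
        ; isEquivalence = record
            { refl = S.refl ; sym = S.sym ; trans = S.trans }
        }
    ; π           = π′
    ; π-cong      = λ p → π-cong record
        { to                 = WordIso.to p
        ; isOrderIsomorphism = WordIso.isOrderIsomorphism p
        ; letters            = WordIso.letters p
        }
    ; π-singleton = λ (a , _) → S.trans
        (π-cong (mkIso setoid id id (λ y → y , refl) (λ { zero → S.refl })))
        (π-singleton a)
    ; π-assoc     = λ α u → π-assoc α (mapʷ proj₁ ∘ u)
    }
    where
    module S = Setoid setoid
    π′ : Word (∃ member) → ∃ member
    π′ w = π (mapʷ proj₁ w) , π-closed (mapʷ proj₁ w) (proj₂ ∘ letter w)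

record _Divides_ {c₁ ℓ₁ c₂ ℓ₂} (M : ⊛Monoid c₁ ℓ₁) (N : ⊛Monoid c₂ ℓ₂) :
                 Set (lsuc (0ℓ ⊔ c₂) ⊔ c₁ ⊔ ℓ₁ ⊔ ℓ₂) where
  field
    sub        : Sub⊛Monoid N c₂
    morphism   : Morphism (Sub⊛Monoid.⊛monoid sub) M
    surjective : Surjective (⊛Monoid._≈_ (Sub⊛Monoid.⊛monoid sub)) (⊛Monoid._≈_ M)
                   (Morphism.⟦_⟧ morphism)

record Language (A : Set) ℓ : Set (lsuc (0ℓ ⊔ ℓ)) where
  field
    member   : Pred (Word A) ℓ
    respects : ∀ {u v} → u ≅ v → member u → member v

module _ {A : Set} {ℓ} (L : Language A ℓ) where
  open Language L

  -- L = h⁻¹(h(L))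
  RecognizedVia : ∀ {c ℓ′} {M : ⊛Monoid c ℓ′} → Morphism (Free A) M → Set (lsuc 0ℓ ⊔ ℓ ⊔ ℓ′)
  RecognizedVia {M = M} h = member ≐ ⟦_⟧ ⊢ λ m → ∃ λ v → member v × ⟦ v ⟧ ≈ m
    where
    open ⊛Monoid M using (_≈_)
    open Morphism h

  RecognizedBy : ∀ {c ℓ′} → ⊛Monoid c ℓ′ → Set (lsuc 0ℓ ⊔ ℓ ⊔ c ⊔ ℓ′)
  RecognizedBy M = ∃ λ (h : Morphism (Free A) M) → RecognizedVia h

  Regular : Set (lsuc (lsuc 0ℓ) ⊔ ℓ)
  Regular = ∃ λ (M : ⊛Monoid 0ℓ 0ℓ) → IsFinite (⊛Monoid.setoid M) × RecognizedBy M

  -- These properties determine M up to isomorphism.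
  record IsSyntactic (M : ⊛Monoid 0ℓ 0ℓ) : Set (lsuc (lsuc 0ℓ) ⊔ ℓ) where
    field
      finite     : IsFinite (⊛Monoid.setoid M)
      recognizes : RecognizedBy M
      divides    : ∀ (N : ⊛Monoid 0ℓ 0ℓ) → RecognizedBy N → M Divides N

  RecognizedByFiniteShufflePowerTrivial : Set (lsuc (lsuc 0ℓ) ⊔ ℓ)
  RecognizedByFiniteShufflePowerTrivial = ∃ λ (M : ⊛Monoid 0ℓ 0ℓ) →
    IsFinite (⊛Monoid.setoid M) × ⊛Monoid.ShufflePowerTrivial M × RecognizedBy M

  RecognizedByQuotient : Set (lsuc 0ℓ ⊔ ℓ)
  RecognizedByQuotient = ∃ λ n → RecognizedVia (quotientMorphism A n)

  -- The syntactic algebra is given by a definite description: it exists, and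
  -- whatever satisfies the description is shuffle-power-trivial.
  SyntacticShufflePowerTrivial : Set (lsuc (lsuc 0ℓ) ⊔ ℓ)
  SyntacticShufflePowerTrivial =
    ∃ IsSyntactic × (∀ M → IsSyntactic M → ⊛Monoid.ShufflePowerTrivial M)

infix  8 _<′_
infix  7 ¬′_
infixr 6 _∧′_
infixr 5 _∨′_

-- Formulas with n free variables, as de Bruijn indices.
data Formula (A : Set) (n : ℕ) : Set where
  _<′_      : Fin n → Fin n → Formula A n
  letterAt  : A → Fin n → Formula A n
  ¬′_       : Formula A n → Formula A n
  _∧′_ _∨′_ : Formula A n → Formula A n → Formula A n
  ∃′_       : Formula A (suc n) → Formula A n

Sentence : Set → Set
Sentence A = Formula A 0

data QuantifierFree {A n} : Pred (Formula A n) 0ℓ where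
  _<′_     : ∀ x y → QuantifierFree (x <′ y)
  letterAt : ∀ a x → QuantifierFree (letterAt a x)
  ¬′_      : ∀ {φ} → QuantifierFree φ → QuantifierFree (¬′ φ)
  _∧′_     : ∀ {φ ψ} → QuantifierFree φ → QuantifierFree ψ → QuantifierFree (φ ∧′ ψ)
  _∨′_     : ∀ {φ ψ} → QuantifierFree φ → QuantifierFree ψ → QuantifierFree (φ ∨′ ψ)

∃* : ∀ {A} k → Formula A k → Sentence A
∃* zero    φ = φ
∃* (suc k) φ = ∃* k (∃′ φ)

data BooleanExistential {A} : Pred (Sentence A) 0ℓ where
  block : ∀ k {φ} → QuantifierFree φ → BooleanExistential (∃* k φ)
  ¬′_   : ∀ {φ} → BooleanExistential φ → BooleanExistential (¬′ φ)
  _∧′_  : ∀ {φ ψ} → BooleanExistential φ → BooleanExistential ψ → BooleanExistential (φ ∧′ ψ)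
  _∨′_  : ∀ {φ ψ} → BooleanExistential φ → BooleanExistential ψ → BooleanExistential (φ ∨′ ψ)

infix 4 _,_⊨_

_,_⊨_ : ∀ {A n} (w : Word A) → Vector (Pos (dom w)) n → Formula A n → Set
w , ρ ⊨ x <′ y       = CountableOrder._<_ (dom w) (ρ x) (ρ y)
w , ρ ⊨ letterAt a x = letter w (ρ x) ≡ a
w , ρ ⊨ ¬′ φ         = ¬ (w , ρ ⊨ φ)
w , ρ ⊨ φ ∧′ ψ       = (w , ρ ⊨ φ) × (w , ρ ⊨ ψ)
w , ρ ⊨ φ ∨′ ψ       = (w , ρ ⊨ φ) ⊎ (w , ρ ⊨ ψ)
w , ρ ⊨ ∃′ φ         = ∃ λ x → w , (x ∷ ρ) ⊨ φ

DefinableInBooleanExistential : ∀ {A ℓ} → Language A ℓ → Set (lsuc 0ℓ ⊔ ℓ)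
DefinableInBooleanExistential L =
  ∃ λ φ → BooleanExistential φ × Language.member L ≐ (λ w → w , [] ⊨ φ)

{-# OPTIONS --safe #-}

-- In a shuffle-power-trivial algebra, {x, y}^κ is a power of xy and of yx that absorbs x and y; hence
-- the product is R- and L-trivial and e^τ = e = e^τ* for idempotents e.  It follows that a submonoid G
-- of a finite shuffle-power-trivial algebra contains the value of every countable word over G.  As 𝐒ₙ
-- is itself finite and shuffle-power-trivial, applying this to M × 𝐒ₙ and the submonoid generated by
-- the letters replaces a countable word by a finite word with the same value in M and the same subwords
-- of length at most n, and (1) ⇒ (2) becomes Simon's theorem on finite words.  The sets of words with
-- given short subwords are the atoms of B(∃*), and shuffle-power-triviality passes to divisors.
module Submission where

open import Defs
open import Axiom.ExcludedMiddle using (ExcludedMiddle)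
open import Data.Product.Base using (_×_)
open import Function.Bundles using (_⇔_)

open import Algebra.Bundles using (Monoid)
import Algebra.Properties.Monoid.Mult
open import Data.Empty using (⊥; ⊥-elim)
open import Data.Fin.Base as Fin using (Fin; zero; suc; toℕ)
import Data.Fin.Properties as Fin
open import Data.Fin.Subset as Subset using (Subset; ∣_∣)
import Data.Fin.Subset.Properties as Subset
open import Data.Irrelevant using ([_])
open import Data.List.Base as List using (List; []; _∷_; _++_; cartesianProductWith; foldr; length)
open import Data.List.Membership.Propositional using (_∈_; _∉_)
open import Data.List.Membership.Propositional.Properties using (∈-allFin; ∈-cartesianProductWith⁺; ∈-map⁺)
import Data.List.Properties as List
open import Data.List.Relation.Binary.Sublist.Propositional using (_⊆_; []; _∷ʳ_; _∷_; minimum; ⊆-refl; ⊆-trans)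
open import Data.List.Relation.Binary.Sublist.Propositional.Properties using (All-resp-⊆; ++⁺ˡ)
open import Data.List.Relation.Unary.All as All using (All; []; _∷_)
open import Data.List.Relation.Unary.Any as Any using (here; there)
import Data.List.Relation.Unary.Any.Properties as Any
open import Data.Maybe.Base using (Maybe; just; nothing; maybe′)
open import Data.Nat.Base as ℕ using (ℕ; zero; suc; NonZero; z≤n; s≤s)
open import Data.Nat.Induction using (<-rec)
import Data.Nat.Properties as ℕ
open import Data.Product.Base using (Σ; ∃; _,_; proj₁; proj₂)
open import Data.Product.Relation.Binary.Pointwise.NonDependent using (×-setoid)
open import Data.Rational.Base as ℚ using (ℚ; 0ℚ; 1ℚ)
import Data.Rational.Properties as ℚ
open import Data.Refinement using (Refinement; _,_; value)
open import Data.Refinement.Properties using (value-injective)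
open import Data.Sum.Base using (_⊎_; inj₁; inj₂; reduce)
open import Data.Unit.Base using (⊤; tt)
import Data.Vec.Base as Vec
import Data.Vec.Functional as V
import Data.Vec.Properties as Vec
open V using (Vector)
open import Function.Base using (_∘_; id)
open import Function.Bundles using (Equivalence; Injection; Inverse; mk↣; mk⇔)
import Function.Construct.Identity as Identity
import Function.Properties.Equivalence as ⇔
open import Level using (0ℓ; _⊔_) renaming (suc to lsuc)
open import Relation.Binary.Bundles using (Setoid)
open import Relation.Binary.Core using (Rel)
open import Relation.Binary.Definitions
  using (Reflexive; Symmetric; Total; Transitive; Trichotomous; tri<; tri≈; tri>)
open import Relation.Binary.PropositionalEquality
  using (_≡_; _≢_; refl; sym; trans; cong; subst; subst₂)
import Relation.Binary.PropositionalEquality as ≡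
import Relation.Binary.Reasoning.Setoid
open import Relation.Binary.Structures.Biased using (isStrictTotalOrderᶜ)
open import Relation.Nullary using (¬_; Dec; yes; no; contradiction; does)
open import Relation.Nullary.Decidable using (True; decidable-stable; dec-true; fromWitness; recompute; toWitness)
open import Relation.Unary using (Pred)

-- The product with `𝐒 A n` is there because a single finite word must imitate a countable word in
-- both respects; finite words chosen separately for `M` and for `𝐒 A n` would be unrelated. The
-- number `n` is known beforehand: it is the sum of the bounds on strict R-chains and strict
-- L-chains in `M`, since the subwords compared consist of a prefix of the letters that change
-- prefix values and a suffix of the letters that change suffix values.
--
-- The fourth condition includes the existence of the syntactic algebra, so it has to be built. In a
-- countable product infinitely many factors may change at once, which finitely many replacements
-- through one-hole contexts cannot achieve. Contexts therefore have arbitrarily many holes, and the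
-- finiteness of some recognising algebra leaves finitely many kinds of factor to replace.
--
-- Words form a type in `Set₁`, whereas the algebras asked for are small; finite algebras are
-- therefore copied onto `Fin`, and subsets described by words are resized by excluded middle.

module _ (em : ∀ {i} → ExcludedMiddle i) where

  -- Excluded middle resizes every proposition to the lowest universe.
  Small : ∀ {p} → Set p → Set
  Small P = True (em {P = P})

  small : ∀ {p} {P : Set p} → P → Small P
  small = fromWitness

  unsmall : ∀ {p} {P : Set p} → Small P → P
  unsmall = toWitness

  byContradiction : ∀ {p} {P : Set p} → ¬ ¬ P → P
  byContradiction = decidable-stable em

  -- Membership in a subset is stored irrelevantly; as excluded middle decides it, `recompute`
  -- returns a proof that can be used.
  holds : ∀ {a p} {A : Set a} {P : Pred A p} (x : Refinement A P) → P (value x)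
  holds (x , [ h ]) = recompute em h

  least : ∀ {p} (P : Pred ℕ p) → ∃ P → ∃ λ n → P n × (∀ m → P m → n ℕ.≤ m)
  least P (n , h) = <-rec (λ n → P n → ∃ λ n → P n × (∀ m → P m → n ℕ.≤ m)) step n h
    where
    step : ∀ n → (∀ {m} → m ℕ.< n → P m → _) → P n → _
    step n rec h with em {P = ∃ λ m → m ℕ.< n × P m}
    ... | yes (m , m<n , h′) = rec m<n h′
    ... | no none = n , h , λ m h′ → ℕ.≮⇒≥ λ m<n → none (m , m<n , h′)

  code : (α : CountableOrder) → Pos α → ℕ
  code α = Injection.to (CountableOrder.countable α)

  -- Linear orders, restrictions and fibres of words

  module Order (α : CountableOrder) where
    open CountableOrder α public hiding (Carrier)

    infix 4 _≤_
    _≤_ : Pos α → Pos α → Set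
    x ≤ y = ¬ y < x

    ≤-refl : ∀ {x} → x ≤ x
    ≤-refl = irrefl refl

    <⇒≤ : ∀ {x y} → x < y → x ≤ y
    <⇒≤ = asym

    ≤⇒<∨≡ : ∀ {x y} → x ≤ y → x < y ⊎ x ≡ y
    ≤⇒<∨≡ {x} {y} x≤y with compare x y
    ... | tri< a _ _ = inj₁ a
    ... | tri≈ _ b _ = inj₂ b
    ... | tri> _ _ c = contradiction c x≤y

    <-≤-trans : ∀ {x y z} → x < y → y ≤ z → x < z
    <-≤-trans p q with ≤⇒<∨≡ q
    ... | inj₁ r = <-trans p r
    ... | inj₂ refl = p

    ≤-<-trans : ∀ {x y z} → x ≤ y → y < z → x < z
    ≤-<-trans p q with ≤⇒<∨≡ p
    ... | inj₁ r = <-trans r q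
    ... | inj₂ refl = q

    ≤-trans : ∀ {x y z} → x ≤ y → y ≤ z → x ≤ z
    ≤-trans p q r = p (≤-<-trans q r)

    <-or-≥ : ∀ x y → x < y ⊎ y ≤ x
    <-or-≥ x y with em {P = x < y}
    ... | yes p = inj₁ p
    ... | no p = inj₂ p

    total : ∀ x y → x ≤ y ⊎ y ≤ x
    total x y with <-or-≥ x y
    ... | inj₁ p = inj₁ (<⇒≤ p)
    ... | inj₂ p = inj₂ p

    ≤-antisym : ∀ {x y} → x ≤ y → y ≤ x → x ≡ y
    ≤-antisym p q with ≤⇒<∨≡ p
    ... | inj₁ r = contradiction r q
    ... | inj₂ r = r

    code-injective : ∀ {x y} → code α x ≡ code α y → x ≡ y
    code-injective = Injection.injective countable

  module _ {a ℓ} (S : Setoid a ℓ) where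
    private module S = Setoid S

    ↾-iso : ∀ {u w : Word S.Carrier} {P : Pred (Pos (dom w)) 0ℓ} (f : Pos (dom u) → Pos (dom w)) →
            (∀ {x y} → CountableOrder._<_ (dom u) x y → CountableOrder._<_ (dom w) (f x) (f y)) →
            (∀ x → P (f x)) → (∀ y → P y → ∃ λ x → f x ≡ y) →
            (∀ x → letter u x S.≈ letter w (f x)) → WordIso S u (w ↾ P)
    ↾-iso f f-mono f∈P f-surj f-letters =
      mkIso S (λ x → f x , [ f∈P x ]) f-mono
        (λ y → proj₁ (f-surj (value y) (holds y)) , value-injective (proj₂ (f-surj (value y) (holds y))))
        f-letters

    ↾-cong : ∀ {w : Word S.Carrier} {P Q : Pred (Pos (dom w)) 0ℓ} →
             (∀ {x} → P x → Q x) → (∀ {x} → Q x → P x) → WordIso S (w ↾ P) (w ↾ Q)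
    ↾-cong P⊆Q Q⊆P = ↾-iso value id (λ x → P⊆Q (holds x)) (λ y h → (y , [ Q⊆P h ]) , refl) (λ _ → S.refl)

    ↾-↾ : ∀ {w : Word S.Carrier} {P : Pred (Pos (dom w)) 0ℓ} {Q : Pred (Pos (dom (w ↾ P))) 0ℓ}
          {R : Pred (Pos (dom w)) 0ℓ} →
          (∀ x → Q x → R (value x)) → (∀ x → R x → Σ (P x) λ p → Q (x , [ p ])) →
          WordIso S ((w ↾ P) ↾ Q) (w ↾ R)
    ↾-↾ Q⊆R R⊆Q = ↾-iso (value ∘ value) id (λ x → Q⊆R (value x) (holds x))
      (λ y r → ((y , [ proj₁ (R⊆Q y r) ]) , [ proj₂ (R⊆Q y r) ]) , refl) (λ _ → S.refl)

    -- Generalised associativity is applied through this: a weakly increasing map into a countable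
    -- order cuts the word into factors. An index outside the range of the map contributes an empty
    -- factor.
    fibers : ∀ (w : Word S.Carrier) (α : CountableOrder) (f : Pos (dom w) → Pos α) →
             (∀ {x y} → CountableOrder._<_ (dom w) x y → Order._≤_ α (f x) (f y)) →
             WordIso S w (∏ α (λ i → w ↾ (λ x → f x ≡ i)))
    fibers w α f f-mono = mkIso S (λ x → f x , x , [ refl ]) mono surj (λ _ → S.refl)
      where
      module w = CountableOrder (dom w)
      module α = Order α
      inner′ : ∀ {i j x y} (p : f x ≡ i) (q : f y ≡ j) → i ≡ j → x w.< y →
               CountableOrder._<_ (dom (∏ α (λ i → w ↾ (λ x → f x ≡ i)))) (i , x , [ p ]) (j , y , [ q ])
      inner′ p q refl lt = inner lt
      mono : ∀ {x y} → x w.< y →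
             CountableOrder._<_ (dom (∏ α (λ i → w ↾ (λ x → f x ≡ i)))) (f x , x , [ refl ]) (f y , y , [ refl ])
      mono lt with α.≤⇒<∨≡ (f-mono lt)
      ... | inj₁ p = outer p
      ... | inj₂ p = inner′ refl refl p lt
      surj : ∀ (y : Σ (Pos α) λ i → Refinement (Pos (dom w)) (λ x → f x ≡ i)) →
             ∃ λ x → (f x , x , [ refl ]) ≡ y
      surj (i , x , [ h ]) with recompute (em {P = f x ≡ i}) h
      ... | refl = x , refl

  map-iso : ∀ {a b ℓ} {A : Set a} (S : Setoid b ℓ) (f : A → Setoid.Carrier S) {u v : Word A} →
            u ≅ v → WordIso S (mapʷ f u) (mapʷ f v)
  map-iso S f p = record
    { to = WordIso.to p
    ; isOrderIsomorphism = WordIso.isOrderIsomorphism p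
    ; letters = λ x → Setoid.reflexive S (cong f (WordIso.letters p x))
    }

  -- Uniqueness of perfect shuffles

  record DenselyColoured {c d} {C : Set c} (D : Pred C d) (w : Word C) : Set (c ⊔ d) where
    open CountableOrder (dom w)
    field
      colours   : ∀ x → D (letter w x)
      -- The other fields hold vacuously of the empty word.
      inhabited : ∀ {c} → D c → ∃ λ z → letter w z ≡ c
      below     : ∀ x {c} → D c → ∃ λ z → z < x × letter w z ≡ c
      above     : ∀ x {c} → D c → ∃ λ z → x < z × letter w z ≡ c
      between   : ∀ {x y} → x < y → ∀ {c} → D c → ∃ λ z → x < z × z < y × letter w z ≡ c

  shuffle-densely : ∀ {c d} {C : Set c} {D : Pred C d} {p} .{{_ : NonZero p}} (x : Vector C p) →
                    (∀ i → D (x i)) → (∀ {c} → D c → ∃ λ i → x i ≡ c) → DenselyColoured D (shuffle x)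
  shuffle-densely {p = p} x x∈D D⊆x = record
    { colours   = λ _ → x∈D _
    ; inhabited = λ h → let z , _ , _ , e = shuffle-dense x (ℚ.positive⁻¹ 1ℚ) (proj₁ (D⊆x h))
                        in z , trans e (proj₂ (D⊆x h))
    ; below     = λ q h → let z , _ , l , e = shuffle-dense x (q-1<q q) (proj₁ (D⊆x h))
                          in z , l , trans e (proj₂ (D⊆x h))
    ; above     = λ q h → let z , l , _ , e = shuffle-dense x (q<q+1 q) (proj₁ (D⊆x h))
                          in z , l , trans e (proj₂ (D⊆x h))
    ; between   = λ lt h → let z , l , r , e = shuffle-dense x lt (proj₁ (D⊆x h))
                           in z , l , r , trans e (proj₂ (D⊆x h))
    }
    where
    q<q+1 : ∀ q → q ℚ.< q ℚ.+ 1ℚ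
    q<q+1 q = subst (ℚ._< q ℚ.+ 1ℚ) (ℚ.+-identityʳ q) (ℚ.+-monoʳ-< q (ℚ.positive⁻¹ 1ℚ))
    q-1<q : ∀ q → q ℚ.+ ℚ.- 1ℚ ℚ.< q
    q-1<q q = subst (q ℚ.+ ℚ.- 1ℚ ℚ.<_) (ℚ.+-identityʳ q) (ℚ.+-monoʳ-< q (ℚ.negative⁻¹ (ℚ.- 1ℚ)))

  -- Any total transitive relation is allowed, so that the reversed order yields a least index;
  -- `reduce` extracts reflexivity from totality.
  greatest : ∀ {a r p} {X : Set a} {_≲_ : Rel X r} → Total _≲_ → Transitive _≲_ →
             ∀ n (g : Fin n → X) (P : Pred (Fin n) p) →
             (∀ i → ¬ P i) ⊎ ∃ λ i → P i × (∀ j → P j → g j ≲ g i)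
  greatest total trans zero g P = inj₁ λ ()
  greatest {_≲_ = _≲_} total trans (suc n) g P
    with greatest total trans n (g ∘ suc) (P ∘ suc) | em {P = P zero}
  ... | inj₁ none | no ¬p = inj₁ λ { zero → ¬p ; (suc i) → none i }
  ... | inj₁ none | yes p = inj₂ (zero , p , λ { zero _ → reduce (total (g zero) (g zero)) ; (suc i) h → contradiction h (none i) })
  ... | inj₂ (i , h , max) | no ¬p = inj₂ (suc i , h , λ { zero p → contradiction p ¬p ; (suc j) → max j })
  ... | inj₂ (i , h , max) | yes p with total (g zero) (g (suc i))
  ...   | inj₁ 0≲i = inj₂ (suc i , h , λ { zero _ → 0≲i ; (suc j) → max j })
  ...   | inj₂ i≲0 = inj₂ (zero , p , λ { zero _ → reduce (total (g zero) (g zero)) ; (suc j) k → trans (max j k) i≲0 })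

  module _ {c} {C : Set c} where

    -- Finitely many pairs, in any order and possibly repeated. Injectivity follows from `mono` by
    -- linearity, which is what `flip` uses.
    record PartialIso (u v : Word C) : Set c where
      private
        module u = CountableOrder (dom u)
        module v = CountableOrder (dom v)
      field
        size    : ℕ
        source  : Fin size → Pos (dom u)
        target  : Fin size → Pos (dom v)
        mono    : ∀ i j → source i u.< source j → target i v.< target j
        match   : ∀ i j → source i ≡ source j → target i ≡ target j
        letters : ∀ i → letter u (source i) ≡ letter v (target i)

      Relates : Pos (dom u) → Pos (dom v) → Set
      Relates x y = ∃ λ i → source i ≡ x × target i ≡ y

    open PartialIso

    infix 4 _⊂_
    _⊂_ : ∀ {u v} → PartialIso u v → PartialIso u v → Set
    p ⊂ q = ∀ {x y} → Relates p x y → Relates q x y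

    flip : ∀ {u v} → PartialIso u v → PartialIso v u
    flip {u} {v} p = record
      { size    = size p
      ; source  = target p
      ; target  = source p
      ; mono    = mono′
      ; match   = match′
      ; letters = sym ∘ letters p
      }
      where
      module u = CountableOrder (dom u)
      module v = CountableOrder (dom v)
      mono′ : ∀ i j → target p i v.< target p j → source p i u.< source p j
      mono′ i j lt with u.compare (source p i) (source p j)
      ... | tri< a _ _ = a
      ... | tri≈ _ b _ = contradiction lt (v.irrefl (match p i j b))
      ... | tri> _ _ c = contradiction lt (v.asym (mono p j i c))
      match′ : ∀ i j → target p i ≡ target p j → source p i ≡ source p j
      match′ i j eq with u.compare (source p i) (source p j)
      ... | tri< a _ _ = contradiction (mono p i j a) (v.irrefl eq)
      ... | tri≈ _ b _ = b
      ... | tri> _ _ c = contradiction (mono p j i c) (v.irrefl (sym eq))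

    module _ {d} {D : Pred C d} where

      -- The image of `x` has to lie above the images of the points left of `x` and below those of
      -- the points right of it. Only the greatest of the former and the least of the latter matter;
      -- according to which of them exist, a field of `DenselyColoured` supplies a point of the
      -- right colour.
      extend : ∀ {u v} → (∀ x → D (letter u x)) → DenselyColoured D v →
               (p : PartialIso u v) (x : Pos (dom u)) → ∃ λ q → p ⊂ q × ∃ (Relates q x)
      extend {u} {v} u∈D dv p x with em {P = ∃ λ i → source p i ≡ x}
      ... | yes (i , eq) = p , id , target p i , i , eq , refl
      ... | no fresh = q , (λ (i , e) → suc i , e) , y , zero , refl , refl
        where
        module u = Order (dom u)
        module v = Order (dom v)
        module dv = DenselyColoured dv
        insertion : ∃ λ y → (∀ i → source p i u.< x → target p i v.< y) ×
                            (∀ i → x u.< source p i → y v.< target p i) × letter v y ≡ letter u x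
        insertion with greatest v.total v.≤-trans (size p) (target p) (λ i → source p i u.< x)
                     | greatest (λ a b → v.total b a) (λ a b → v.≤-trans b a) (size p) (target p) (λ i → x u.< source p i)
        ... | inj₁ noL | inj₁ noU =
          let z , e = dv.inhabited (u∈D x)
          in z , (λ i h → contradiction h (noL i)) , (λ i h → contradiction h (noU i)) , e
        ... | inj₁ noL | inj₂ (j , hj , minU) =
          let z , l , e = dv.below (target p j) (u∈D x)
          in z , (λ i h → contradiction h (noL i)) , (λ i h → v.<-≤-trans l (minU i h)) , e
        ... | inj₂ (i , hi , maxL) | inj₁ noU =
          let z , l , e = dv.above (target p i) (u∈D x)
          in z , (λ k h → v.≤-<-trans (maxL k h) l) , (λ k h → contradiction h (noU k)) , e
        ... | inj₂ (i , hi , maxL) | inj₂ (j , hj , minU) =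
          let z , l , r , e = dv.between (mono p i j (u.<-trans hi hj)) (u∈D x)
          in z , (λ k h → v.≤-<-trans (maxL k h) l) , (λ k h → v.<-≤-trans r (minU k h)) , e

        y : Pos (dom v)
        y = proj₁ insertion

        q : PartialIso u v
        q = record
          { size    = suc (size p)
          ; source  = x V.∷ source p
          ; target  = y V.∷ target p
          ; mono    = λ { zero zero lt → contradiction lt (u.irrefl refl)
                        ; zero (suc j) → proj₁ (proj₂ (proj₂ insertion)) j
                        ; (suc i) zero → proj₁ (proj₂ insertion) i
                        ; (suc i) (suc j) → mono p i j }
          ; match   = λ { zero zero _ → refl
                        ; zero (suc j) e → contradiction (j , sym e) fresh
                        ; (suc i) zero e → contradiction (i , e) fresh
                        ; (suc i) (suc j) → match p i j }
          ; letters = λ { zero → sym (proj₂ (proj₂ (proj₂ insertion))) ; (suc i) → letters p i }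
          }

      extendAt : ∀ {u v} → (∀ x → D (letter u x)) → DenselyColoured D v → (n : ℕ) (p : PartialIso u v) →
                 ∃ λ q → p ⊂ q × (∀ x → code (dom u) x ≡ n → ∃ (Relates q x))
      extendAt {u} u∈D dv n p with em {P = ∃ λ x → code (dom u) x ≡ n}
      ... | no none = p , id , λ x e → contradiction (x , e) none
      ... | yes (x , refl) with extend u∈D dv p x
      ...   | q , sub , y , r = q , sub , λ x′ e →
        subst (λ x → ∃ (Relates q x)) (sym (Order.code-injective (dom u) e)) (y , r)

      -- Cantor's back-and-forth argument.
      densely-coloured-unique : ∀ {u v} → DenselyColoured D u → DenselyColoured D v → u ≅ v
      densely-coloured-unique {u} {v} du dv = mkIso _ to to-mono to-surj to-letters
        where
        module u = CountableOrder (dom u)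
        module v = CountableOrder (dom v)
        module du = DenselyColoured du
        module dv = DenselyColoured dv

        forth : ∀ n (p : PartialIso u v) → _
        forth n p = extendAt du.colours dv n p
        back : ∀ n (p : PartialIso v u) → _
        back n p = extendAt dv.colours du n p

        stage : ℕ → PartialIso u v
        stage zero = record
          { size = 0 ; source = λ () ; target = λ () ; mono = λ () ; match = λ () ; letters = λ () }
        stage (suc n) = flip (proj₁ (back n (flip (proj₁ (forth n (stage n))))))

        swapped : ∀ {u v x y} {p : PartialIso u v} → Relates p x y → Relates (flip p) y x
        swapped (i , a , b) = i , b , a

        forth⊂stage : ∀ n → proj₁ (forth n (stage n)) ⊂ stage (suc n)
        forth⊂stage n {x} {y} r =
          let r₁ = proj₁ (proj₂ (back n (flip (proj₁ (forth n (stage n)))))) (swapped {p = proj₁ (forth n (stage n))} r)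
          in proj₁ r₁ , proj₂ (proj₂ r₁) , proj₁ (proj₂ r₁)

        grow : ∀ n → stage n ⊂ stage (suc n)
        grow n r = forth⊂stage n (proj₁ (proj₂ (forth n (stage n))) r)

        grow* : ∀ {m n} → m ℕ.≤′ n → stage m ⊂ stage n
        grow* (ℕ.≤′-reflexive refl) r = r
        grow* (ℕ.≤′-step m≤n) r = grow _ (grow* m≤n r)

        image : ∀ x → ∃ λ y → ∃ λ n → Relates (stage n) x y
        image x = let y , r = proj₂ (proj₂ (forth _ (stage (code (dom u) x)))) x refl
                  in y , suc (code (dom u) x) , forth⊂stage _ r

        preimage : ∀ y → ∃ λ x → ∃ λ n → Relates (stage n) x y
        preimage y = let x , i , a , b = proj₂ (proj₂ (back _ (flip (proj₁ (forth n (stage n)))))) y refl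
                     in x , suc n , i , b , a
          where n = code (dom v) y

        to : Pos (dom u) → Pos (dom v)
        to x = proj₁ (image x)

        compatible : ∀ {x y x′ y′} m n → Relates (stage m) x y → Relates (stage n) x′ y′ →
                     (x u.< x′ → y v.< y′) × (x ≡ x′ → y ≡ y′)
        compatible m n r r′ with grow* (ℕ.≤⇒≤′ (ℕ.m≤m⊔n m n)) r | grow* (ℕ.≤⇒≤′ (ℕ.m≤n⊔m m n)) r′
        ... | i , refl , refl | j , refl , refl = mono (stage (m ℕ.⊔ n)) i j , match (stage (m ℕ.⊔ n)) i j

        to-mono : ∀ {x x′} → x u.< x′ → to x v.< to x′
        to-mono {x} {x′} = let _ , m , r = image x ; _ , n , r′ = image x′ in proj₁ (compatible m n r r′)

        to-surj : ∀ y → ∃ λ x → to x ≡ y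
        to-surj y = let x , n , r = preimage y ; _ , m , r′ = image x in x , proj₂ (compatible m n r′ r) refl

        to-letters : ∀ x → letter u x ≡ letter v (to x)
        to-letters x = let _ , n , r = image x in preserves (stage n) r
          where
          preserves : ∀ (p : PartialIso u v) {x y} → Relates p x y → letter u x ≡ letter v y
          preserves p (i , refl , refl) = letters p i

  module _ {a ℓ} (S : Setoid a ℓ) where
    private module S = Setoid S

    letterwise : ∀ {α} {u v : Pos α → S.Carrier} → (∀ i → u i S.≈ v i) → WordIso S (word α u) (word α v)
    letterwise eq = mkIso S id id (λ y → y , refl) eq

    from-≅ : ∀ {u v : Word S.Carrier} → u ≅ v → WordIso S u v
    from-≅ = map-iso S id

  -- The monoid laws, from generalised associativity

  module MonoidLaws {c ℓ} (M : ⊛Monoid c ℓ) where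
    open ⊛Monoid M
    module S = Setoid setoid

    π-letterwise : ∀ {α} {u v : Pos α → Carrier} → (∀ i → u i ≈ v i) → π (word α u) ≈ π (word α v)
    π-letterwise eq = π-cong (letterwise setoid eq)

    ∙-cong : ∀ {a b c d} → a ≈ b → c ≈ d → a ∙ c ≈ b ∙ d
    ∙-cong p q = π-letterwise λ { zero → p ; (suc zero) → q }

    π-fibers : ∀ (w : Word Carrier) (α : CountableOrder) (f : Pos (dom w) → Pos α) →
               (∀ {x y} → CountableOrder._<_ (dom w) x y → Order._≤_ α (f x) (f y)) →
               π w ≈ π (word α (λ i → π (w ↾ (λ x → f x ≡ i))))
    π-fibers w α f f-mono = S.trans (π-cong (fibers setoid w α f f-mono)) (π-assoc α _)

    -- The case of two fibres, from which the unit and associative laws follow. `P` and `Q` are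
    -- disjoint because no position precedes itself.
    π-split : ∀ (w : Word Carrier) {P Q : Pred (Pos (dom w)) 0ℓ} → (∀ x → P x ⊎ Q x) →
              (∀ {x y} → P x → Q y → CountableOrder._<_ (dom w) x y) →
              π w ≈ π (w ↾ P) ∙ π (w ↾ Q)
    π-split w {P} {Q} cover P<Q = S.trans (π-fibers w (finOrder 2) side side-mono)
      (π-letterwise λ
        { zero → π-cong (↾-cong setoid (λ {x} → side≡0 x) (λ {x} → P⇒side x))
        ; (suc zero) → π-cong (↾-cong setoid (λ {x} → side≡1 x) (λ {x} → Q⇒side x)) })
      where
      module w = CountableOrder (dom w)
      side : Pos (dom w) → Fin 2
      side x with em {P = P x}
      ... | yes _ = zero
      ... | no _ = suc zero
      side≡0 : ∀ x → side x ≡ zero → P x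
      side≡0 x eq with em {P = P x} | eq
      ... | yes p | _ = p
      ... | no _ | ()
      side≡1 : ∀ x → side x ≡ suc zero → Q x
      side≡1 x eq with em {P = P x} | cover x | eq
      ... | yes _ | _ | ()
      ... | no ¬p | inj₁ p | _ = contradiction p ¬p
      ... | no ¬p | inj₂ q | _ = q
      P⇒side : ∀ x → P x → side x ≡ zero
      P⇒side x p with em {P = P x}
      ... | yes _ = refl
      ... | no ¬p = contradiction p ¬p
      Q⇒side : ∀ x → Q x → side x ≡ suc zero
      Q⇒side x q with em {P = P x}
      ... | yes p = contradiction (P<Q p q) (w.irrefl refl)
      ... | no _ = refl
      side-mono : ∀ {x y} → x w.< y → ¬ side y Fin.< side x
      side-mono {x} {y} lt h with em {P = P x} | em {P = P y} | cover x
      ... | yes _ | yes _ | _ = contradiction h λ ()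
      ... | yes _ | no _  | _ = contradiction h λ ()
      ... | no _ | no _ | _ = contradiction h λ { (s≤s ()) }
      ... | no ¬p | yes p | inj₁ p′ = ¬p p′
      ... | no _ | yes p | inj₂ q = w.asym lt (P<Q p q)

    π-empty : ∀ {w} → ¬ Pos (dom w) → π w ≈ identity
    π-empty none = π-cong (mkIso setoid (λ x → ⊥-elim (none x)) (λ {x} → ⊥-elim (none x)) (λ ()) (λ x → ⊥-elim (none x)))

    π-one : ∀ {w} (x : Pos (dom w)) → (∀ y → y ≡ x) → π w ≈ letter w x
    π-one {w} x unique = S.trans
      (S.sym (π-cong {finWord (letter w x V.∷ V.[])} (mkIso setoid (λ _ → x) (λ { {zero} {zero} () })
        (λ y → zero , sym (unique y)) λ { zero → S.refl })))
      (π-singleton _)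

    π-cons : ∀ {n} (v : Vector Carrier (suc n)) → π (finWord v) ≈ v zero ∙ π (finWord (v ∘ suc))
    π-cons v = S.trans
      (π-split (finWord v) {_≡ zero} {λ i → ∃ λ j → suc j ≡ i}
        (λ { zero → inj₁ refl ; (suc j) → inj₂ (j , refl) })
        (λ { refl (_ , refl) → s≤s z≤n }))
      (∙-cong
        (π-one (zero , [ refl ]) λ y → value-injective (holds y))
        (S.sym (π-cong (↾-iso setoid {u = finWord (v ∘ suc)} suc s≤s (λ j → j , refl) (λ _ → id) (λ _ → S.refl)))))

    identityʳ : ∀ a → a ∙ identity ≈ a
    identityʳ a = S.trans (∙-cong S.refl (π-empty λ ()))
      (S.trans (S.sym (π-cons (a V.∷ V.[]))) (π-singleton a))

    identityˡ : ∀ a → identity ∙ a ≈ a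
    identityˡ a = S.sym (S.trans (S.sym (π-singleton a)) (S.trans
      (π-split (finWord (a V.∷ V.[])) {λ _ → ⊥} {λ _ → ⊤} (λ _ → inj₂ tt) (λ ()))
      (∙-cong (π-empty λ x → holds x)
        (S.trans (S.sym (π-cong (↾-iso setoid {u = finWord (a V.∷ V.[])} id id (λ _ → tt) (λ y _ → y , refl) (λ _ → S.refl))))
          (π-singleton a)))))

    -- Both bracketings come from cutting the three-letter word, after its second letter and after
    -- its first.
    assoc : ∀ a b c → (a ∙ b) ∙ c ≈ a ∙ (b ∙ c)
    assoc a b c = S.trans (S.sym (S.trans
      (π-split (finWord (a V.∷ b V.∷ c V.∷ V.[])) {λ i → ∃ λ (j : Fin 2) → Fin.inject₁ j ≡ i} {_≡ suc (suc zero)}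
        (λ { zero → inj₁ (zero , refl) ; (suc zero) → inj₁ (suc zero , refl) ; (suc (suc zero)) → inj₂ refl })
        (λ { (zero , refl) refl → s≤s z≤n ; (suc zero , refl) refl → s≤s (s≤s z≤n) }))
      (∙-cong
        (S.sym (π-cong (↾-iso setoid {u = finWord (a V.∷ b V.∷ V.[])} Fin.inject₁
          (λ {x} {y} → subst₂ ℕ._<_ (sym (Fin.toℕ-inject₁ x)) (sym (Fin.toℕ-inject₁ y)))
          (λ j → j , refl) (λ _ → id) (λ { zero → S.refl ; (suc zero) → S.refl }))))
        (S.trans (S.sym (π-cong (↾-iso setoid {u = finWord (c V.∷ V.[])} (λ _ → suc (suc zero))
          (λ { {zero} {zero} () }) (λ _ → refl) (λ y e → zero , sym e) (λ { zero → S.refl }))))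
          (π-singleton c)))))
      (S.trans (π-cons _) (∙-cong S.refl (π-letterwise λ { zero → S.refl ; (suc zero) → S.refl })))

    monoid : Monoid c ℓ
    monoid = record
      { Carrier  = Carrier
      ; _≈_      = _≈_
      ; _∙_      = _∙_
      ; ε        = identity
      ; isMonoid = record
          { isSemigroup = record
              { isMagma = record { isEquivalence = S.isEquivalence ; ∙-cong = ∙-cong }
              ; assoc   = assoc
              }
          ; identity = identityˡ , identityʳ
          }
      }

    open Algebra.Properties.Monoid.Mult monoid public
      using (×-congʳ; ×-assocˡ; ×-homo-+)

    π-finWord : ∀ {n} (v : Vector Carrier n) → π (finWord v) ≈ product v
    π-finWord {zero} v = π-empty λ ()
    π-finWord {suc n} v = S.trans (π-cons v) (∙-cong S.refl (π-finWord (v ∘ suc)))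

    product-cong : ∀ {n} {u v : Vector Carrier n} → (∀ i → u i ≈ v i) → product u ≈ product v
    product-cong {zero} eq = S.refl
    product-cong {suc n} eq = ∙-cong (eq zero) (product-cong (eq ∘ suc))

    power-idempotent : ∀ {e} → _∙_ IdempotentOn e → ∀ n → power (suc n) e ≈ e
    power-idempotent idem zero = identityʳ _
    power-idempotent idem (suc n) = S.trans (∙-cong S.refl (power-idempotent idem n)) idem

    power-absorbˡ : ∀ {a b} → a ∙ b ≈ a → ∀ n → a ∙ power n b ≈ a
    power-absorbˡ eq zero = identityʳ _
    power-absorbˡ eq (suc n) = S.trans (S.sym (assoc _ _ _)) (S.trans (∙-cong eq S.refl) (power-absorbˡ eq n))

    power-absorbʳ : ∀ {a b} → b ∙ a ≈ a → ∀ n → power n b ∙ a ≈ a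
    power-absorbʳ eq zero = identityˡ _
    power-absorbʳ eq (suc n) = S.trans (assoc _ _ _) (S.trans (∙-cong S.refl (power-absorbʳ eq n)) eq)

    power-slide : ∀ c d n → d ∙ power n (c ∙ d) ≈ power n (d ∙ c) ∙ d
    power-slide c d zero = S.trans (identityʳ d) (S.sym (identityˡ d))
    power-slide c d (suc n) = begin
      d ∙ ((c ∙ d) ∙ power n (c ∙ d)) ≈⟨ assoc _ _ _ ⟨
      (d ∙ (c ∙ d)) ∙ power n (c ∙ d) ≈⟨ ∙-cong (S.sym (assoc _ _ _)) S.refl ⟩
      ((d ∙ c) ∙ d) ∙ power n (c ∙ d) ≈⟨ assoc _ _ _ ⟩
      (d ∙ c) ∙ (d ∙ power n (c ∙ d)) ≈⟨ ∙-cong S.refl (power-slide c d n) ⟩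
      (d ∙ c) ∙ (power n (d ∙ c) ∙ d) ≈⟨ assoc _ _ _ ⟨
      ((d ∙ c) ∙ power n (d ∙ c)) ∙ d ∎
      where open Relation.Binary.Reasoning.Setoid setoid

    isIdempotentPower-cong : ∀ {m m′ e e′} → m ≈ m′ → e ≈ e′ → IsIdempotentPower m e → IsIdempotentPower m′ e′
    isIdempotentPower-cong {e = e} {e′} p q h = record
      { exponent   = h.exponent
      ; isPower    = S.trans (S.sym q) (S.trans h.isPower (×-congʳ (suc h.exponent) p))
      ; idempotent = S.trans (∙-cong {e′} {e} {e′} {e} (S.sym q) (S.sym q)) (S.trans h.idempotent q)
      }
      where module h = IsIdempotentPower h

  -- Morphisms and submonoids

  module MorphismLaws {c₁ ℓ₁ c₂ ℓ₂} {M : ⊛Monoid c₁ ℓ₁} {N : ⊛Monoid c₂ ℓ₂} (f : Morphism M N) where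
    private
      module M = ⊛Monoid M
      module N = ⊛Monoid N
      module NL = MonoidLaws N
    open Morphism f
    open NL using (module S)

    ∙-homo : ∀ a b → ⟦ a M.∙ b ⟧ N.≈ ⟦ a ⟧ N.∙ ⟦ b ⟧
    ∙-homo a b = S.trans (π-homo _) (NL.π-letterwise λ { zero → S.refl ; (suc zero) → S.refl })

    identity-homo : ⟦ M.identity ⟧ N.≈ N.identity
    identity-homo = S.trans (π-homo _) (NL.π-empty λ ())

    power-homo : ∀ n a → ⟦ M.power n a ⟧ N.≈ N.power n ⟦ a ⟧
    power-homo zero a = identity-homo
    power-homo (suc n) a = S.trans (∙-homo _ _) (NL.∙-cong S.refl (power-homo n a))

    product-homo : ∀ {n} (v : Vector M.Carrier n) → ⟦ M.product v ⟧ N.≈ N.product (⟦_⟧ ∘ v)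
    product-homo {zero} v = identity-homo
    product-homo {suc n} v = S.trans (∙-homo _ _) (NL.∙-cong S.refl (product-homo (v ∘ suc)))

    isIdempotentPower-homo : ∀ {m e} → M.IsIdempotentPower m e → N.IsIdempotentPower ⟦ m ⟧ ⟦ e ⟧
    isIdempotentPower-homo {m} {e} h = record
      { exponent   = h.exponent
      ; isPower    = S.trans (⟦⟧-cong h.isPower) (power-homo (suc h.exponent) m)
      ; idempotent = S.trans (S.sym (∙-homo e e)) (⟦⟧-cong h.idempotent)
      }
      where module h = M.IsIdempotentPower h

    shufflePower-homo : ∀ {p} .{{_ : NonZero p}} (x : Vector M.Carrier p) →
                        M.IsIdempotentPower (M.product x) (M.κ x) →
                        N.IsIdempotentPower (N.product (⟦_⟧ ∘ x)) (N.κ (⟦_⟧ ∘ x))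
    shufflePower-homo x h =
      NL.isIdempotentPower-cong (product-homo x) (π-homo _) (isIdempotentPower-homo h)

  -- Closed under finite products only; `Condensation` derives closure under all countable products
  -- when the algebra is finite and shuffle-power-trivial.
  record IsSubmonoid {c ℓ g} (M : ⊛Monoid c ℓ) (G : Pred (⊛Monoid.Carrier M) g) : Set (c ⊔ ℓ ⊔ g) where
    open ⊛Monoid M
    field
      respects : ∀ {x y} → x ≈ y → G x → G y
      ∙-closed : ∀ {x y} → G x → G y → G (x ∙ y)
      ε-closed : G identity

    product-closed : ∀ {n} {v : Vector Carrier n} → (∀ i → G (v i)) → G (product v)
    product-closed {zero} h = ε-closed
    product-closed {suc n} h = ∙-closed (h zero) (product-closed (h ∘ suc))

    power-closed : ∀ n {x} → G x → G (power n x)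
    power-closed zero h = ε-closed
    power-closed (suc n) h = ∙-closed h (power-closed n h)

  -- What the limit argument and the argument on finite words use of shuffle-power-triviality, in a
  -- form symmetric under reversal: `opposite-tame` exchanges the two trivialities.
  record Tame {c ℓ} (M : ⊛Monoid c ℓ) : Set (lsuc 0ℓ ⊔ c ⊔ ℓ) where
    open ⊛Monoid M
    field
      finite    : IsFinite setoid
      R-trivial : ∀ {a b c d} → a ≈ b ∙ c → b ≈ a ∙ d → a ≈ b
      L-trivial : ∀ {a b c d} → a ≈ c ∙ b → b ≈ d ∙ a → a ≈ b
      π-const   : ∀ ξ → Pos ξ → ∀ {e} → _∙_ IdempotentOn e → π (word ξ λ _ → e) ≈ e

  -- Consequences of shuffle-power-triviality

  module _ {c ℓ} {M : ⊛Monoid c ℓ} (spt : ⊛Monoid.ShufflePowerTrivial M) where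
    open ⊛Monoid M
    open MonoidLaws M
    open Relation.Binary.Reasoning.Setoid setoid

    private
      Image : ∀ {p} → Vector Carrier p → Pred Carrier c
      Image x c = ∃ λ i → x i ≡ c

      image-shuffle : ∀ {p} .{{_ : NonZero p}} (x : Vector Carrier p) → DenselyColoured (Image x) (shuffle x)
      image-shuffle x = shuffle-densely x (λ i → i , refl) id

    κ-unique : ∀ {p} .{{_ : NonZero p}} (x : Vector Carrier p) {w} → DenselyColoured (Image x) w → π w ≈ κ x
    κ-unique x d = π-cong (from-≅ setoid (densely-coloured-unique d (image-shuffle x)))

    -- Copies of a perfect shuffle along any nonempty order form a perfect shuffle again. A copy has
    -- no end points, so whatever is needed next to a point is found inside its own copy.
    κ-const : ∀ ξ → Pos ξ → ∀ {p} .{{_ : NonZero p}} (x : Vector Carrier p) → π (word ξ λ _ → κ x) ≈ κ x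
    κ-const ξ i₀ x = S.trans (S.sym (π-assoc ξ (λ _ → shuffle x))) (κ-unique x record
      { colours   = λ (i , q) → d.colours q
      ; inhabited = λ h → let z , e = d.inhabited h in (i₀ , z) , e
      ; below     = λ (i , q) h → let z , l , e = d.below q h in (i , z) , inner l , e
      ; above     = λ (i , q) h → let z , l , e = d.above q h in (i , z) , inner l , e
      ; between   = λ { {i , q} (outer lt) h → let z , l , e = d.above q h in (i , z) , inner l , outer lt , e
                      ; {i , q} (inner lt) h → let z , l , r , e = d.between lt h in (i , z) , inner l , inner r , e }
      })
      where module d = DenselyColoured (image-shuffle x)

    -- A single letter placed between two copies of the shuffle leaves it a perfect shuffle, since
    -- both copies are open on the side of that letter.
    κ-absorbs : ∀ {p} .{{_ : NonZero p}} (x : Vector Carrier p) i → κ x ∙ (x i ∙ κ x) ≈ κ x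
    κ-absorbs x i = begin
      κ x ∙ (x i ∙ κ x)                       ≈⟨ ∙-cong S.refl (∙-cong (S.sym (π-singleton _)) (S.sym (identityʳ _))) ⟩
      product (λ j → π (U j))                 ≈⟨ π-finWord _ ⟨
      π (finWord (λ j → π (U j)))             ≈⟨ π-assoc (finOrder 3) U ⟨
      π (∏ (finOrder 3) U)                    ≈⟨ κ-unique x dense ⟩
      κ x                                     ∎
      where
      module d = DenselyColoured (image-shuffle x)
      U : Vector (Word Carrier) 3
      U = shuffle x V.∷ finWord (x i V.∷ V.[]) V.∷ shuffle x V.∷ V.[]
      0<1 : zero {2} Fin.< suc {2} zero
      0<1 = s≤s z≤n
      1<2 : suc {2} zero Fin.< suc {2} (suc zero)
      1<2 = s≤s (s≤s z≤n)
      dense : DenselyColoured (Image x) (∏ (finOrder 3) U)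
      dense = record
        { colours   = λ { (zero , q) → d.colours q ; (suc zero , zero) → i , refl ; (suc (suc zero) , q) → d.colours q }
        ; inhabited = λ h → let z , e = d.inhabited h in (zero , z) , e
        ; below     = λ { (zero , q) h → let z , l , e = d.below q h in (zero , z) , inner l , e
                        ; (suc zero , zero) h → let z , e = d.inhabited h in (zero , z) , outer 0<1 , e
                        ; (suc (suc zero) , q) h → let z , l , e = d.below q h in (suc (suc zero) , z) , inner l , e }
        ; above     = λ { (zero , q) h → let z , l , e = d.above q h in (zero , z) , inner l , e
                        ; (suc zero , zero) h → let z , e = d.inhabited h in (suc (suc zero) , z) , outer 1<2 , e
                        ; (suc (suc zero) , q) h → let z , l , e = d.above q h in (suc (suc zero) , z) , inner l , e }
        ; between   = λ {y} {z} → between {y} {z}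
        }
        where
        between : ∀ {y z} → CountableOrder._<_ (dom (∏ (finOrder 3) U)) y z → ∀ {c} → Image x c → _
        between {zero , q} (outer lt) h = let z , l , e = d.above q h in (zero , z) , inner l , outer lt , e
        between {suc zero , zero} {zero , r} (outer ()) h
        between {suc zero , zero} {suc zero , r} (outer (s≤s ())) h
        between {suc zero , zero} {suc (suc zero) , r} (outer lt) h =
          let z , l , e = d.below r h in (suc (suc zero) , z) , outer 1<2 , inner l , e
        between {suc (suc zero) , q} {zero , r} (outer ()) h
        between {suc (suc zero) , q} {suc zero , r} (outer (s≤s ())) h
        between {suc (suc zero) , q} {suc (suc zero) , r} (outer (s≤s (s≤s ()))) h
        between {zero , q} (inner lt) h = let z , l , r , e = d.between lt h in (zero , z) , inner l , inner r , e
        between {suc zero , zero} {_ , zero} (inner ()) h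
        between {suc (suc zero) , q} (inner lt) h = let z , l , r , e = d.between lt h in (suc (suc zero) , z) , inner l , inner r , e

    -- The shuffle of c and d is absorbing on the submonoid generated by c and d: it is a power of dc
    -- and of cd, hence commutes with d, while f d f ≈ f as the shuffle of c and d is dense.
    private module _ (c d : Carrier) where
      f : Carrier
      f = κ (d V.∷ c V.∷ V.[])

      module dc = IsIdempotentPower (spt (d V.∷ c V.∷ V.[]))
      module cd = IsIdempotentPower (spt (c V.∷ d V.∷ V.[]))

      f≈dcⁿ : f ≈ power (suc dc.exponent) (d ∙ c)
      f≈dcⁿ = S.trans dc.isPower (×-congʳ (suc dc.exponent) (∙-cong S.refl (identityʳ c)))

      f≈cdᵐ : f ≈ power (suc cd.exponent) (c ∙ d)
      f≈cdᵐ = S.trans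
        (S.sym (κ-unique (d V.∷ c V.∷ V.[]) (shuffle-densely (c V.∷ d V.∷ V.[])
          (λ { zero → suc zero , refl ; (suc zero) → zero , refl })
          λ { (zero , e) → suc zero , e ; (suc zero , e) → zero , e })))
        (S.trans cd.isPower (×-congʳ (suc cd.exponent) (∙-cong S.refl (identityʳ d))))

      -- The exponents obtained for `dc` and `cd` may differ. As `f` is idempotent, raising it to
      -- the other exponent turns it into the power `n * m` of either product, and `power-slide`
      -- moves `d` across.
      fd≈df : f ∙ d ≈ d ∙ f
      fd≈df = S.sym (begin
        d ∙ f                            ≈⟨ ∙-cong S.refl (S.sym (power-idempotent dc.idempotent dc.exponent)) ⟩
        d ∙ power n f                    ≈⟨ ∙-cong S.refl (×-congʳ n f≈cdᵐ) ⟩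
        d ∙ power n (power m (c ∙ d))    ≈⟨ ∙-cong S.refl (×-assocˡ _ n m) ⟩
        d ∙ power (n ℕ.* m) (c ∙ d)      ≈⟨ power-slide c d (n ℕ.* m) ⟩
        power (n ℕ.* m) (d ∙ c) ∙ d      ≈⟨ ∙-cong (S.reflexive (cong (λ k → power k (d ∙ c)) (ℕ.*-comm n m))) S.refl ⟩
        power (m ℕ.* n) (d ∙ c) ∙ d      ≈⟨ ∙-cong (×-assocˡ _ m n) S.refl ⟨
        power m (power n (d ∙ c)) ∙ d    ≈⟨ ∙-cong (×-congʳ m f≈dcⁿ) S.refl ⟨
        power m f ∙ d                    ≈⟨ ∙-cong (power-idempotent dc.idempotent cd.exponent) S.refl ⟩
        f ∙ d                            ∎)
        where
        n = suc dc.exponent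
        m = suc cd.exponent

      df≈f : d ∙ f ≈ f
      df≈f = begin
        d ∙ f             ≈⟨ ∙-cong S.refl dc.idempotent ⟨
        d ∙ (f ∙ f)       ≈⟨ assoc _ _ _ ⟨
        (d ∙ f) ∙ f       ≈⟨ ∙-cong (S.sym fd≈df) S.refl ⟩
        (f ∙ d) ∙ f       ≈⟨ assoc _ _ _ ⟩
        f ∙ (d ∙ f)       ≈⟨ κ-absorbs (d V.∷ c V.∷ V.[]) zero ⟩
        f                 ∎

    -- If `a = bc` and `b = ad`, then `dc` fixes `a` on the right, hence so does its power `f`, and
    -- `f` absorbs `d`: `b = ad = afd = af = a`. The left-hand case is dual. For an idempotent `e`
    -- the shuffle of `e` alone has value `e`, so `κ-const` becomes `π-const`.
    shufflePowerTrivial⇒tame : IsFinite setoid → Tame M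
    shufflePowerTrivial⇒tame finite = record
      { finite    = finite
      ; R-trivial = R-trivial
      ; L-trivial = L-trivial
      ; π-const   = λ ξ i {e} idem → S.trans (π-letterwise λ _ → S.sym (κe≈e idem))
                      (S.trans (κ-const ξ i (e V.∷ V.[])) (κe≈e idem))
      }
      where
      af≈a : ∀ {a} c d → a ∙ (d ∙ c) ≈ a → a ∙ f c d ≈ a
      af≈a c d eq = S.trans (∙-cong S.refl (f≈dcⁿ c d)) (power-absorbˡ eq (suc (dc.exponent c d)))
      fa≈a : ∀ {a} c d → (c ∙ d) ∙ a ≈ a → f c d ∙ a ≈ a
      fa≈a c d eq = S.trans (∙-cong (f≈cdᵐ c d) S.refl) (power-absorbʳ eq (suc (cd.exponent c d)))
      R-trivial : ∀ {a b c d} → a ≈ b ∙ c → b ≈ a ∙ d → a ≈ b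
      R-trivial {a} {b} {c} {d} a≈bc b≈ad = S.sym (begin
        b                     ≈⟨ b≈ad ⟩
        a ∙ d                 ≈⟨ ∙-cong af≈a′ S.refl ⟨
        (a ∙ f c d) ∙ d       ≈⟨ assoc _ _ _ ⟩
        a ∙ (f c d ∙ d)       ≈⟨ ∙-cong S.refl (S.trans (fd≈df c d) (df≈f c d)) ⟩
        a ∙ f c d             ≈⟨ af≈a′ ⟩
        a                     ∎)
        where
        af≈a′ : a ∙ f c d ≈ a
        af≈a′ = af≈a c d (S.trans (S.sym (assoc a d c)) (S.trans (∙-cong (S.sym b≈ad) S.refl) (S.sym a≈bc)))
      L-trivial : ∀ {a b c d} → a ≈ c ∙ b → b ≈ d ∙ a → a ≈ b
      L-trivial {a} {b} {c} {d} a≈cb b≈da = S.sym (begin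
        b                     ≈⟨ b≈da ⟩
        d ∙ a                 ≈⟨ ∙-cong S.refl fa≈a′ ⟨
        d ∙ (f c d ∙ a)       ≈⟨ assoc _ _ _ ⟨
        (d ∙ f c d) ∙ a       ≈⟨ ∙-cong (df≈f c d) S.refl ⟩
        f c d ∙ a             ≈⟨ fa≈a′ ⟩
        a                     ∎)
        where
        fa≈a′ : f c d ∙ a ≈ a
        fa≈a′ = fa≈a c d (S.trans (assoc c d a) (S.trans (∙-cong S.refl (S.sym b≈da)) (S.sym a≈cb)))
      κe≈e : ∀ {e} → _∙_ IdempotentOn e → κ (e V.∷ V.[]) ≈ e
      κe≈e {e} idem = let open IsIdempotentPower (spt (e V.∷ V.[])) in
        S.trans isPower (S.trans (×-congʳ (suc exponent) (identityʳ e)) (power-idempotent idem exponent))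

    κ-closed : ∀ {g} {G : Pred Carrier g} → IsSubmonoid M G → ∀ {p} .{{_ : NonZero p}} (x : Vector Carrier p) →
               (∀ i → G (x i)) → G (κ x)
    κ-closed G x h = respects (S.sym isPower) (power-closed (suc exponent) (product-closed h))
      where
      open IsIdempotentPower (spt x)
      open IsSubmonoid G

  -- Ranks for the R-order and the L-order

  module _ {n p} (P : Pred (Fin n) p) where
    subset : Subset n
    subset = Vec.tabulate (λ i → does (em {P = P i}))

    ∈-subset⁺ : ∀ {i} → P i → i Subset.∈ subset
    ∈-subset⁺ {i} h = Vec.lookup⇒[]= i subset (trans (Vec.lookup∘tabulate _ i) (dec-true em h))

    ∈-subset⁻ : ∀ {i} → i Subset.∈ subset → P i
    ∈-subset⁻ {i} h with em {P = P i} in eq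
    ... | yes q = q
    ... | no _ = contradiction (trans (sym (Vec.[]=⇒lookup h)) (trans (Vec.lookup∘tabulate _ i) (cong does eq))) λ ()

  module _ {a ℓ} {S : Setoid a ℓ} (finite : IsFinite S) where
    private module S = Setoid S

    -- The rank counts the elements strictly below. If `x ⊏ y`, then by transitivity everything
    -- below `x` is below `y`, and `x` itself is counted for `y` only.
    ranked : ∀ {r} (_⊏_ : Rel S.Carrier r) → (∀ {x y} → x S.≈ y → ¬ x ⊏ y) →
             (∀ {x y z} → x S.≈ y → y ⊏ z → x ⊏ z) → (∀ {x y z} → x ⊏ y → y ⊏ z → x ⊏ z) →
             ∃ λ bound → ∃ λ (rank : S.Carrier → ℕ) → (∀ x → rank x ℕ.≤ bound) ×
               (∀ {x y} → x ⊏ y → rank x ℕ.< rank y)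
    ranked _⊏_ irrefl resp trans = n , (λ x → ∣ below x ∣) , (λ x → Subset.∣p∣≤n (below x)) ,
      λ {x} {y} x⊏y → Subset.p⊂q⇒∣p∣<∣q∣
        ( (λ h → ∈-subset⁺ _ (trans (∈-subset⁻ _ h) x⊏y))
        , e.to x , ∈-subset⁺ _ (resp (e.strictlyInverseʳ x) x⊏y)
        , λ h → irrefl (e.strictlyInverseʳ x) (∈-subset⁻ _ h))
      where
      n = proj₁ finite
      module e = Inverse (proj₂ finite)
      below : S.Carrier → Subset n
      below x = subset (λ i → e.from i ⊏ x)

  module _ {c ℓ} {M : ⊛Monoid c ℓ} (tame : Tame M) where
    open ⊛Monoid M
    open MonoidLaws M
    open Tame tame

    R-rank : ∃ λ bound → ∃ λ (rank : Carrier → ℕ) → (∀ x → rank x ℕ.≤ bound) ×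
             (∀ {a b c} → a ≈ b ∙ c → ¬ a ≈ b → rank a ℕ.< rank b)
    R-rank =
      let bound , rank , ≤bound , strict = ranked finite (λ a b → ¬ a ≈ b × ∃ λ c → a ≈ b ∙ c)
            (λ eq (neq , _) → neq eq)
            (λ eq (neq , c , e) → (λ eq′ → neq (S.trans (S.sym eq) eq′)) , c , S.trans eq e)
            (λ { (neq , c , e) (neq′ , c′ , e′) →
                 (λ eq → neq (R-trivial e (S.trans e′ (∙-cong (S.sym eq) S.refl)))) ,
                 c′ ∙ c , S.trans e (S.trans (∙-cong e′ S.refl) (assoc _ _ _)) })
      in bound , rank , ≤bound , λ e neq → strict (neq , _ , e)

    -- Oriented oppositely to `R-rank`: a strict multiplication on the left raises this rank, one on
    -- the right lowers the other. So the R-rank bounds the strict steps still possible from a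
    -- value, the L-rank those that have led to it.
    L-rank : ∃ λ bound → ∃ λ (rank : Carrier → ℕ) → (∀ x → rank x ℕ.≤ bound) ×
             (∀ {a b c} → a ≈ c ∙ b → ¬ a ≈ b → rank b ℕ.< rank a)
    L-rank =
      let bound , rank , ≤bound , strict = ranked finite (λ b a → ¬ a ≈ b × ∃ λ c → a ≈ c ∙ b)
            (λ eq (neq , _) → neq (S.sym eq))
            (λ eq (neq , c , e) → (λ eq′ → neq (S.trans eq′ eq)) , c , S.trans e (∙-cong S.refl (S.sym eq)))
            (λ { (neq , c , e) (neq′ , c′ , e′) →
                 (λ eq → neq′ (L-trivial e′ (S.trans e (∙-cong S.refl (S.sym eq))))) ,
                 c′ ∙ c , S.trans e′ (S.trans (∙-cong S.refl e) (S.sym (assoc _ _ _))) })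
      in bound , rank , ≤bound , λ e neq → strict (neq , _ , e)

  -- Reversal of words and algebras

  reverseᵒ : CountableOrder → CountableOrder
  reverseᵒ α = record
    { Carrier            = α.Carrier
    ; _<_                = λ x y → y α.< x
    ; isStrictTotalOrder = isStrictTotalOrderᶜ record
        { isEquivalence = ≡.isEquivalence
        ; trans         = λ p q → α.<-trans q p
        ; compare       = cmp
        }
    ; countable          = α.countable
    }
    where
    module α = CountableOrder α
    cmp : Trichotomous _≡_ (λ x y → y α.< x)
    cmp x y with α.compare x y
    ... | tri< a b c = tri> c b a
    ... | tri≈ a b c = tri≈ c b a
    ... | tri> a b c = tri< c b a

  reverse : ∀ {a} {A : Set a} → Word A → Word A
  reverse w = word (reverseᵒ (dom w)) (letter w)

  opposite : ∀ {c ℓ} → ⊛Monoid c ℓ → ⊛Monoid c ℓ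
  opposite M = record
    { setoid      = setoid
    ; π           = π ∘ reverse
    ; π-cong      = λ p → let module p = WordIso p in
        π-cong (mkIso setoid p.to p.mono (λ y → p.from y , p.to∘from y) p.letters)
    ; π-singleton = λ a → S.trans
        (π-cong (mkIso setoid id (λ { {zero} {zero} () }) (λ y → y , refl) (λ _ → S.refl))) (π-singleton a)
    ; π-assoc     = λ α u → S.trans
        (π-cong (mkIso setoid id (λ { (outer p) → outer p ; (inner p) → inner p }) (λ y → y , refl) (λ _ → S.refl)))
        (π-assoc (reverseᵒ α) (reverse ∘ u))
    }
    where
    open ⊛Monoid M
    module S = Setoid setoid

  module _ {c ℓ} (M : ⊛Monoid c ℓ) where
    open ⊛Monoid M
    open MonoidLaws M
    private module Mᵒ = ⊛Monoid (opposite M)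

    opposite-∙ : ∀ a b → a Mᵒ.∙ b ≈ b ∙ a
    opposite-∙ a b = π-cong (mkIso setoid Fin.opposite
      (λ { {zero} {zero} () ; {suc zero} {zero} _ → s≤s z≤n ; {zero} {suc zero} () ; {suc zero} {suc zero} (s≤s ()) })
      (λ { zero → suc zero , refl ; (suc zero) → zero , refl })
      (λ { zero → S.refl ; (suc zero) → S.refl }))

    opposite-identity : Mᵒ.identity ≈ identity
    opposite-identity = π-empty λ ()

    opposite-tame : Tame M → Tame (opposite M)
    opposite-tame tame = record
      { finite    = finite
      ; R-trivial = λ p q → L-trivial (S.trans p (opposite-∙ _ _)) (S.trans q (opposite-∙ _ _))
      ; L-trivial = λ p q → R-trivial (S.trans p (opposite-∙ _ _)) (S.trans q (opposite-∙ _ _))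
      ; π-const   = λ ξ x idem → π-const (reverseᵒ ξ) x (S.trans (S.sym (opposite-∙ _ _)) idem)
      }
      where open Tame tame

    opposite-isSubmonoid : ∀ {g} {G : Pred Carrier g} → IsSubmonoid M G → IsSubmonoid (opposite M) G
    opposite-isSubmonoid sub = record
      { respects = respects
      ; ∙-closed = λ x y → respects (S.sym (opposite-∙ _ _)) (∙-closed y x)
      ; ε-closed = respects (S.sym opposite-identity) ε-closed
      }
      where open IsSubmonoid sub

    reverse-↾ : ∀ (w : Word Carrier) (P : Pred (Pos (dom w)) 0ℓ) → π (reverse (reverse w ↾ P)) ≈ π (w ↾ P)
    reverse-↾ w P = π-cong (mkIso setoid id id (λ y → y , refl) (λ _ → S.refl))

  -- Values of final and initial segments

  ℕ-order : CountableOrder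
  ℕ-order = record
    { Carrier            = ℕ
    ; _<_                = ℕ._<_
    ; isStrictTotalOrder = ℕ.<-isStrictTotalOrder
    ; countable          = mk↣ {to = id} id
    }

  module Splitting {c ℓ} (M : ⊛Monoid c ℓ) (w : Word (⊛Monoid.Carrier M)) where
    open ⊛Monoid M
    open MonoidLaws M
    open Order (dom w)

    -- Relative to a subset `R`, with the factors again restrictions of `w` itself, so that repeated
    -- cuts do not nest restrictions.
    π-split-↾ : ∀ {R P Q : Pred (Pos (dom w)) 0ℓ} → (∀ {x} → R x → P x ⊎ Q x) →
                (∀ {x} → P x → R x) → (∀ {x} → Q x → R x) → (∀ {x y} → P x → Q y → x < y) →
                π (w ↾ R) ≈ π (w ↾ P) ∙ π (w ↾ Q)
    π-split-↾ {P = P} {Q} cover P⊆R Q⊆R P<Q = S.trans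
      (π-split _ {P ∘ value} {Q ∘ value} (λ x → cover (holds x)) P<Q)
      (∙-cong (π-cong (↾-↾ setoid (λ _ → id) (λ _ h → P⊆R h , h)))
              (π-cong (↾-↾ setoid (λ _ → id) (λ _ h → Q⊆R h , h))))

    π-fibers-↾ : ∀ {R : Pred (Pos (dom w)) 0ℓ} (α : CountableOrder) (f : Pos (dom (w ↾ R)) → Pos α) →
                 (∀ {x y} → value x < value y → Order._≤_ α (f x) (f y)) →
                 (Q : Pos α → Pred (Pos (dom w)) 0ℓ) → (∀ i x → f x ≡ i → Q i (value x)) →
                 (∀ i x → Q i x → Σ (R x) λ r → f (x , [ r ]) ≡ i) →
                 π (w ↾ R) ≈ π (word α λ i → π (w ↾ Q i))
    π-fibers-↾ α f f-mono Q ⊆Q Q⊆ = S.trans (π-fibers _ α f f-mono)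
      (π-letterwise λ i → π-cong (↾-↾ setoid (⊆Q i) (Q⊆ i)))

    Ioo Ioc : Pos (dom w) → Pos (dom w) → Pred (Pos (dom w)) 0ℓ
    Ioo s t x = s < x × x < t
    Ioc s t x = s < x × x ≤ t

  module Limits {c ℓ g} {M : ⊛Monoid c ℓ} (tame : Tame M) {G : Pred (⊛Monoid.Carrier M) g} (sub : IsSubmonoid M G)
                (w : Word (⊛Monoid.Carrier M)) (letters∈G : ∀ x → G (letter w x))
                (intervals∈G : ∀ {s t} → CountableOrder._<_ (dom w) s t →
                   G (⊛Monoid.π M (w ↾ Splitting.Ioo M w s t))) where
    open ⊛Monoid M
    open MonoidLaws M
    open Tame tame
    open IsSubmonoid sub
    open Order (dom w)
    open Splitting M w

    -- Half-open intervals, so that adjacent ones fit together without a point left over.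
    val : Pos (dom w) → Pos (dom w) → Carrier
    val s t = π (w ↾ Ioc s t)

    val∈G : ∀ {s t} → s < t → G (val s t)
    val∈G {s} {t} s<t = respects
      (S.sym (π-split-↾ {P = Ioo s t} {Q = _≡ t} split (λ (a , b) → a , <⇒≤ b) (λ { refl → s<t , ≤-refl }) λ { (_ , b) refl → b }))
      (∙-closed (intervals∈G s<t)
        (respects (S.sym (π-one (t , [ refl ]) (λ y → value-injective (holds y)))) (letters∈G t)))
      where
      split : ∀ {x} → Ioc s t x → Ioo s t x ⊎ x ≡ t
      split (a , b) with ≤⇒<∨≡ b
      ... | inj₁ l = inj₁ (a , l)
      ... | inj₂ e = inj₂ e

    val-∙ : ∀ {s t u} → s < t → t < u → val s u ≈ val s t ∙ val t u
    val-∙ {s} {t} {u} s<t t<u = π-split-↾ split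
      (λ (a , b) → a , ≤-trans b (<⇒≤ t<u)) (λ (a , b) → <-trans s<t a , b) (λ (_ , b) (c , _) → ≤-<-trans b c)
      where
      split : ∀ {x} → Ioc s u x → Ioc s t x ⊎ Ioc t u x
      split {x} (a , b) with <-or-≥ t x
      ... | inj₁ l = inj₂ (l , b)
      ... | inj₂ l = inj₁ (a , l)

    module Unbounded (next : ∀ x → ∃ λ y → x < y) where

      above : ∀ x y → ∃ λ z → x < z × y < z
      above x y with <-or-≥ x y
      ... | inj₁ l = let z , h = next y in z , <-trans l h , h
      ... | inj₂ l = let z , h = next x in z , h , ≤-<-trans l h

      abstract
        -- The prefix values val s t descend in the R-order as t grows, hence stabilise.
        stabilise : ∀ s → ∃ λ t → s < t × (∀ {u} → t < u → val s u ≈ val s t)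
        stabilise s =
          let _ , rank , _ , strict = R-rank tame
              _ , (t , s<t , eq) , min = least (λ n → ∃ λ t → s < t × rank (val s t) ≡ n)
                                           (_ , proj₁ (next s) , proj₂ (next s) , refl)
          in t , s<t , λ {u} t<u → byContradiction λ neq →
               ℕ.<⇒≱ (strict (val-∙ s<t t<u) neq) (subst (ℕ._≤ _) (sym eq) (min _ (u , <-trans s<t t<u , refl)))

      stable : Pos (dom w) → Pos (dom w)
      stable s = proj₁ (stabilise s)

      lim : Pos (dom w) → Carrier
      lim s = val s (stable s)

      lim-val : ∀ {s u} → stable s < u → val s u ≈ lim s
      lim-val {s} = proj₂ (proj₂ (stabilise s))

      -- Both limits are read off at one point `u` beyond both points of stabilisation.
      lim-∙ : ∀ {s t} → s < t → lim s ≈ val s t ∙ lim t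
      lim-∙ {s} {t} s<t =
        let u , p , q = above (stable s) (stable t)
            t<u = <-trans (proj₁ (proj₂ (stabilise t))) q
        in S.trans (S.sym (lim-val p)) (S.trans (val-∙ s<t t<u) (∙-cong S.refl (lim-val q)))

      module _ (y : Pos (dom w)) where

        abstract
          -- The limits ascend in the L-order as s grows, hence are eventually constant.
          start : ∃ λ s → y < s × (∀ {t} → s < t → lim t ≈ lim s)
          start =
            let _ , rank , _ , strict = L-rank tame
                _ , (s , y<s , eq) , min = least (λ n → ∃ λ s → y < s × rank (lim s) ≡ n)
                                             (_ , proj₁ (next y) , proj₂ (next y) , refl)
            in s , y<s , λ {t} s<t → S.sym (byContradiction λ neq →
                 ℕ.<⇒≱ (strict (lim-∙ s<t) neq) (subst (ℕ._≤ _) (sym eq) (min _ (t , <-trans y<s s<t , refl))))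

        s₀ : Pos (dom w)
        s₀ = proj₁ start

        abstract
          -- Passing the position of code `n` at stage `n` makes the sequence cofinal; passing
          -- `stable x` gives each of its segments the limit value.
          step : ∀ n x → ∃ λ z → x < z × stable x < z × (∀ y → code (dom w) y ≡ n → y < z)
          step n x with em {P = ∃ λ y → code (dom w) y ≡ n}
          ... | no none = let z , p , q = above x (stable x) in z , p , q , λ y e → contradiction (y , e) none
          ... | yes (y , refl) =
            let z , p , q = above x (stable x)
                z′ , p′ , q′ = above z y
            in z′ , <-trans p p′ , <-trans q p′ , λ y′ e → subst (_< z′) (sym (code-injective e)) q′

        seq : ℕ → Pos (dom w)
        seq zero = s₀
        seq (suc n) = proj₁ (step n (seq n))

        seq-step : ∀ n → seq n < seq (suc n)
        seq-step n = proj₁ (proj₂ (step n (seq n)))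

        stable<seq : ∀ n → stable (seq n) < seq (suc n)
        stable<seq n = proj₁ (proj₂ (proj₂ (step n (seq n))))

        seq-mono : ∀ {m n} → m ℕ.≤′ n → seq m ≤ seq n
        seq-mono (ℕ.≤′-reflexive refl) = ≤-refl
        seq-mono (ℕ.≤′-step h) = ≤-trans (seq-mono h) (<⇒≤ (seq-step _))

        abstract
          -- For a position after `s₀`, the least such `n` is the index of the segment
          -- `(seq n, seq (suc n)]` that contains it.
          segment : ∀ x → ∃ λ n → x ≤ seq (suc n) × (∀ m → x ≤ seq (suc m) → n ℕ.≤ m)
          segment x = least _ (code (dom w) x ,
            <⇒≤ (proj₂ (proj₂ (proj₂ (step (code (dom w) x) (seq (code (dom w) x))))) x refl))

        index : Pos (dom w) → ℕ
        index x = proj₁ (segment x)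

        after-s₀ : π (w ↾ (s₀ <_)) ≈ π (word ℕ-order λ n → val (seq n) (seq (suc n)))
        after-s₀ = π-fibers-↾ ℕ-order (index ∘ value)
          (λ {x} {y} lt → ℕ.≤⇒≯ (proj₂ (proj₂ (segment (value x))) _
            (<⇒≤ (<-≤-trans lt (proj₁ (proj₂ (segment (value y))))))))
          (λ n → Ioc (seq n) (seq (suc n)))
          (λ { n x refl → lower (value x) (holds x) _ refl , proj₁ (proj₂ (segment (value x))) })
          (λ n x (a , b) → ≤-<-trans (seq-mono (ℕ.≤⇒≤′ (z≤n {n}))) a ,
            ℕ.≤-antisym (proj₂ (proj₂ (segment x)) n b)
              (ℕ.≮⇒≥ λ lt → proj₁ (proj₂ (segment x)) (≤-<-trans (seq-mono (ℕ.≤⇒≤′ lt)) a)))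
          where
          lower : ∀ x → s₀ < x → ∀ n → index x ≡ n → seq n < x
          lower x s₀<x zero eq = s₀<x
          lower x s₀<x (suc n) eq with <-or-≥ (seq (suc n)) x
          ... | inj₁ l = l
          ... | inj₂ l = contradiction (subst (ℕ._≤ n) eq (proj₂ (proj₂ (segment x)) n l)) ℕ.1+n≰n

        r : Carrier
        r = lim s₀

        lim-seq : ∀ n → lim (seq n) ≈ r
        lim-seq n with ≤⇒<∨≡ (seq-mono (ℕ.≤⇒≤′ (z≤n {n})))
        ... | inj₁ l = proj₂ (proj₂ start) l
        ... | inj₂ e = S.reflexive (cong lim (sym e))

        val-seq : ∀ n → val (seq n) (seq (suc n)) ≈ r
        val-seq n = S.trans (lim-val (stable<seq n)) (lim-seq n)

        -- The interval `(seq 0, seq 2]` and each of its two halves have the value `r`. The two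
        -- stabilisations thus do the work for which Ramsey's theorem is commonly used.
        r-idempotent : _∙_ IdempotentOn r
        r-idempotent = S.sym (S.trans
          (S.sym (lim-val (<-trans (stable<seq 0) (seq-step 1))))
          (S.trans (val-∙ (seq-step 0) (seq-step 1)) (∙-cong (val-seq 0) (val-seq 1))))

        -- Up to `s₀` there is one bounded interval. The rest is an ω-product of copies of `r`,
        -- which by `π-const` is `r`, and `r` is itself the value of a bounded interval.
        after∈G : G (π (w ↾ (y <_)))
        after∈G = respects
          (S.sym (π-split-↾ {P = Ioc y s₀} {Q = s₀ <_} split proj₁
            (<-trans (proj₁ (proj₂ start))) (λ (_ , b) c → ≤-<-trans b c)))
          (∙-closed (val∈G (proj₁ (proj₂ start)))
            (respects (S.sym (S.trans after-s₀ (S.trans (π-letterwise val-seq) (π-const ℕ-order 0 r-idempotent))))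
              (val∈G (proj₁ (proj₂ (stabilise s₀))))))
          where
          split : ∀ {x} → y < x → Ioc y s₀ x ⊎ s₀ < x
          split {x} l with <-or-≥ s₀ x
          ... | inj₁ h = inj₂ h
          ... | inj₂ h = inj₁ (l , h)

    after∈G : ∀ y → G (π (w ↾ (y <_)))
    after∈G y with em {P = ∃ λ m → ∀ x → x ≤ m}
    ... | no none = Unbounded.after∈G (λ x → byContradiction λ h → none (x , λ y l → h (y , l))) y
    ... | yes (m , max) with <-or-≥ y m
    ...   | inj₁ y<m = respects (π-cong (↾-cong setoid proj₁ (λ l → l , max _))) (val∈G y<m)
    ...   | inj₂ m≤y = respects (S.sym (π-empty λ x → max _ (≤-<-trans m≤y (holds x)))) ε-closed

  module _ {c ℓ g} {M : ⊛Monoid c ℓ} (tame : Tame M) {G : Pred (⊛Monoid.Carrier M) g} (sub : IsSubmonoid M G) where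
    open ⊛Monoid M
    open MonoidLaws M
    open IsSubmonoid sub

    -- Cut at any position `y`. `Limits.after∈G` settles what follows `y`, and, applied to the
    -- reversed word in the opposite algebra, what precedes it.
    intervals-closed : ∀ (w : Word Carrier) → (∀ x → G (letter w x)) →
      (∀ {s t} → CountableOrder._<_ (dom w) s t → G (π (w ↾ Splitting.Ioo M w s t))) → G (π w)
    intervals-closed w letters∈G intervals∈G with em {P = Pos (dom w)}
    ... | no empty = respects (S.sym (π-empty empty)) ε-closed
    ... | yes y = respects (S.sym (π-split w {_< y} {y ≤_} cover <-≤-trans)) (∙-closed before from-y)
      where
      open Order (dom w)
      open Splitting M w
      cover : ∀ x → x < y ⊎ y ≤ x
      cover x = <-or-≥ x y
      before : G (π (w ↾ (_< y)))
      before = respects (reverse-↾ M w (_< y))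
        (Limits.after∈G (opposite-tame M tame) (opposite-isSubmonoid M sub) (reverse w) letters∈G
          (λ {s} {t} lt → respects
            (S.trans (π-cong (↾-cong setoid (λ (a , b) → b , a) (λ (a , b) → b , a))) (S.sym (reverse-↾ M w _)))
            (intervals∈G lt))
          y)
      from-y : G (π (w ↾ (y ≤_)))
      from-y = respects
        (S.sym (π-split-↾ {P = _≡ y} {Q = y <_} (λ h → split (≤⇒<∨≡ h)) (λ { refl → ≤-refl }) <⇒≤ (λ { refl l → l })))
        (∙-closed (respects (S.sym (π-one (y , [ refl ]) (λ z → value-injective (holds z)))) (letters∈G y))
          (Limits.after∈G tame sub w letters∈G intervals∈G y))
        where
        split : ∀ {x} → y < x ⊎ y ≡ x → x ≡ y ⊎ y < x
        split (inj₁ l) = inj₂ l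
        split (inj₂ e) = inj₁ (sym e)

  -- Convex quotients, homogeneous intervals and condensation

  module Quotient (α : CountableOrder) {r} (E : Rel (Pos α) r) (E-refl : Reflexive E) (E-sym : Symmetric E)
                  (E-trans : Transitive E)
                  (convex : ∀ {x y z} → CountableOrder._<_ α x y → CountableOrder._<_ α y z → E x z → E x y) where
    open Order α

    private
      abstract
        pick : ∀ x → ∃ λ y → E x y × (∀ z → E x z → code α y ℕ.≤ code α z)
        pick x =
          let _ , (y , h , e) , min = least (λ n → ∃ λ y → E x y × code α y ≡ n) (_ , x , E-refl , refl)
          in y , h , λ z h′ → subst (ℕ._≤ _) (sym e) (min _ (z , h′ , refl))

      rep : Pos α → Pos α
      rep x = proj₁ (pick x)

      E-rep : ∀ x → E x (rep x)
      E-rep x = proj₁ (proj₂ (pick x))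

      rep-cong : ∀ {x y} → E x y → rep x ≡ rep y
      rep-cong {x} {y} h = code-injective (ℕ.≤-antisym
        (proj₂ (proj₂ (pick x)) _ (E-trans h (E-rep y)))
        (proj₂ (proj₂ (pick y)) _ (E-trans (E-sym h) (E-rep x))))

    abstract
      -- A class is represented by its member of least code, so the quotient is a suborder of `α`
      -- and inherits linearity and countability, whatever the universe of `E`.
      quotient : CountableOrder
      quotient = α ↾ᵒ (λ x → rep x ≡ x)

      class : Pos α → Pos quotient
      class x = rep x , [ sym (rep-cong (E-rep x)) ]

      class-cong : ∀ {x y} → E x y → class x ≡ class y
      class-cong h = value-injective (rep-cong h)

      class-injective : ∀ {x y} → class x ≡ class y → E x y
      class-injective {x} {y} eq = E-trans (E-rep x) (subst (λ z → E z y) (sym (cong value eq)) (E-sym (E-rep y)))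

      class-surjective : ∀ i → ∃ λ x → class x ≡ i
      class-surjective i = value i , value-injective (holds i)

      -- If the representatives stood in the opposite order, convexity of the class of `x` or of the
      -- class of `y` would make `x` and `y` equivalent, and their representatives equal.
      class-mono : ∀ {x y} → x < y → Order._≤_ quotient (class x) (class y)
      class-mono {x} {y} x<y rep< = irrefl (sym (rep-cong x~y)) rep<
        where
        x~y : E x y
        x~y with <-or-≥ x (rep y)
        ... | inj₁ l = E-trans (convex l rep< (E-rep x)) (E-sym (E-rep y))
        ... | inj₂ l with ≤⇒<∨≡ l
        ...   | inj₁ l′ = E-trans (E-sym (convex l′ x<y (E-sym (E-rep y)))) (E-sym (E-rep y))
        ...   | inj₂ e = subst (λ z → E z y) e (E-sym (E-rep y))

  module _ (α : CountableOrder) {c} {C : Set c} (colour : Pos α → C) where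
    open Order α

    Absent DenseIn : C → Pos α → Pos α → Set c
    Absent c x y = ∀ z → x < z → z < y → colour z ≢ c
    DenseIn c x y = ∀ x′ y′ → x ≤ x′ → x′ < y′ → y′ ≤ y → ∃ λ z → x′ < z × z < y′ × colour z ≡ c

    -- One colour at a time: if some subinterval misses the colour, shrink to it; if none does, the
    -- colour is dense. Both properties pass to subintervals, so earlier decisions survive the
    -- shrinking.
    homogeneous : ∀ (cs : List C) {x y} → x < y →
      ∃ λ x′ → ∃ λ y′ → x′ < y′ × (∀ {c} → c ∈ cs → Absent c x′ y′ ⊎ DenseIn c x′ y′)
    homogeneous [] x<y = _ , _ , x<y , λ ()
    homogeneous (c ∷ cs) x<y with homogeneous cs x<y
    ... | x , y , lt , rest with em {P = ∃ λ x′ → ∃ λ y′ → x ≤ x′ × x′ < y′ × y′ ≤ y × Absent c x′ y′}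
    ...   | no none = x , y , lt , λ
      { (here refl) → inj₂ λ x′ y′ a b d → byContradiction λ h →
          none (x′ , y′ , a , b , d , λ z p q e → h (z , p , q , e))
      ; (there c∈cs) → rest c∈cs }
    ...   | yes (x′ , y′ , a , b , d , absent) = x′ , y′ , b , λ
      { (here refl) → inj₁ absent
      ; (there c∈cs) → restrict (rest c∈cs) }
      where
      restrict : ∀ {c} → Absent c x y ⊎ DenseIn c x y → Absent c x′ y′ ⊎ DenseIn c x′ y′
      restrict (inj₁ h) = inj₁ λ z p q → h z (≤-<-trans a p) (<-≤-trans q d)
      restrict (inj₂ h) = inj₂ λ _ _ p q r → h _ _ (≤-trans a p) q (≤-trans r d)

  -- Identify x and y if all open intervals between them have their value in G.  The classes are convex
  -- and have their value in G, so the quotient order is dense.  Colour it by the values of the classes: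
  -- if it has two points, then some interval of it is a perfect shuffle of elements of G, and the κ
  -- of these elements is in G.  So the points of that interval would have been identified.
  module Condensation {c ℓ} {M : ⊛Monoid c ℓ} (spt : ⊛Monoid.ShufflePowerTrivial M)
                      (finite : IsFinite (⊛Monoid.setoid M))
                      {g} {G : Pred (⊛Monoid.Carrier M) g} (sub : IsSubmonoid M G)
                      (w : Word (⊛Monoid.Carrier M)) (letters∈G : ∀ x → G (letter w x)) where
    open ⊛Monoid M
    open MonoidLaws M
    open IsSubmonoid sub
    open Order (dom w)
    open Splitting M w

    private
      tame : Tame M
      tame = shufflePowerTrivial⇒tame spt finite

    -- Vacuous when `y < x`, so that `E` is the conjunction of both directions. Ranging over all
    -- subintervals makes the classes convex.
    Flat : Pos (dom w) → Pos (dom w) → Set g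
    Flat x y = ∀ {s t} → x ≤ s → s < t → t ≤ y → G (π (w ↾ Ioo s t))

    -- An interval `(s,t)` around `y` is the product of `(s,y)`, the letter at `y`, and `(y,t)`.
    flat-trans : ∀ {x y z} → Flat x y → Flat y z → Flat x z
    flat-trans {x} {y} {z} f f′ {s} {t} x≤s s<t t≤z with <-or-≥ s y | <-or-≥ y t
    ... | inj₂ y≤s | _ = f′ y≤s s<t t≤z
    ... | _ | inj₂ t≤y = f x≤s s<t t≤y
    ... | inj₁ s<y | inj₁ y<t = respects
      (S.sym (π-split-↾ {P = Ioc s y} {Q = Ioo y t} cover
        (λ (a , b) → a , ≤-<-trans b y<t) (λ (a , b) → <-trans s<y a , b) λ (_ , a) (b , _) → ≤-<-trans a b))
      (∙-closed
        (respects
          (S.sym (π-split-↾ {P = Ioo s y} {Q = _≡ y} cover′ (λ (a , b) → a , <⇒≤ b) (λ { refl → s<y , ≤-refl }) λ { (_ , b) refl → b }))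
          (∙-closed (f x≤s s<y ≤-refl)
            (respects (S.sym (π-one (y , [ refl ]) (λ u → value-injective (holds u)))) (letters∈G y))))
        (f′ ≤-refl y<t t≤z))
      where
      cover : ∀ {u} → Ioo s t u → Ioc s y u ⊎ Ioo y t u
      cover {u} (a , b) with <-or-≥ y u
      ... | inj₁ l = inj₂ (l , b)
      ... | inj₂ l = inj₁ (a , l)
      cover′ : ∀ {u} → Ioc s y u → Ioo s y u ⊎ u ≡ y
      cover′ {u} (a , b) with ≤⇒<∨≡ b
      ... | inj₁ l = inj₁ (a , l)
      ... | inj₂ e = inj₂ e

    E : Pos (dom w) → Pos (dom w) → Set g
    E x y = Flat x y × Flat y x

    flat-refl : ∀ {x} → Flat x x
    flat-refl a b c = contradiction (<-≤-trans (≤-<-trans a b) c) (irrefl refl)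

    open Quotient (dom w) E (flat-refl , flat-refl) (λ (a , b) → b , a)
      (λ (a , b) (c , d) → flat-trans a c , flat-trans d b)
      (λ x<y y<z (f , _) → (λ a b c → f a b (≤-trans c (<⇒≤ y<z))) ,
        λ a b c → contradiction (<-≤-trans (≤-<-trans a b) c) (<⇒≤ x<y))

    private module Q = Order quotient

    class-mono-≤ : ∀ {x y} → x ≤ y → class x Q.≤ class y
    class-mono-≤ h with ≤⇒<∨≡ h
    ... | inj₁ l = class-mono l
    ... | inj₂ refl = Q.≤-refl

    class-cancel : ∀ {x y} → class x Q.< class y → x < y
    class-cancel {x} {y} lt with <-or-≥ x y
    ... | inj₁ l = l
    ... | inj₂ l = contradiction lt (class-mono-≤ l)

    -- Bounded open intervals inside a class have values in `G` by the choice of `E`;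
    -- `intervals-closed` extends this to convex parts without end points, in particular to whole
    -- classes.
    class-closed : (C : Pred (Pos (dom w)) 0ℓ) → (∀ {x y} → C x → C y → class x ≡ class y) →
                   (∀ {x y z} → C x → C z → x < y → y < z → C y) → G (π (w ↾ C))
    class-closed C C⊆class C-convex = intervals-closed tame sub (w ↾ C) (letters∈G ∘ value)
      λ {s} {t} s<t → respects
        (S.sym (π-cong (↾-↾ setoid (λ _ → id) (λ x (a , b) → C-convex (holds s) (holds t) a b , a , b))))
        (proj₁ (class-injective (C⊆class (holds s) (holds t))) ≤-refl s<t ≤-refl)

    fibre∈G : ∀ i → G (π (w ↾ (λ x → class x ≡ i)))
    fibre∈G i = class-closed _ (λ p q → trans p (sym q))
      λ { {x} {y} {z} refl e x<y y<z → Q.≤-antisym (subst (class y Q.≤_) e (class-mono y<z)) (class-mono x<y) }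

    Between : Pos quotient → Pos quotient → Pred (Pos (dom w)) 0ℓ
    Between i j x = i Q.< class x × class x Q.< j

    -- An interval `(s,t)` of `w` consists of the rest of the class of `s`, the classes strictly
    -- between, and the beginning of the class of `t`. The outer parts are in `G` by `class-closed`;
    -- if the middle always is, then `i` and `j` are one class.
    merge : ∀ {i j} → i Q.< j →
            ¬ (∀ {i′ j′} → i Q.≤ i′ → i′ Q.< j′ → j′ Q.≤ j → G (π (w ↾ Between i′ j′)))
    merge {i} {j} i<j between∈G with class-surjective i | class-surjective j
    ... | x , refl | y , refl = Q.irrefl (class-cong {x} {y} (flat , λ a b c →
            contradiction (<-≤-trans (≤-<-trans a b) c) (<⇒≤ (class-cancel i<j)))) i<j
      where
      flat : Flat x y
      flat {s} {t} x≤s s<t t≤y with Q.≤⇒<∨≡ (class-mono s<t)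
      ... | inj₂ e = proj₁ (class-injective e) ≤-refl s<t ≤-refl
      ... | inj₁ l = respects
        (S.sym (S.trans
          (π-split-↾ {P = Left} {Q = λ u → s < u × u < t × class s Q.< class u} cover
            (λ (a , e) → a , class-cancel (subst (Q._< class t) (sym e) l)) (λ (a , b , _) → a , b)
            (λ { (_ , e) (_ , _ , c) → class-cancel (subst (Q._< _) (sym e) c) }))
          (∙-cong S.refl
            (π-split-↾ {P = Between (class s) (class t)} {Q = Right} cover′
              (λ (a , b) → class-cancel a , class-cancel b , a)
              (λ (a , e) → class-cancel (subst (class s Q.<_) (sym e) l) , a , subst (class s Q.<_) (sym e) l)
              (λ { (_ , b) (_ , e) → class-cancel (subst (_ Q.<_) (sym e) b) })))))
        (∙-closed
          (class-closed Left (λ (_ , e) (_ , e′) → trans e (sym e′))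
            (λ { {a} {b} {d} (p , e) (_ , e′) a<b b<d → <-trans p a<b ,
                 Q.≤-antisym (subst (class b Q.≤_) e′ (class-mono b<d)) (subst (Q._≤ class b) e (class-mono a<b)) }))
          (∙-closed (between∈G (class-mono-≤ x≤s) l (class-mono-≤ t≤y))
            (class-closed Right (λ (_ , e) (_ , e′) → trans e (sym e′))
              (λ { {a} {b} {d} (_ , e) (p , e′) a<b b<d → <-trans b<d p ,
                   Q.≤-antisym (subst (class b Q.≤_) e′ (class-mono b<d)) (subst (Q._≤ class b) e (class-mono a<b)) }))))
        where
        Left Right : Pred (Pos (dom w)) 0ℓ
        Left u = s < u × class u ≡ class s
        Right u = u < t × class u ≡ class t
        cover : ∀ {u} → Ioo s t u → Left u ⊎ (s < u × u < t × class s Q.< class u)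
        cover (a , b) with Q.≤⇒<∨≡ (class-mono a)
        ... | inj₁ lt = inj₂ (a , b , lt)
        ... | inj₂ e = inj₁ (a , sym e)
        cover′ : ∀ {u} → s < u × u < t × class s Q.< class u → Between (class s) (class t) u ⊎ Right u
        cover′ (a , b , lt) with Q.≤⇒<∨≡ (class-mono b)
        ... | inj₁ lt′ = inj₁ (lt , lt′)
        ... | inj₂ e = inj₂ (b , e)

    -- Neighbouring classes have only the empty word between them, whose value is the identity, so
    -- they would merge.
    dense : ∀ {i j} → i Q.< j → ∃ λ k → i Q.< k × k Q.< j
    dense i<j = byContradiction λ none → merge i<j λ {i′} {j′} i≤i′ _ j′≤j →
      respects (S.sym (π-empty λ x → let a , b = holds {P = Between i′ j′} x in none (_ , Q.≤-<-trans i≤i′ a , Q.<-≤-trans b j′≤j))) ε-closed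

    private
      size : ℕ
      size = proj₁ finite
      module e = Inverse (proj₂ finite)

    -- Values are coded in `Fin size` because uniqueness of perfect shuffles compares letters by
    -- `≡`, while values are known only up to `≈`.
    colour : Pos quotient → Fin size
    colour i = e.to (π (w ↾ (λ x → class x ≡ i)))

    module _ {i j} (i<j : i Q.< j) (decided : ∀ c → Absent quotient colour c i j ⊎ DenseIn quotient colour c i j) where

      present⇒dense : ∀ {k} → i Q.< k → k Q.< j → DenseIn quotient colour (colour k) i j
      present⇒dense {k} i<k k<j with decided (colour k)
      ... | inj₁ absent = contradiction refl (absent k i<k k<j)
      ... | inj₂ h = h

      between∈G : ∀ {i′ j′} → i Q.≤ i′ → i′ Q.< j′ → j′ Q.≤ j → G (π (w ↾ Between i′ j′))
      between∈G {i′} {j′} i≤i′ i′<j′ j′≤j = respects (S.sym (begin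
        π (w ↾ Between i′ j′)                                    ≈⟨ decompose ⟩
        π (word inside λ k → π (w ↾ (λ x → class x ≡ value k)))  ≈⟨ π-letterwise (λ k → S.sym (e.strictlyInverseʳ _)) ⟩
        π (mapʷ e.from (word inside (colour ∘ value)))           ≈⟨ π-cong (map-iso setoid e.from
                                                                     (densely-coloured-unique inside-dense shuffle-dense′)) ⟩
        κ (e.from ∘ pick)                                        ∎))
        (κ-closed spt sub (e.from ∘ pick) λ c → colour∈G (pick-dense c))
        where
        open Relation.Binary.Reasoning.Setoid setoid
        D : Pred (Fin size) 0ℓ
        D c = DenseIn quotient colour c i j

        -- By density of the quotient some class lies strictly between `i′` and `j′`, so some colour
        -- is dense; in particular `size` is not zero.
        default : ∃ D
        default = let k , a , b = dense i′<j′ in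
          colour k , present⇒dense (Q.≤-<-trans i≤i′ a) (Q.<-≤-trans b j′≤j)

        instance
          size≢0 : NonZero size
          size≢0 = Fin.nonZeroIndex (proj₁ default)

        -- `κ` takes a vector, so all of `Fin size` is listed and every colour that is not dense
        -- gives way to the default; repetitions do not change the shuffle.
        choose : ∀ c → ∃ λ c′ → D c′ × (D c → c′ ≡ c)
        choose c with em {P = D c}
        ... | yes d = c , d , λ _ → refl
        ... | no ¬d = proj₁ default , proj₂ default , λ d → contradiction d ¬d

        pick : Fin size → Fin size
        pick c = proj₁ (choose c)

        pick-dense : ∀ c → D (pick c)
        pick-dense c = proj₁ (proj₂ (choose c))

        shuffle-dense′ : DenselyColoured D (shuffle pick)
        shuffle-dense′ = shuffle-densely pick pick-dense (λ {c} d → c , proj₂ (proj₂ (choose c)) d)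

        inside : CountableOrder
        inside = quotient ↾ᵒ (λ k → i′ Q.< k × k Q.< j′)

        inner-bounds : ∀ (k : Pos inside) → i′ Q.< value k × value k Q.< j′
        inner-bounds k = holds k

        inside-dense : DenselyColoured D (word inside (colour ∘ value))
        inside-dense = record
          { colours   = λ k → let a , b = inner-bounds k in present⇒dense (Q.≤-<-trans i≤i′ a) (Q.<-≤-trans b j′≤j)
          ; inhabited = λ d → let z , a , b , eq = d _ _ i≤i′ i′<j′ j′≤j in (z , [ a , b ]) , eq
          ; below     = λ k d → let a , b = inner-bounds k
                                    z , a′ , b′ , eq = d _ _ i≤i′ a (Q.<⇒≤ (Q.<-≤-trans b j′≤j))
                                in (z , [ a′ , Q.<-trans b′ b ]) , b′ , eq
          ; above     = λ k d → let a , b = inner-bounds k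
                                    z , a′ , b′ , eq = d _ _ (Q.<⇒≤ (Q.≤-<-trans i≤i′ a)) b j′≤j
                                in (z , [ Q.<-trans a a′ , b′ ]) , a′ , eq
          ; between   = λ {k} {l} lt d →
                          let a , _ = inner-bounds k
                              _ , b = inner-bounds l
                              z , a′ , b′ , eq = d _ _ (Q.<⇒≤ (Q.≤-<-trans i≤i′ a)) lt (Q.<⇒≤ (Q.<-≤-trans b j′≤j))
                          in (z , [ Q.<-trans a a′ , Q.<-trans b′ b ]) , a′ , b′ , eq
          }

        decompose : π (w ↾ Between i′ j′) ≈ π (word inside λ k → π (w ↾ (λ x → class x ≡ value k)))
        decompose = π-fibers-↾ inside (λ x → class (value x) , [ holds x ]) class-mono
          (λ k x → class x ≡ value k) (λ { _ x refl → refl })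
          λ { k x refl → holds k , value-injective refl }

        colour∈G : ∀ {c} → D c → G (e.from c)
        colour∈G d with d _ _ (λ h → Q.irrefl refl h) i<j (λ h → Q.irrefl refl h)
        ... | z , _ , _ , refl = respects (S.sym (e.strictlyInverseʳ _)) (fibre∈G z)

    quotient-trivial : ∀ x y → class x ≡ class y
    quotient-trivial x y with Q.compare (class x) (class y)
    ... | tri≈ _ eq _ = eq
    ... | tri< lt _ _ = let _ , _ , lt′ , decided = homogeneous quotient colour (List.allFin size) lt in
      ⊥-elim (merge lt′ (between∈G lt′ (λ c → decided (∈-allFin c))))
    ... | tri> _ _ lt = let _ , _ , lt′ , decided = homogeneous quotient colour (List.allFin size) lt in
      ⊥-elim (merge lt′ (between∈G lt′ (λ c → decided (∈-allFin c))))

    π∈G : G (π w)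
    π∈G = respects
      (S.sym (π-cong (↾-iso setoid {u = w} {P = λ _ → ⊤} id id (λ _ → tt) (λ y _ → y , refl) (λ _ → S.refl))))
      (class-closed (λ _ → ⊤) (λ {x} {y} _ _ → quotient-trivial x y) (λ _ _ _ _ → tt))

  -- Sublists

  module _ {a} {A : Set a} where

    ⊆-drop : ∀ {x : A} {s w t} → x ∉ w → x ∷ s ⊆ w ++ t → x ∷ s ⊆ t
    ⊆-drop {w = []} x∉w h = h
    ⊆-drop {w = _ ∷ w} x∉w (_ ∷ʳ h) = ⊆-drop (x∉w ∘ there) h
    ⊆-drop {w = _ ∷ w} x∉w (refl ∷ h) = contradiction (here refl) x∉w

    ⊆-uncons : ∀ {x y : A} {s t} → x ∷ s ⊆ y ∷ t → s ⊆ t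
    ⊆-uncons (_ ∷ʳ h) = ⊆-trans (_ ∷ʳ ⊆-refl) h
    ⊆-uncons (_ ∷ h) = h

    ⊆-drop-≢ : ∀ {x y : A} {s t} → x ≢ y → x ∷ s ⊆ y ∷ t → x ∷ s ⊆ t
    ⊆-drop-≢ x≢y (_ ∷ʳ h) = h
    ⊆-drop-≢ x≢y (refl ∷ h) = contradiction refl x≢y

    ∈⇒⊆ : ∀ {x : A} {w s t} → x ∈ w → s ⊆ t → x ∷ s ⊆ w ++ t
    ∈⇒⊆ {w = _ ∷ w} (here refl) h = refl ∷ ++⁺ˡ w h
    ∈⇒⊆ {w = _ ∷ w} (there x∈w) h = _ ∷ʳ ∈⇒⊆ x∈w h

    first-occurrence : ∀ {x : A} {s v} → x ∷ s ⊆ v → ∃ λ w → ∃ λ t → v ≡ w ++ x ∷ t × x ∉ w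
    first-occurrence {x} {v = y ∷ v} h with em {P = x ≡ y} | h
    ... | yes refl | _ = [] , v , refl , λ ()
    ... | no x≢y | refl ∷ _ = contradiction refl x≢y
    ... | no x≢y | _ ∷ʳ h′ = let w , t , e , x∉w = first-occurrence h′ in
      y ∷ w , t , cong (y ∷_) e , λ { (here e) → x≢y e ; (there m) → x∉w m }

    -- A copy of `y ∷ c` that does not fit into `t` has its first letter in `w`.
    occurrence-before : ∀ {y : A} {c} w {t} → y ∷ c ⊆ w ++ t → ¬ y ∷ c ⊆ t →
                        ∃ λ w₀ → ∃ λ w₁ → w ≡ w₀ ++ y ∷ w₁ × c ⊆ w₁ ++ t
    occurrence-before [] h ¬h = contradiction h ¬h
    occurrence-before (x ∷ w) (_ ∷ʳ h) ¬h = let w₀ , w₁ , e , h′ = occurrence-before w h ¬h in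
      x ∷ w₀ , w₁ , cong (x ∷_) e , h′
    occurrence-before (x ∷ w) (refl ∷ h) ¬h = [] , w , refl , h

  -- Simon's theorem on finite words

  module Evaluation {c ℓ} (M : ⊛Monoid c ℓ) {a} {A : Set a} (g : A → ⊛Monoid.Carrier M) where
    open ⊛Monoid M
    open MonoidLaws M

    eval : List A → Carrier
    eval = foldr (λ x m → g x ∙ m) identity

    eval-++ : ∀ u v → eval (u ++ v) ≈ eval u ∙ eval v
    eval-++ [] v = S.sym (identityˡ _)
    eval-++ (x ∷ u) v = S.trans (∙-cong S.refl (eval-++ u v)) (S.sym (assoc _ _ _))

  -- Klíma's proof.  The prefix values of u change at few letters only, and deleting other letters
  -- does not change the value of u; these letters form the leftmost occurrence in u of a word a.
  -- Dually, suffix values of v single out the rightmost occurrence in v of a word c.  The relative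
  -- positions of the leftmost a and the rightmost c are the same in u and in v, as they are determined
  -- by subwords of the form (prefix of a)(suffix of c).  So u and v have a common subword z that
  -- covers a in u and c in v, and z has the value of both.
  module Simon {c ℓ} {M : ⊛Monoid c ℓ} (tame : Tame M) {a} {A : Set a} (g : A → ⊛Monoid.Carrier M) where
    open ⊛Monoid M
    open MonoidLaws M
    open Tame tame
    open Evaluation M g
    open Relation.Binary.Reasoning.Setoid setoid

    data LeftReduct (p : Carrier) : List A → List A → Set (a ⊔ ℓ) where
      []   : LeftReduct p [] []
      drop : ∀ {x s u} → p ∙ g x ≈ p → LeftReduct p s u → LeftReduct p s (x ∷ u)
      keep : ∀ {x s u} → ¬ p ∙ g x ≈ p → LeftReduct (p ∙ g x) s u → LeftReduct p (x ∷ s) (x ∷ u)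

    -- From the right, the value accumulated so far is `eval s` itself; from the left it is not
    -- visible in the remaining list and has to be carried as `p`.
    data RightReduct : List A → List A → Set (a ⊔ ℓ) where
      []   : RightReduct [] []
      drop : ∀ {x s v} → g x ∙ eval s ≈ eval s → RightReduct s v → RightReduct s (x ∷ v)
      keep : ∀ {x s v} → ¬ g x ∙ eval s ≈ eval s → RightReduct s v → RightReduct (x ∷ s) (x ∷ v)

    leftReduct : ∀ p u → ∃ λ s → LeftReduct p s u
    leftReduct p [] = [] , []
    leftReduct p (x ∷ u) with em {P = p ∙ g x ≈ p}
    ... | yes h = let s , r = leftReduct p u in s , drop h r
    ... | no h = let s , r = leftReduct (p ∙ g x) u in x ∷ s , keep h r

    rightReduct : ∀ v → ∃ λ s → RightReduct s v
    rightReduct [] = [] , []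
    rightReduct (x ∷ v) with rightReduct v
    ... | s , r with em {P = g x ∙ eval s ≈ eval s}
    ...   | yes h = s , drop h r
    ...   | no h = x ∷ s , keep h r

    leftReduct-⊆ : ∀ {p s u} → LeftReduct p s u → s ⊆ u
    leftReduct-⊆ [] = []
    leftReduct-⊆ (drop _ r) = _ ∷ʳ leftReduct-⊆ r
    leftReduct-⊆ (keep _ r) = refl ∷ leftReduct-⊆ r

    rightReduct-⊆ : ∀ {s v} → RightReduct s v → s ⊆ v
    rightReduct-⊆ [] = []
    rightReduct-⊆ (drop _ r) = _ ∷ʳ rightReduct-⊆ r
    rightReduct-⊆ (keep _ r) = refl ∷ rightReduct-⊆ r

    leftReduct-eval : ∀ {p s u} → LeftReduct p s u → p ∙ eval s ≈ p ∙ eval u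
    leftReduct-eval [] = S.refl
    leftReduct-eval (drop h r) = S.trans (leftReduct-eval r) (S.trans (∙-cong (S.sym h) S.refl) (assoc _ _ _))
    leftReduct-eval (keep _ r) = S.trans (S.sym (assoc _ _ _)) (S.trans (leftReduct-eval r) (assoc _ _ _))

    rightReduct-eval : ∀ {s v} → RightReduct s v → eval s ≈ eval v
    rightReduct-eval [] = S.refl
    rightReduct-eval (drop h r) = S.trans (S.sym h) (∙-cong S.refl (rightReduct-eval r))
    rightReduct-eval (keep _ r) = ∙-cong S.refl (rightReduct-eval r)

    -- Every kept letter strictly lowers the R-rank of the prefix value.
    leftReduct-length : ∀ {p s u} → LeftReduct p s u → length s ℕ.≤ proj₁ (proj₂ (R-rank tame)) p
    leftReduct-length [] = z≤n
    leftReduct-length (drop _ r) = leftReduct-length r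
    leftReduct-length (keep h r) = ℕ.≤-<-trans (leftReduct-length r) (proj₂ (proj₂ (proj₂ (R-rank tame))) S.refl h)

    rightReduct-length : ∀ {s v} → RightReduct s v → length s ℕ.≤ proj₁ (proj₂ (L-rank tame)) (eval s)
    rightReduct-length [] = z≤n
    rightReduct-length (drop _ r) = rightReduct-length r
    rightReduct-length (keep h r) = ℕ.≤-<-trans (rightReduct-length r) (proj₂ (proj₂ (proj₂ (L-rank tame))) S.refl h)

    Stable : Carrier → A → Set ℓ
    Stable p x = p ∙ g x ≈ p

    stable-eval : ∀ {p u} → All (Stable p) u → p ∙ eval u ≈ p
    stable-eval [] = identityʳ _
    stable-eval (h ∷ hs) = S.trans (S.sym (assoc _ _ _)) (S.trans (∙-cong h S.refl) (stable-eval hs))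

    stable-++ : ∀ {p} w {u} → All (Stable p) w → p ∙ eval (w ++ u) ≈ p ∙ eval u
    stable-++ w hs = S.trans (∙-cong S.refl (eval-++ w _)) (S.trans (S.sym (assoc _ _ _)) (∙-cong (stable-eval hs) S.refl))

    leftReduct-[] : ∀ {p u} → LeftReduct p [] u → All (Stable p) u
    leftReduct-[] [] = []
    leftReduct-[] (drop h r) = h ∷ leftReduct-[] r

    -- The letters before the kept `x` fix `p` and `x` does not, so this is the first occurrence of
    -- `x` in `u`: kept letters sit leftmost.
    leftReduct-∷ : ∀ {p x s u} → LeftReduct p (x ∷ s) u → ¬ Stable p x × ∃ λ w → ∃ λ t →
                   u ≡ w ++ x ∷ t × All (Stable p) w × LeftReduct (p ∙ g x) s t
    leftReduct-∷ (drop h r) with leftReduct-∷ r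
    ... | ¬h , w , t , refl , hs , r′ = ¬h , _ ∷ w , t , refl , h ∷ hs , r′
    leftReduct-∷ (keep ¬h r) = ¬h , [] , _ , refl , [] , r

    leftReduct-++ : ∀ {p s w u} → All (Stable p) w → LeftReduct p s u → LeftReduct p s (w ++ u)
    leftReduct-++ [] r = r
    leftReduct-++ (h ∷ hs) r = drop h (leftReduct-++ hs r)

    rightReduct-∷ : ∀ {y s v} → RightReduct (y ∷ s) v → ∃ λ w → ∃ λ t →
                    v ≡ w ++ y ∷ t × RightReduct s t × eval v ≈ eval (y ∷ t)
    rightReduct-∷ (drop h r) with rightReduct-∷ r
    ... | w , t , refl , r′ , e = _ ∷ w , t , refl , r′ , S.trans (∙-cong S.refl (S.sym (rightReduct-eval r)))
      (S.trans h (S.trans (rightReduct-eval r) e))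
    rightReduct-∷ (keep _ r) = [] , _ , refl , r , S.refl

    -- Kept letters sit rightmost: whatever precedes some copy of `s` in `v` fixes `eval s`. If the
    -- head of `s` has just been kept, a copy with a letter in front would push all of `s` into the
    -- tail, against the same claim for that head.
    rightReduct-maximal : ∀ {x s v} → RightReduct s v → ¬ g x ∙ eval s ≈ eval s → ¬ x ∷ s ⊆ v
    rightReduct-maximal (drop h r) ¬h (_ ∷ʳ sub) = rightReduct-maximal r ¬h sub
    rightReduct-maximal (drop h r) ¬h (refl ∷ sub) = ¬h h
    rightReduct-maximal (keep ¬h′ r) ¬h sub = rightReduct-maximal r ¬h′ (⊆-uncons sub)

    rightReduct-tail : ∀ {x s v} → RightReduct s (x ∷ v) → s ⊆ v → g x ∙ eval s ≈ eval s × RightReduct s v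
    rightReduct-tail (drop h r) sub = h , r
    rightReduct-tail (keep ¬h r) sub = contradiction sub (rightReduct-maximal r ¬h)

    rightReduct-suffix : ∀ {s} w {v} → RightReduct s (w ++ v) → s ⊆ v → RightReduct s v
    rightReduct-suffix [] r sub = r
    rightReduct-suffix (x ∷ w) r sub = rightReduct-suffix w (proj₂ (rightReduct-tail r (++⁺ˡ w sub))) sub

    identity-stable : ∀ {v} → RightReduct [] v → All (Stable identity) v
    identity-stable [] = []
    identity-stable (drop h r) = S.trans (identityˡ _) (S.trans (S.sym (identityʳ _)) h) ∷ identity-stable r

    Agree : List A → List A → List A → List A → Set a
    Agree s t u v = ∀ s₁ s₂ t₁ t₂ → s ≡ s₁ ++ s₂ → t ≡ t₁ ++ t₂ → s₁ ++ t₂ ⊆ u ⇔ s₁ ++ t₂ ⊆ v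

    -- The invariant of the induction. What has been consumed stands to the left, so `u` is compared
    -- after the prefix value `p`, while the value of what remains of `v` is compared outright.
    Common : List A → List A → Set (c ⊔ a ⊔ ℓ)
    Common s t = ∀ p {u v} → LeftReduct p s u → RightReduct t v → s ⊆ v → t ⊆ u → Agree s t u v →
                 ∃ λ z → p ∙ eval z ≈ p ∙ eval u × eval z ≈ eval v

    -- The two reducts are merged as in sorting. Whether the first `x` of `u` precedes a copy of
    -- `y ∷ t` decides which head is consumed next, and `agree` makes the answer the same in `v`. If
    -- it does, `x` is consumed; otherwise `y` is, together with `x` if they are the same letter.
    common-∷ : ∀ {x s y t} → Common s (y ∷ t) → Common s t → Common (x ∷ s) t → Common (x ∷ s) (y ∷ t)
    common-∷ {x} {s} {y} {t} left both right p {u} {v} l r s⊆v t⊆u agree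
      with leftReduct-∷ l | em {P = x ∷ y ∷ t ⊆ u}
    ... | ¬stable , w , u′ , refl , w-stable , l′ | yes first
      with first-occurrence s⊆v
    ...   | w′ , v′ , refl , x∉w′ =
      let z , e , e′ = left (p ∙ g x) l′ r′ (⊆-uncons (⊆-drop x∉w′ s⊆v)) (⊆-uncons (⊆-drop x∉w first))
                         (λ s₁ s₂ t₁ t₂ es et → mk⇔
                           (λ h → ⊆-uncons (⊆-drop x∉w′ (Equivalence.to
                                    (agree (x ∷ s₁) s₂ t₁ t₂ (cong (x ∷_) es) et) (++⁺ˡ w (refl ∷ h)))))
                           (λ h → ⊆-uncons (⊆-drop x∉w (Equivalence.from
                                    (agree (x ∷ s₁) s₂ t₁ t₂ (cong (x ∷_) es) et) (++⁺ˡ w′ (refl ∷ h))))))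
      in x ∷ z , left-eval z e ,
         S.trans (∙-cong S.refl (S.trans e′ (S.sym (rightReduct-eval r′)))) (S.trans (proj₁ tail) (rightReduct-eval r))
      where
      x∉w : x ∉ w
      x∉w m = ¬stable (All.lookup {P = Stable p} w-stable m)
      t⊆v′ : y ∷ t ⊆ v′
      t⊆v′ = ⊆-uncons (⊆-drop x∉w′ (Equivalence.to (agree (x ∷ []) s [] (y ∷ t) refl refl) first))
      tail = rightReduct-tail (rightReduct-suffix w′ r (x ∷ʳ t⊆v′)) t⊆v′
      r′ : RightReduct (y ∷ t) v′
      r′ = proj₂ tail
      left-eval : ∀ z → (p ∙ g x) ∙ eval z ≈ (p ∙ g x) ∙ eval u′ → p ∙ eval (x ∷ z) ≈ p ∙ eval (w ++ x ∷ u′)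
      left-eval z e = S.trans (S.sym (assoc _ _ _)) (S.trans e (S.trans (assoc _ _ _) (S.sym (stable-++ w w-stable))))
    common-∷ {x} {s} {y} {t} left both right p {u} {v} l r s⊆v t⊆u agree | ¬stable , w , u′ , refl , w-stable , l′ | no ¬first
      with rightReduct-∷ r | em {P = x ≡ y}
    -- Without a copy of `x ∷ x ∷ t`, every copy of `x ∷ t` in `u` starts at the first `x`, so the
    -- two heads are one position.
    ... | w′ , v′ , refl , r′ , v≈ | yes refl =
      let z , e , e′ = both (p ∙ g x) l′ r′ (⊆-uncons (⊆-drop x∉w′ s⊆v)) (⊆-uncons (⊆-drop x∉w t⊆u))
                         (λ s₁ s₂ t₁ t₂ es et → mk⇔
                           (λ h → ⊆-uncons (⊆-drop x∉w′ (Equivalence.to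
                                    (agree (x ∷ s₁) s₂ (x ∷ t₁) t₂ (cong (x ∷_) es) (cong (x ∷_) et))
                                    (++⁺ˡ w (refl ∷ h)))))
                           (λ h → ⊆-uncons (⊆-drop x∉w (Equivalence.from
                                    (agree (x ∷ s₁) s₂ (x ∷ t₁) t₂ (cong (x ∷_) es) (cong (x ∷_) et))
                                    (++⁺ˡ w′ (refl ∷ h))))))
      in x ∷ z , left-eval z e , S.trans (∙-cong S.refl e′) (S.sym v≈)
      where
      x∉w : x ∉ w
      x∉w m = ¬stable (All.lookup {P = Stable p} w-stable m)
      x∉w′ : x ∉ w′
      x∉w′ m = ¬first (Equivalence.from (agree (x ∷ []) s [] (x ∷ t) refl refl) (∈⇒⊆ m (refl ∷ rightReduct-⊆ r′)))
      left-eval : ∀ z → (p ∙ g x) ∙ eval z ≈ (p ∙ g x) ∙ eval u′ → p ∙ eval (x ∷ z) ≈ p ∙ eval (w ++ x ∷ u′)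
      left-eval z e = S.trans (S.sym (assoc _ _ _)) (S.trans e (S.trans (assoc _ _ _) (S.sym (stable-++ w w-stable))))
    -- Now `y` occurs in `u` before the first `x`, among letters that fix `p`, so putting it in
    -- front of `z` does not affect the value on the left.
    ... | w′ , v′ , refl , r′ , v≈ | no x≢y
      with occurrence-before w t⊆u (λ h → ¬first (++⁺ˡ w (refl ∷ ⊆-drop-≢ (x≢y ∘ sym) h)))
    ...   | w₀ , w₁ , refl , t⊆ =
      let z , e , e′ = right p (leftReduct-++ w₁-stable (keep ¬stable l′)) r′ s⊆v′ t⊆ agree′
      in y ∷ z ,
         (begin
           p ∙ (g y ∙ eval z)                        ≈⟨ assoc _ _ _ ⟨
           (p ∙ g y) ∙ eval z                        ≈⟨ ∙-cong y-stable S.refl ⟩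
           p ∙ eval z                                ≈⟨ e ⟩
           p ∙ eval (w₁ ++ x ∷ u′)                   ≈⟨ ∙-cong y-stable S.refl ⟨
           (p ∙ g y) ∙ eval (w₁ ++ x ∷ u′)           ≈⟨ assoc _ _ _ ⟩
           p ∙ eval (y ∷ w₁ ++ x ∷ u′)               ≈⟨ stable-++ w₀ w₀-stable ⟨
           p ∙ eval (w₀ ++ y ∷ w₁ ++ x ∷ u′)         ≡⟨ cong (λ l → p ∙ eval l) split ⟨
           p ∙ eval ((w₀ ++ y ∷ w₁) ++ x ∷ u′)       ∎) ,
         S.trans (∙-cong S.refl e′) (S.sym v≈)
      where
      split : (w₀ ++ y ∷ w₁) ++ x ∷ u′ ≡ w₀ ++ y ∷ w₁ ++ x ∷ u′
      split = List.++-assoc w₀ (y ∷ w₁) (x ∷ u′)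
      stable-parts : ∀ w₀ → All (Stable p) (w₀ ++ y ∷ w₁) → All (Stable p) w₀ × Stable p y × All (Stable p) w₁
      stable-parts [] (h ∷ hs) = [] , h , hs
      stable-parts (_ ∷ w₀) (h ∷ hs) = let a , b , c = stable-parts w₀ hs in h ∷ a , b , c
      w₀-stable = proj₁ (stable-parts w₀ w-stable)
      y-stable : Stable p y
      y-stable = proj₁ (proj₂ (stable-parts w₀ w-stable))
      w₁-stable = proj₂ (proj₂ (stable-parts w₀ w-stable))
      x∉w₀ : x ∉ w₀
      x∉w₀ m = ¬stable (All.lookup w₀-stable m)
      x∉w′ : x ∉ w′
      x∉w′ m = ¬first (Equivalence.from (agree (x ∷ []) s [] (y ∷ t) refl refl) (∈⇒⊆ m (refl ∷ rightReduct-⊆ r′)))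
      s⊆v′ : x ∷ s ⊆ v′
      s⊆v′ = ⊆-drop-≢ x≢y (⊆-drop x∉w′ s⊆v)
      agree′ : Agree (x ∷ s) t (w₁ ++ x ∷ u′) v′
      agree′ [] s₂ t₁ t₂ es et = mk⇔ (λ _ → ⊆-trans (suffix t₁ et) (rightReduct-⊆ r′)) (λ _ → ⊆-trans (suffix t₁ et) t⊆)
        where
        suffix : ∀ t₁ {t₂ t : List A} → t ≡ t₁ ++ t₂ → t₂ ⊆ t
        suffix t₁ refl = ++⁺ˡ t₁ ⊆-refl
      agree′ (.x ∷ s₁) s₂ t₁ t₂ refl et = mk⇔
        (λ h → ⊆-drop-≢ x≢y (⊆-drop x∉w′ (Equivalence.to (agree (x ∷ s₁) s₂ (y ∷ t₁) t₂ refl (cong (y ∷_) et))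
                 (subst (_ ⊆_) (sym split) (++⁺ˡ w₀ (y ∷ʳ h))))))
        (λ h → ⊆-drop-≢ x≢y (⊆-drop x∉w₀ (subst (_ ⊆_) split
                 (Equivalence.from (agree (x ∷ s₁) s₂ (y ∷ t₁) t₂ refl (cong (y ∷_) et)) (++⁺ˡ w′ (y ∷ʳ h))))))

    -- When one reduct is exhausted, all letters of its word are neutral on that side. The other
    -- reduct serves as `z`: being a sublist of both words, it has the neutral value there as well.
    common : ∀ s t → Common s t
    common [] t p l r _ t⊆u _ =
      t , S.trans (stable-eval (All-resp-⊆ t⊆u (leftReduct-[] l))) (S.sym (stable-eval (leftReduct-[] l))) , rightReduct-eval r
    common s@(_ ∷ _) [] p l r s⊆v _ _ =
      s , leftReduct-eval l , S.trans (≈1 (All-resp-⊆ s⊆v (identity-stable r))) (S.sym (≈1 (identity-stable r)))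
      where
      ≈1 : ∀ {u} → All (Stable identity) u → eval u ≈ identity
      ≈1 h = S.trans (S.sym (identityˡ _)) (stable-eval h)
    common (x ∷ s) (y ∷ t) = common-∷ (common s (y ∷ t)) (common s t) (common (x ∷ s) t)

    eval-determined : ∃ λ n → ∀ u v → (∀ s → length s ℕ.≤ n → s ⊆ u ⇔ s ⊆ v) → eval u ≈ eval v
    -- A word `s₁ ++ t₂` to be tested is a prefix of the left reduct, of length at most `m`,
    -- followed by a suffix of the right reduct, of length at most `n`.
    eval-determined = m ℕ.+ n , determined
      where
      m = proj₁ (R-rank tame)
      n = proj₁ (L-rank tame)
      determined : ∀ u v → (∀ s → length s ℕ.≤ m ℕ.+ n → s ⊆ u ⇔ s ⊆ v) → eval u ≈ eval v
      determined u v u∼v with leftReduct identity u | rightReduct v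
      ... | s , l | t , r =
        let z , e , e′ = common s t identity l r
                           (Equivalence.to (u∼v s (ℕ.≤-trans s≤m (ℕ.m≤m+n m n))) (leftReduct-⊆ l))
                           (Equivalence.from (u∼v t (ℕ.≤-trans t≤n (ℕ.m≤n+m n m))) (rightReduct-⊆ r))
                           λ s₁ s₂ t₁ t₂ es et → u∼v (s₁ ++ t₂) (subst (ℕ._≤ m ℕ.+ n) (sym (List.length-++ s₁))
                             (ℕ.+-mono-≤ (ℕ.≤-trans (prefix s₁ es) s≤m) (ℕ.≤-trans (suffix t₁ et) t≤n)))
        in S.trans (S.sym (S.trans (S.sym (identityˡ _)) (S.trans e (identityˡ _)))) e′
        where
        s≤m : length s ℕ.≤ m
        s≤m = ℕ.≤-trans (leftReduct-length l) (proj₁ (proj₂ (proj₂ (R-rank tame))) identity)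
        t≤n : length t ℕ.≤ n
        t≤n = ℕ.≤-trans (rightReduct-length r) (proj₁ (proj₂ (proj₂ (L-rank tame))) (eval t))
        prefix : ∀ s₁ {s₂ s : List A} → s ≡ s₁ ++ s₂ → length s₁ ℕ.≤ length s
        prefix s₁ {s₂} refl = subst (length s₁ ℕ.≤_) (sym (List.length-++ s₁)) (ℕ.m≤m+n _ (length s₂))
        suffix : ∀ t₁ {t₂ t : List A} → t ≡ t₁ ++ t₂ → length t₂ ℕ.≤ length t
        suffix t₁ {t₂} refl = subst (length t₂ ℕ.≤_) (sym (List.length-++ t₁)) (ℕ.m≤n+m _ (length t₁))

  -- Short words as lists, subwords as embeddings

  module _ {a} {A : Set a} where

    fromList : List A → Word A
    fromList l = word (finOrder (length l)) (List.lookup l)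

    -- Equivalent to `⊑`, but without the quantified subset and hence in a lower universe.
    record Embedding (s w : Word A) : Set a where
      private
        module s = CountableOrder (dom s)
        module w = CountableOrder (dom w)
      field
        to      : Pos (dom s) → Pos (dom w)
        mono    : ∀ {x y} → x s.< y → to x w.< to y
        letters : ∀ x → letter s x ≡ letter w (to x)

    open Embedding

    ⊑⇒embedding : ∀ {s w} → s ⊑ w → Embedding s w
    ⊑⇒embedding (P , p) = record
      { to = value ∘ WordIso.to p ; mono = WordIso.mono p ; letters = WordIso.letters p }

    embedding⇒⊑ : ∀ {s w} → Embedding s w → s ⊑ w
    embedding⇒⊑ f = (λ y → ∃ λ x → to f x ≡ y) , ↾-iso _ (to f) (mono f) (λ x → x , refl) (λ _ → id) (letters f)

    ⊑-respˡ-≅ : ∀ {s t w : Word A} → s ≅ t → t ⊑ w → s ⊑ w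
    ⊑-respˡ-≅ p (P , q) = P , ≅-trans _ p q

    fromList-length≤ : ∀ l {n} → length l ℕ.≤ n → length≤ (fromList l) n
    fromList-length≤ l h = mk↣ {to = λ i → Fin.inject≤ i h} (Fin.inject≤-injective h h _ _)

    -- The injection leaves at most `n` candidates to search; an index that is not hit is sent to
    -- the default `x₀`.
    minimal : ∀ {s : Word A} {n} → length≤ s n → Pos (dom s) → ∃ λ x → ∀ y → Order._≤_ (dom s) x y
    minimal {s} {n} inj x₀ = choose (greatest (λ x y → total y x) (λ p q → ≤-trans q p) n position Hit)
      where
      open Order (dom s)
      Hit : Pred (Fin n) 0ℓ
      Hit i = ∃ λ x → Injection.to inj x ≡ i
      position : Fin n → Pos (dom s)
      position i with em {P = Hit i}
      ... | yes (x , _) = x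
      ... | no _ = x₀
      position-to : ∀ y → position (Injection.to inj y) ≡ y
      position-to y with em {P = Hit (Injection.to inj y)}
      ... | yes (x , e) = Injection.injective inj e
      ... | no h = contradiction (y , refl) h
      choose : (∀ i → ¬ Hit i) ⊎ (∃ λ i → Hit i × ∀ j → Hit j → position i ≤ position j) → ∃ λ x → ∀ y → x ≤ y
      choose (inj₁ none) = contradiction (x₀ , refl) (none _)
      choose (inj₂ (i , _ , min)) = position i , λ y → subst (position i ≤_) (position-to y) (min _ (y , refl))

    -- Take off the least position; `punchOut` removes its index from the target of the injection.
    short⇒list : ∀ n {s : Word A} → length≤ s n → ∃ λ l → length l ℕ.≤ n × fromList l ≅ s
    short⇒list n {s} inj with em {P = Pos (dom s)}
    ... | no empty = [] , z≤n , mkIso _ (λ ()) (λ { {()} }) (λ y → contradiction y empty) (λ ())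
    short⇒list zero inj | yes x = contradiction (Injection.to inj x) λ ()
    short⇒list (suc n) {s} inj | yes x₀ with minimal {s} inj x₀
    ... | m , min = letter s m ∷ l , s≤s l≤n , mkIso _ f f-mono f-surj f-letters
      where
      open Order (dom s)
      s′ : Word A
      s′ = s ↾ (m <_)
      inj≢ : (x : Pos (dom s′)) → Injection.to inj m ≢ Injection.to inj (value x)
      inj≢ x e = irrefl (Injection.injective inj e) (holds x)
      rest = short⇒list n {s′} (mk↣ {to = λ x → Fin.punchOut (inj≢ x)} λ {x} {y} e →
        value-injective (Injection.injective inj (Fin.punchOut-injective (inj≢ x) (inj≢ y) e)))
      l = proj₁ rest
      l≤n = proj₁ (proj₂ rest)
      module rest = WordIso (proj₂ (proj₂ rest))
      f : Fin (suc (length l)) → Pos (dom s)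
      f zero = m
      f (suc i) = value (rest.to i)
      f-mono : ∀ {i j} → i Fin.< j → f i < f j
      f-mono {zero} {suc j} _ = holds (rest.to j)
      f-mono {suc i} {suc j} (s≤s h) = rest.mono h
      f-surj : ∀ y → ∃ λ i → f i ≡ y
      f-surj y with ≤⇒<∨≡ (min y)
      ... | inj₂ e = zero , e
      ... | inj₁ h = suc (rest.from (y , [ h ])) , cong value (rest.to∘from (y , [ h ]))
      f-letters : ∀ i → List.lookup (letter s m ∷ l) i ≡ letter s (f i)
      f-letters zero = refl
      f-letters (suc i) = rest.letters i

    ∼-fromLists : ∀ {n} {u v : Word A} → (∀ l → length l ℕ.≤ n → fromList l ⊑ u ⇔ fromList l ⊑ v) → u ∼[ n ] v
    ∼-fromLists {n} h s len = let l , l≤n , p = short⇒list n {s} len in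
      mk⇔ (λ q → ⊑-respˡ-≅ (≅-sym _ p) (Equivalence.to (h l l≤n) (⊑-respˡ-≅ p q)))
          (λ q → ⊑-respˡ-≅ (≅-sym _ p) (Equivalence.from (h l l≤n) (⊑-respˡ-≅ p q)))

    ⊆⇒embedding : ∀ {s t} → s ⊆ t → Embedding (fromList s) (fromList t)
    ⊆⇒embedding [] = record { to = id ; mono = id ; letters = λ _ → refl }
    ⊆⇒embedding (_ ∷ʳ h) = let f = ⊆⇒embedding h in
      record { to = suc ∘ to f ; mono = s≤s ∘ mono f ; letters = letters f }
    ⊆⇒embedding (refl ∷ h) = let f = ⊆⇒embedding h in record
      { to      = λ { zero → zero ; (suc i) → suc (to f i) }
      ; mono    = λ { {zero} {suc j} _ → s≤s z≤n ; {suc i} {suc j} (s≤s lt) → s≤s (mono f lt) }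
      ; letters = λ { zero → refl ; (suc i) → letters f i }
      }

    embedding-tail : ∀ {s y t} (f : Embedding s (fromList (y ∷ t))) → (∀ i → zero ≢ to f i) → Embedding s (fromList t)
    embedding-tail {t = t} f nz = record
      { to      = λ i → Fin.punchOut (nz i)
      ; mono    = λ {i} {j} lt → lower (nz i) (nz j) (mono f lt)
      ; letters = λ i → trans (letters f i) (lookup-lower (nz i))
      }
      where
      lower : ∀ {i j : Fin (suc (length t))} (p : zero ≢ i) (q : zero ≢ j) → i Fin.< j → Fin.punchOut p Fin.< Fin.punchOut q
      lower {zero} p _ _ = contradiction refl p
      lower {suc i} {suc j} _ _ (s≤s lt) = lt
      lookup-lower : ∀ {y} {i : Fin (suc (length t))} (p : zero ≢ i) → List.lookup (y ∷ t) i ≡ List.lookup t (Fin.punchOut p)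
      lookup-lower {i = zero} p = contradiction refl p
      lookup-lower {i = suc i} _ = refl

    -- By monotonicity only the first position of `s` can be sent to the first position of `t`, so
    -- what remains embeds into the tail.
    embedding⇒⊆ : ∀ s t → Embedding (fromList s) (fromList t) → s ⊆ t
    embedding⇒⊆ [] t f = minimum t
    embedding⇒⊆ (x ∷ s) [] f = contradiction (to f zero) λ ()
    embedding⇒⊆ (x ∷ s) (y ∷ t) f with to f zero in eq
    ... | zero = trans (letters f zero) (cong (List.lookup (y ∷ t)) eq) ∷
      embedding⇒⊆ s t (embedding-tail (record { to = to f ∘ suc ; mono = mono f ∘ s≤s ; letters = letters f ∘ suc })
        λ i e → ℕ.<⇒≢ (mono f {zero} {suc i} (s≤s z≤n)) (cong toℕ (trans eq e)))
    ... | suc j = y ∷ʳ embedding⇒⊆ (x ∷ s) t (embedding-tail f nz)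
      where
      nz : ∀ i → zero ≢ to f i
      nz zero e = contradiction (trans e eq) λ ()
      nz (suc i) e = ℕ.n≮0 (subst (to f zero Fin.<_) (sym e) (mono f {zero} {suc i} (s≤s z≤n)))

    ∼-sublists : ∀ {n s t} → fromList s ∼[ n ] fromList t → ∀ l → length l ℕ.≤ n → l ⊆ s ⇔ l ⊆ t
    ∼-sublists {s = s} {t} h l l≤n = mk⇔
      (λ p → embedding⇒⊆ l t (⊑⇒embedding (Equivalence.to (h (fromList l) (fromList-length≤ l l≤n)) (embedding⇒⊑ (⊆⇒embedding p)))))
      (λ p → embedding⇒⊆ l s (⊑⇒embedding (Equivalence.from (h (fromList l) (fromList-length≤ l l≤n)) (embedding⇒⊑ (⊆⇒embedding p)))))

    -- The quotients by subwords are shuffle-power-trivial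

    record Full {d} (D : Pred A d) (n : ℕ) (w : Word A) : Set (a ⊔ d) where
      field
        over     : ∀ x → D (letter w x)
        contains : ∀ l → length l ℕ.≤ n → All D l → Embedding (fromList l) w

    -- In a full word the short subwords are exactly the short words over `D`, so `D` alone
    -- determines the class.
    full-∼ : ∀ {d} {D : Pred A d} {n u v} → Full D n u → Full D n v → u ∼[ n ] v
    full-∼ {D = D} fu fv = ∼-fromLists λ l l≤n → mk⇔ (⇒ fu fv l l≤n) (⇒ fv fu l l≤n)
      where
      ⇒ : ∀ {n u v} → Full D n u → Full D n v → ∀ l → length l ℕ.≤ n → fromList l ⊑ u → fromList l ⊑ v
      ⇒ fu fv l l≤n h = let f = ⊑⇒embedding h in embedding⇒⊑
        (Full.contains fv l l≤n (All.tabulate λ {x} x∈l → subst D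
          (trans (sym (letters f (Any.index x∈l))) (sym (Any.lookup-index x∈l))) (Full.over fu _)))

    module _ (n : ℕ) where
      open ⊛Monoid (𝐒 A n) hiding (_≈_; Carrier; setoid)

      module _ {p} (W : Vector (Word A) p) where

        Letter : Pred A a
        Letter c = ∃ λ i → ∃ λ x → letter (W i) x ≡ c

        -- The letters of `l` are placed one by one, each in a factor to the right of the previous
        -- one: every factor recurs above every rational.
        shuffle-full : .{{_ : NonZero p}} → Full Letter n (κ W)
        shuffle-full = record
          { over     = λ (q , x) → _ , x , refl
          ; contains = λ l _ h → let f , m , e , _ = after 0ℚ l h in record { to = f ; mono = m ; letters = e }
          }
          where
          after : ∀ q l → All Letter l → ∃ λ (f : Fin (length l) → Pos (dom (κ W))) →
                  (∀ {i j} → i Fin.< j → CountableOrder._<_ (dom (κ W)) (f i) (f j)) ×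
                  (∀ i → List.lookup l i ≡ letter (κ W) (f i)) × (∀ i → q ℚ.< proj₁ (f i))
          after q [] [] = (λ ()) , (λ { {()} }) , (λ ()) , λ ()
          after q (c ∷ l) ((i , x , e) ∷ h) with DenselyColoured.above (shuffle-densely W (λ i → i , refl) id) q (i , refl)
          ... | r , q<r , eq with after r l h
          ...   | f , m , e′ , r<f = g , g-mono , g-letters , q<g
            where
            g : Fin (suc (length l)) → Pos (dom (κ W))
            g zero = r , subst (Pos ∘ dom) (sym eq) x
            g (suc j) = f j
            g-mono : ∀ {i j} → i Fin.< j → CountableOrder._<_ (dom (κ W)) (g i) (g j)
            g-mono {zero} {suc j} _ = outer (r<f j)
            g-mono {suc i} {suc j} (s≤s lt) = m lt
            transport : ∀ {u v : Word A} (eq : u ≡ v) x → letter u x ≡ letter v (subst (Pos ∘ dom) eq x)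
            transport refl x = refl
            g-letters : ∀ j → List.lookup (c ∷ l) j ≡ letter (κ W) (g j)
            g-letters zero = trans (sym e) (transport (sym eq) x)
            g-letters (suc j) = e′ j
            q<g : ∀ j → q ℚ.< proj₁ (g j)
            q<g zero = q<r
            q<g (suc j) = ℚ.<-trans q<r (r<f j)

      product-over : ∀ {p d} (D : Pred A d) (W : Vector (Word A) p) → (∀ i x → D (letter (W i) x)) →
                     ∀ x → D (letter (product W) x)
      product-over {suc p} D W h (zero , x) = h zero x
      product-over {suc p} D W h (suc zero , x) = product-over D (W ∘ suc) (h ∘ suc) x

      product-contains : ∀ {p} (W : Vector (Word A) p) {c} → Letter W c → ∃ λ x → letter (product W) x ≡ c
      product-contains {suc p} W (zero , x , e) = (zero , x) , e
      product-contains {suc p} W (suc i , x , e) = let y , e′ = product-contains (W ∘ suc) (i , x , e) in (suc zero , y) , e′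

      power-over : ∀ {d} (D : Pred A d) {w} k → (∀ x → D (letter w x)) → ∀ x → D (letter (power k w) x)
      power-over D (suc k) h (zero , x) = h x
      power-over D {w} (suc k) h (suc zero , x) = power-over D {w} k h x

      -- One letter from each copy.
      power-contains : ∀ {w} k l → length l ℕ.≤ k → All (λ c → ∃ λ x → letter w x ≡ c) l → Embedding (fromList l) (power k w)
      power-contains k [] _ [] = record { to = λ () ; mono = λ { {()} } ; letters = λ () }
      power-contains {w} (suc k) (c ∷ l) (s≤s l≤k) ((x , e) ∷ h) = record
        { to      = λ { zero → zero , x ; (suc i) → suc zero , to f i }
        ; mono    = λ { {zero} {suc j} _ → outer (s≤s z≤n) ; {suc i} {suc j} (s≤s lt) → inner (mono f lt) }
        ; letters = λ { zero → sym e ; (suc i) → letters f i }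
        }
        where
        f = power-contains {w} k l l≤k h

      𝐒-shufflePowerTrivial : ShufflePowerTrivial
      𝐒-shufflePowerTrivial W = record
        -- Exponents are stored less one, so the power is `suc n`, one copy more than
        -- `power-contains` asks for.
        { exponent   = n
        ; isPower    = full-∼ (shuffle-full W) record
            { over     = power-over (Letter W) {product W} (suc n) (product-over (Letter W) W λ i x → i , x , refl)
            ; contains = λ l l≤n h → power-contains {product W} (suc n) l (ℕ.m≤n⇒m≤1+n l≤n) (All.map (product-contains W) h)
            }
        ; idempotent = full-∼ {v = κ W} record
            { over     = λ { (zero , x) → Full.over (shuffle-full W) x ; (suc zero , x) → Full.over (shuffle-full W) x }
            ; contains = λ l l≤n h → let f = Full.contains (shuffle-full W) l l≤n h in
                record { to = λ i → zero , to f i ; mono = λ lt → inner (mono f lt) ; letters = letters f }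
            } (shuffle-full W)
        }

  -- Finiteness

  module _ {s ℓ} (S : Setoid s ℓ) where
    open Setoid S using (Carrier; _≈_) renaming (refl to ≈-refl; sym to ≈-sym; trans to ≈-trans)

    private
      irredundant : ∀ m (r : Fin m → Carrier) → ∃ λ k → ∃ λ (r′ : Fin k → Carrier) →
                    (∀ {i j} → r′ i ≈ r′ j → i ≡ j) × (∀ i → ∃ λ j → r i ≈ r′ j)
      irredundant zero r = zero , r , (λ { {()} }) , λ ()
      irredundant (suc m) r with irredundant m (r ∘ suc)
      ... | k , r′ , inj , cover with em {P = ∃ λ j → r zero ≈ r′ j}
      ...   | yes h = k , r′ , inj , λ { zero → h ; (suc i) → cover i }
      ...   | no h = suc k , r zero V.∷ r′ ,
        (λ { {zero} {zero} _ → refl ; {zero} {suc j} e → contradiction (j , e) h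
           ; {suc i} {zero} e → contradiction (i , ≈-sym e) h ; {suc i} {suc j} e → cong suc (inj e) }) ,
        λ { zero → zero , ≈-refl ; (suc i) → let j , e = cover i in suc j , e }

    covered⇒finite : ∀ {m} (r : Fin m → Carrier) → (∀ x → ∃ λ i → x ≈ r i) → IsFinite S
    covered⇒finite {m} r cover with irredundant m r
    ... | k , r′ , inj , cover′ = k , record
      { to        = to
      ; from      = r′
      ; to-cong   = λ {x} {y} e → inj (≈-trans (≈-sym (to-≈ x)) (≈-trans e (to-≈ y)))
      ; from-cong = λ { refl → ≈-refl }
      ; inverse   = (λ {x} e → inj (≈-trans (≈-sym (to-≈ _)) e)) , λ { {x} refl → ≈-sym (to-≈ x) }
      }
      where
      index : ∀ x → ∃ λ j → x ≈ r′ j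
      index x = let i , e = cover x ; j , e′ = cover′ i in j , ≈-trans e e′
      to : Carrier → Fin k
      to x = proj₁ (index x)
      to-≈ : ∀ x → x ≈ r′ (to x)
      to-≈ x = proj₂ (index x)

    abstract
      -- `χ` may separate equivalent elements. A representative of each nonempty fibre, with `x₀`
      -- for the empty ones, gives a finite cover, whose repetitions `covered⇒finite` removes.
      classified⇒finite : ∀ {m} (χ : Carrier → Fin m) → Carrier → (∀ {x y} → χ x ≡ χ y → x ≈ y) → IsFinite S
      classified⇒finite {m} χ x₀ χ-injective = covered⇒finite r λ x → χ x , χ-injective (sym (r-section x))
        where
        r : Fin m → Carrier
        r i with em {P = ∃ λ x → χ x ≡ i}
        ... | yes (x , _) = x
        ... | no _ = x₀
        r-section : ∀ x → χ (r (χ x)) ≡ χ x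
        r-section x with em {P = ∃ λ y → χ y ≡ χ x}
        ... | yes (_ , e) = e
        ... | no h = contradiction (x , refl) h

  module _ {A : Set} (finite : IsFinite (≡.setoid A)) where

    private
      module e = Inverse (proj₂ finite)
      elements : List A
      elements = List.map e.from (List.allFin (proj₁ finite))
      ∈-elements : ∀ x → x ∈ elements
      ∈-elements x = subst (_∈ elements) (e.strictlyInverseʳ x) (∈-map⁺ e.from (∈-allFin (e.to x)))

    lists≤ : ℕ → List (List A)
    lists≤ zero = [] ∷ []
    lists≤ (suc n) = [] ∷ cartesianProductWith _∷_ elements (lists≤ n)

    ∈-lists≤ : ∀ {n} l → length l ℕ.≤ n → l ∈ lists≤ n
    ∈-lists≤ {zero} [] _ = here refl
    ∈-lists≤ {suc n} [] _ = here refl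
    ∈-lists≤ {suc n} (x ∷ l) (s≤s h) = there (∈-cartesianProductWith⁺ _∷_ (∈-elements x) (∈-lists≤ l h))

    -- A class is determined by which of the finitely many short lists occur, recorded as one bit
    -- each.
    𝐒-finite : ∀ n → IsFinite (⊛Monoid.setoid (𝐒 A n))
    𝐒-finite n = classified⇒finite _ {2 ℕ.^ length ls} (Fin.funToFin ∘ bit) ε λ {u} {v} e → ∼-fromLists λ l l≤n →
      let i , l≡ = index l l≤n
          bit≡ = trans (sym (Fin.finToFun-funToFin (bit u) i)) (trans (cong (λ k → Fin.finToFun k i) e) (Fin.finToFun-funToFin (bit v) i))
      in subst (λ l → fromList l ⊑ u ⇔ fromList l ⊑ v) l≡ (mk⇔ (same u v i bit≡) (same v u i (sym bit≡)))
      where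
      ls = lists≤ n
      bit : Word A → Fin (length ls) → Fin 2
      bit w i with em {P = fromList (List.lookup ls i) ⊑ w}
      ... | yes _ = suc zero
      ... | no _ = zero
      same : ∀ u v i → bit u i ≡ bit v i → fromList (List.lookup ls i) ⊑ u → fromList (List.lookup ls i) ⊑ v
      same u v i e h with em {P = fromList (List.lookup ls i) ⊑ u} | em {P = fromList (List.lookup ls i) ⊑ v}
      ... | _ | yes h′ = h′
      ... | no ¬h | _ = contradiction h ¬h
      same u v i () h | yes _ | no _
      index : ∀ l → length l ℕ.≤ n → ∃ λ i → List.lookup ls i ≡ l
      index l h = Any.index (∈-lists≤ l h) , sym (Any.lookup-index (∈-lists≤ l h))

  -- Products of algebras

  module _ {c₁ ℓ₁ c₂ ℓ₂} (M : ⊛Monoid c₁ ℓ₁) (N : ⊛Monoid c₂ ℓ₂) where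
    private
      module M = ⊛Monoid M
      module N = ⊛Monoid N
      module ML = MonoidLaws M
      module NL = MonoidLaws N

    infixr 2 _×ᵐ_
    _×ᵐ_ : ⊛Monoid (c₁ ⊔ c₂) (ℓ₁ ⊔ ℓ₂)
    _×ᵐ_ = record
      { setoid      = ×-setoid M.setoid N.setoid
      ; π           = λ w → M.π (mapʷ proj₁ w) , N.π (mapʷ proj₂ w)
      ; π-cong      = λ p → let module p = WordIso p in
          M.π-cong (record { to = p.to ; isOrderIsomorphism = p.isOrderIsomorphism ; letters = proj₁ ∘ p.letters }) ,
          N.π-cong (record { to = p.to ; isOrderIsomorphism = p.isOrderIsomorphism ; letters = proj₂ ∘ p.letters })
      ; π-singleton = λ (a , b) →
          ML.π-one zero (λ { zero → refl }) , NL.π-one zero (λ { zero → refl })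
      ; π-assoc     = λ α u → M.π-assoc α (mapʷ proj₁ ∘ u) , N.π-assoc α (mapʷ proj₂ ∘ u)
      }

    private
      fst : Morphism _×ᵐ_ M
      fst = record { ⟦_⟧ = proj₁ ; ⟦⟧-cong = proj₁ ; π-homo = λ _ → ML.S.refl }
      snd : Morphism _×ᵐ_ N
      snd = record { ⟦_⟧ = proj₂ ; ⟦⟧-cong = proj₂ ; π-homo = λ _ → NL.S.refl }
      module fst = MorphismLaws fst
      module snd = MorphismLaws snd
      module P = ⊛Monoid _×ᵐ_

    ×ᵐ-finite : IsFinite M.setoid → IsFinite N.setoid → IsFinite P.setoid
    ×ᵐ-finite (m , e) (n , f) = classified⇒finite _ (λ (a , b) → Fin.combine (e.to a) (f.to b)) P.identity
      λ {x} {y} eq → let p , q = Fin.combine-injective _ _ _ _ eq in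
        ML.S.trans (ML.S.sym (e.strictlyInverseʳ _)) (ML.S.trans (e.from-cong p) (e.strictlyInverseʳ _)) ,
        NL.S.trans (NL.S.sym (f.strictlyInverseʳ _)) (NL.S.trans (f.from-cong q) (f.strictlyInverseʳ _))
      where
      module e = Inverse e
      module f = Inverse f

    ×ᵐ-shufflePowerTrivial : M.ShufflePowerTrivial → N.ShufflePowerTrivial → P.ShufflePowerTrivial
    ×ᵐ-shufflePowerTrivial sptM sptN x = record
      -- Both components need one exponent. Idempotents do not change under further powers, so the
      -- product of the two exponents serves, stored less one.
      { exponent   = ℕ.pred (suc j ℕ.* suc k)
      ; isPower    = ML.S.trans (M-power (proj₁ (P.product x)) (ML.S.trans m.isPower (ML.×-congʳ (suc j) (ML.S.sym (fst.product-homo x)))))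
                       (ML.S.sym (fst.power-homo (suc j ℕ.* suc k) (P.product x))) ,
                     NL.S.trans (N-power (proj₂ (P.product x)) (NL.S.trans n.isPower (NL.×-congʳ (suc k) (NL.S.sym (snd.product-homo x)))))
                       (NL.S.sym (snd.power-homo (suc j ℕ.* suc k) (P.product x)))
      ; idempotent = ML.S.trans (fst.∙-homo (P.κ x) (P.κ x)) m.idempotent , NL.S.trans (snd.∙-homo (P.κ x) (P.κ x)) n.idempotent
      }
      where
      module m = M.IsIdempotentPower (sptM (proj₁ ∘ x))
      module n = N.IsIdempotentPower (sptN (proj₂ ∘ x))
      j = m.exponent
      k = n.exponent
      M-power : ∀ p → M.κ (proj₁ ∘ x) M.≈ M.power (suc j) p → M.κ (proj₁ ∘ x) M.≈ M.power (suc j ℕ.* suc k) p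
      M-power p e = ML.S.trans (ML.S.sym (ML.power-idempotent m.idempotent k)) (ML.S.trans (ML.×-congʳ (suc k) e)
        (ML.S.trans (ML.×-assocˡ _ (suc k) (suc j)) (ML.S.reflexive (cong (λ i → M.power i p) (ℕ.*-comm (suc k) (suc j))))))
      N-power : ∀ p → N.κ (proj₂ ∘ x) N.≈ N.power (suc k) p → N.κ (proj₂ ∘ x) N.≈ N.power (suc j ℕ.* suc k) p
      N-power p e = NL.S.trans (NL.S.sym (NL.power-idempotent n.idempotent j)) (NL.S.trans (NL.×-congʳ (suc j) e)
        (NL.×-assocˡ _ (suc j) (suc k)))

    pairing : ∀ {c ℓ} {K : ⊛Monoid c ℓ} → Morphism K M → Morphism K N → Morphism K _×ᵐ_
    pairing f g = record
      { ⟦_⟧     = λ x → Morphism.⟦_⟧ f x , Morphism.⟦_⟧ g x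
      ; ⟦⟧-cong = λ e → Morphism.⟦⟧-cong f e , Morphism.⟦⟧-cong g e
      ; π-homo  = λ w → Morphism.π-homo f w , Morphism.π-homo g w
      }

  -- Morphisms from the free algebra

  module _ {a} {A : Set a} where

    singleton : A → Word A
    singleton x = finWord (x V.∷ V.[])

    concat-singletons : ∀ (w : Word A) → concat (mapʷ singleton w) ≅ w
    concat-singletons w = mkIso _ proj₁ (λ { (outer lt) → lt ; (inner {x = zero} {zero} ()) })
      (λ y → (y , zero) , refl) λ { (_ , zero) → refl }

    module FreeMorphism {c ℓ} {M : ⊛Monoid c ℓ} (h : Morphism (Free A) M) where
      open ⊛Monoid M
      open MonoidLaws M
      open Morphism h

      generator : A → Carrier
      generator = ⟦_⟧ ∘ singleton

      open Evaluation M generator public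

      determined : ∀ w → ⟦ w ⟧ ≈ π (mapʷ generator w)
      determined w = S.trans (⟦⟧-cong (≅-sym _ (concat-singletons w))) (π-homo _)

      eval-fromList : ∀ l → ⟦ fromList l ⟧ ≈ eval l
      eval-fromList l = S.trans (determined (fromList l)) (go l)
        where
        go : ∀ l → π (mapʷ generator (fromList l)) ≈ eval l
        go [] = π-empty λ ()
        go (x ∷ l) = S.trans (π-cons (generator ∘ List.lookup (x ∷ l))) (∙-cong S.refl (go l))

      -- `Condensation.π∈G` with `G` the submonoid of values of finite words.
      finite-word : IsFinite setoid → ShufflePowerTrivial → ∀ w → ∃ λ l → ⟦ w ⟧ ≈ ⟦ fromList l ⟧
      finite-word finite spt w = let l , e = Condensation.π∈G spt finite values (mapʷ generator w) letters∈G in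
        l , S.trans (determined w) (S.trans e (S.sym (eval-fromList l)))
        where
        values : IsSubmonoid M (λ m → ∃ λ l → m ≈ eval l)
        values = record
          { respects = λ e (l , e′) → l , S.trans (S.sym e) e′
          ; ∙-closed = λ (l , e) (l′ , e′) → l ++ l′ , S.trans (∙-cong e e′) (S.sym (eval-++ l l′))
          ; ε-closed = [] , S.refl
          }
        letters∈G : ∀ x → ∃ λ l → generator (letter w x) ≈ eval l
        letters∈G x = letter w x ∷ [] , S.sym (identityʳ _)

    -- M ×ᵐ 𝐒 A n is again finite and shuffle-power-trivial, so every word has the same image in it as
    -- some finite word; this reduces the claim to finite words.
    shufflePowerTrivial-∼ : ∀ {c ℓ} {M : ⊛Monoid c ℓ} (h : Morphism (Free A) M) → IsFinite (⊛Monoid.setoid M) →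
      ⊛Monoid.ShufflePowerTrivial M → (∀ n → IsFinite (⊛Monoid.setoid (𝐒 A n))) →
      ∃ λ n → ∀ {u v} → u ∼[ n ] v → ⊛Monoid._≈_ M (Morphism.⟦_⟧ h u) (Morphism.⟦_⟧ h v)
    shufflePowerTrivial-∼ {M = M} h finite spt 𝐒-finite = n , λ {u} {v} u∼v →
      let s , u≈s , u∼s = approximate u
          t , v≈t , v∼t = approximate v
          s∼t = S∼.trans {fromList s} {u} {fromList t} (S∼.sym {u} {fromList s} u∼s) (S∼.trans {u} {v} {fromList t} u∼v v∼t)
      in S.trans u≈s (S.trans (eval-fromList s) (S.trans (proj₂ simon s t (∼-sublists s∼t))
           (S.trans (S.sym (eval-fromList t)) (S.sym v≈t))))
      where
      open MonoidLaws M using (module S)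
      open FreeMorphism h
      simon = Simon.eval-determined (shufflePowerTrivial⇒tame spt finite) generator
      n = proj₁ simon
      module S∼ = Setoid (∼-setoid {A = A} n)
      approximate : ∀ w → ∃ λ l → ⊛Monoid._≈_ M (Morphism.⟦_⟧ h w) (Morphism.⟦_⟧ h (fromList l)) × w ∼[ n ] fromList l
      approximate = FreeMorphism.finite-word (pairing M (𝐒 A n) h (quotientMorphism A n))
        (×ᵐ-finite M (𝐒 A n) finite (𝐒-finite n)) (×ᵐ-shufflePowerTrivial M (𝐒 A n) spt (𝐒-shufflePowerTrivial n))

  -- Boolean combinations of existential sentences

  module _ {A : Set} where
    open Embedding

    ⊨-cong : ∀ {w : Word A} {n} (φ : Formula A n) {ρ σ : Vector (Pos (dom w)) n} → (∀ i → ρ i ≡ σ i) → w , ρ ⊨ φ → w , σ ⊨ φ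
    ⊨-cong {w} (x <′ y) eq h = subst₂ (CountableOrder._<_ (dom w)) (eq x) (eq y) h
    ⊨-cong {w} (letterAt a x) eq h = trans (cong (letter w) (sym (eq x))) h
    ⊨-cong (¬′ φ) eq h h′ = h (⊨-cong φ (sym ∘ eq) h′)
    ⊨-cong (φ ∧′ ψ) eq (h , h′) = ⊨-cong φ eq h , ⊨-cong ψ eq h′
    ⊨-cong (φ ∨′ ψ) eq (inj₁ h) = inj₁ (⊨-cong φ eq h)
    ⊨-cong (φ ∨′ ψ) eq (inj₂ h) = inj₂ (⊨-cong ψ eq h)
    ⊨-cong (∃′ φ) eq (x , h) = x , ⊨-cong φ (λ { zero → refl ; (suc i) → eq i }) h

    ∃*-⊨ : ∀ {w : Word A} k (φ : Formula A k) → w , V.[] ⊨ ∃* k φ ⇔ (∃ λ ρ → w , ρ ⊨ φ)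
    ∃*-⊨ zero φ = mk⇔ (λ h → V.[] , h) (λ (_ , h) → ⊨-cong φ (λ ()) h)
    ∃*-⊨ (suc k) φ = mk⇔
      (λ h → let ρ , x , h′ = Equivalence.to (∃*-⊨ k (∃′ φ)) h in x V.∷ ρ , h′)
      (λ (ρ , h) → Equivalence.from (∃*-⊨ k (∃′ φ)) (ρ ∘ suc , ρ zero , ⊨-cong φ (λ { zero → refl ; (suc i) → refl }) h))

    quantifierFree-⊨ : ∀ {u v : Word A} {n} {φ : Formula A n} → QuantifierFree φ → (f : Embedding u v) →
                       ∀ ρ → (u , ρ ⊨ φ) ⇔ (v , to f ∘ ρ ⊨ φ)
    quantifierFree-⊨ {u} {v} (x <′ y) f ρ = mk⇔ (mono f) reflect
      where
      module u = CountableOrder (dom u)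
      module v = CountableOrder (dom v)
      reflect : to f (ρ x) v.< to f (ρ y) → ρ x u.< ρ y
      reflect lt with u.compare (ρ x) (ρ y)
      ... | tri< a _ _ = a
      ... | tri≈ _ b _ = contradiction lt (v.irrefl (cong (to f) b))
      ... | tri> _ _ c = contradiction lt (v.asym (mono f c))
    quantifierFree-⊨ (letterAt a x) f ρ = mk⇔ (trans (sym (letters f (ρ x)))) (trans (letters f (ρ x)))
    quantifierFree-⊨ (¬′ q) f ρ = let e = quantifierFree-⊨ q f ρ in
      mk⇔ (λ h → h ∘ Equivalence.from e) (λ h → h ∘ Equivalence.to e)
    quantifierFree-⊨ (q ∧′ r) f ρ = let e = quantifierFree-⊨ q f ρ ; e′ = quantifierFree-⊨ r f ρ in
      mk⇔ (λ (h , h′) → Equivalence.to e h , Equivalence.to e′ h′) (λ (h , h′) → Equivalence.from e h , Equivalence.from e′ h′)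
    quantifierFree-⊨ (q ∨′ r) f ρ = let e = quantifierFree-⊨ q f ρ ; e′ = quantifierFree-⊨ r f ρ in
      mk⇔ (λ { (inj₁ h) → inj₁ (Equivalence.to e h) ; (inj₂ h) → inj₂ (Equivalence.to e′ h) })
          (λ { (inj₁ h) → inj₁ (Equivalence.from e h) ; (inj₂ h) → inj₂ (Equivalence.from e′ h) })

    ∼-mono : ∀ {m n} {u v : Word A} → m ℕ.≤ n → u ∼[ n ] v → u ∼[ m ] v
    ∼-mono m≤n h s inj = h s (mk↣ {to = λ x → Fin.inject≤ (Injection.to inj x) m≤n}
      (Injection.injective inj ∘ Fin.inject≤-injective m≤n m≤n _ _))

    Invariant : ℕ → Sentence A → Set₁
    Invariant n φ = ∀ {u v} → u ∼[ n ] v → u , V.[] ⊨ φ → v , V.[] ⊨ φ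

    invariant-mono : ∀ {m n} φ → m ℕ.≤ n → Invariant m φ → Invariant n φ
    invariant-mono φ m≤n h {u} {v} u∼v = h (∼-mono {u = u} {v} m≤n u∼v)

    -- The witnesses of a block of `k` quantifiers span a subword of length at most `k`, which
    -- occurs in `v` too; a quantifier-free formula is carried back along one embedding and forth
    -- along the other. Negation uses the symmetry of `∼`, and a binary connective the larger of the
    -- two bounds.
    booleanExistential-invariant : ∀ {φ : Sentence A} → BooleanExistential φ → ∃ λ n → Invariant n φ
    booleanExistential-invariant (block k {φ} q) = k , λ {u} {v} u∼v h →
      let ρ , h′ = Equivalence.to (∃*-⊨ k φ) h
          s = u ↾ (λ x → ∃ λ i → ρ i ≡ x)
          σ : Vector (Pos (dom s)) k
          σ i = ρ i , [ i , refl ]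
          short : length≤ s k
          short = mk↣ {to = λ x → proj₁ (holds x)} λ {x} {y} e →
            value-injective (trans (sym (proj₂ (holds x))) (trans (cong ρ e) (proj₂ (holds y))))
          f = ⊑⇒embedding (Equivalence.to (u∼v s short) (_ , ≅-refl _))
          include : Embedding s u
          include = record { to = value ; mono = id ; letters = λ _ → refl }
      in Equivalence.from (∃*-⊨ k φ)
           (_ , Equivalence.to (quantifierFree-⊨ q f σ) (Equivalence.from (quantifierFree-⊨ q include σ) h′))
    booleanExistential-invariant (¬′_ {φ} b) = let n , h = booleanExistential-invariant b in
      n , λ {u} {v} u∼v ¬φ φv → ¬φ (h {v} {u} (λ s l → ⇔.sym (u∼v s l)) φv)
    booleanExistential-invariant (_∧′_ {φ} {ψ} b c) =
      let m , h = booleanExistential-invariant b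
          n , k = booleanExistential-invariant c
      in m ℕ.⊔ n , λ {u} {v} u∼v (p , q) →
        invariant-mono φ (ℕ.m≤m⊔n m n) h {u} {v} u∼v p , invariant-mono ψ (ℕ.m≤n⊔m m n) k {u} {v} u∼v q
    booleanExistential-invariant (_∨′_ {φ} {ψ} b c) =
      let m , h = booleanExistential-invariant b
          n , k = booleanExistential-invariant c
      in m ℕ.⊔ n , λ {u} {v} u∼v → λ
        { (inj₁ p) → inj₁ (invariant-mono φ (ℕ.m≤m⊔n m n) h {u} {v} u∼v p)
        ; (inj₂ q) → inj₂ (invariant-mono ψ (ℕ.m≤n⊔m m n) k {u} {v} u∼v q) }

    -- `ι` names the variables, so that the recursion moves along the list within a fixed context.
    matrix : ∀ {n} x (l : List A) → (Fin (suc (length l)) → Fin n) → Formula A n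
    matrix x [] ι = letterAt x (ι zero)
    matrix x (y ∷ l) ι = letterAt x (ι zero) ∧′ ((ι zero <′ ι (suc zero)) ∧′ matrix y l (ι ∘ suc))

    matrix-quantifierFree : ∀ {n} x l (ι : Fin (suc (length l)) → Fin n) → QuantifierFree (matrix x l ι)
    matrix-quantifierFree x [] ι = letterAt x (ι zero)
    matrix-quantifierFree x (y ∷ l) ι =
      letterAt x (ι zero) ∧′ ((ι zero <′ ι (suc zero)) ∧′ matrix-quantifierFree y l (ι ∘ suc))

    matrix-sound : ∀ {w : Word A} {n} (ρ : Vector (Pos (dom w)) n) x l ι → w , ρ ⊨ matrix x l ι →
                   (∀ {i j} → i Fin.< j → CountableOrder._<_ (dom w) (ρ (ι i)) (ρ (ι j))) ×
                   (∀ i → List.lookup (x ∷ l) i ≡ letter w (ρ (ι i)))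
    matrix-sound ρ x [] ι h = (λ { {zero} {zero} () }) , λ { zero → sym h }
    matrix-sound {w} ρ x (y ∷ l) ι (e , lt , h) with matrix-sound ρ y l (ι ∘ suc) h
    ... | m , e′ = mono′ , λ { zero → sym e ; (suc i) → e′ i }
      where
      open CountableOrder (dom w) using (_<_; <-trans)
      mono′ : ∀ {i j} → i Fin.< j → ρ (ι i) < ρ (ι j)
      mono′ {zero} {suc zero} _ = lt
      mono′ {zero} {suc (suc j)} _ = <-trans lt (m (s≤s z≤n))
      mono′ {suc i} {suc j} (s≤s l) = m l

    matrix-complete : ∀ {w : Word A} {n} (ρ : Vector (Pos (dom w)) n) x l ι →
                      (∀ {i j} → i Fin.< j → CountableOrder._<_ (dom w) (ρ (ι i)) (ρ (ι j))) →
                      (∀ i → List.lookup (x ∷ l) i ≡ letter w (ρ (ι i))) → w , ρ ⊨ matrix x l ι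
    matrix-complete ρ x [] ι m e = sym (e zero)
    matrix-complete ρ x (y ∷ l) ι m e =
      sym (e zero) , m (s≤s z≤n) , matrix-complete ρ y l (ι ∘ suc) (m ∘ s≤s) (e ∘ suc)

    -- Without free variables there are no atomic formulas, so even falsity takes a quantified
    -- variable.
    ⊥′ : Sentence A
    ⊥′ = ∃* 1 (zero <′ zero)

    ¬⊥′ : ∀ {w : Word A} → ¬ (w , V.[] ⊨ ⊥′)
    ¬⊥′ {w} (x , h) = CountableOrder.irrefl (dom w) refl h

    occurs : List A → Sentence A
    occurs [] = ¬′ ⊥′
    occurs (x ∷ l) = ∃* (suc (length l)) (matrix x l id)

    occurs-booleanExistential : ∀ l → BooleanExistential (occurs l)
    occurs-booleanExistential [] = ¬′ block 1 (zero <′ zero)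
    occurs-booleanExistential (x ∷ l) = block _ (matrix-quantifierFree x l id)

    occurs-⊨ : ∀ {w : Word A} l → w , V.[] ⊨ occurs l ⇔ Embedding (fromList l) w
    occurs-⊨ {w} [] = mk⇔ (λ _ → record { to = λ () ; mono = λ { {()} } ; letters = λ () }) (λ _ → ¬⊥′ {w})
    occurs-⊨ {w} (x ∷ l) = mk⇔
      (λ h → let ρ , h′ = Equivalence.to (∃*-⊨ _ (matrix x l id)) h
                 m , e = matrix-sound ρ x l id h′
             in record { to = ρ ; mono = m ; letters = e })
      (λ f → Equivalence.from (∃*-⊨ _ (matrix x l id)) (to f , matrix-complete (to f) x l id (mono f) (letters f)))

    AgreeOn : List (List A) → Word A → Word A → Set
    AgreeOn ls u v = ∀ {l} → l ∈ ls → Embedding (fromList l) u ⇔ Embedding (fromList l) v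

    -- Induction on the list, by cases on whether `l` occurs. `Near` closes each half of `K` under
    -- agreement on the remaining words. Within a half, agreement on `ls` is agreement on `l ∷ ls`,
    -- so by saturation nothing foreign to `K` is added there. For the empty list, `K` is everything
    -- or nothing. The level of `K` leaves room for the quantifier over words in `Near`.
    definable : ∀ {ℓ} (ls : List (List A)) (K : Pred (Word A) (lsuc 0ℓ ⊔ ℓ)) → (∀ {u v} → AgreeOn ls u v → K u → K v) →
                ∃ λ φ → BooleanExistential φ × ∀ w → K w ⇔ (w , V.[] ⊨ φ)
    definable [] K saturated with em {P = ∃ K}
    ... | yes (u , k) = occurs [] , occurs-booleanExistential [] ,
      λ w → mk⇔ (λ _ → ¬⊥′ {w}) (λ _ → saturated {u} (λ ()) k)
    ... | no none = ⊥′ , block 1 (zero <′ zero) ,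
      λ w → mk⇔ (λ k → contradiction (w , k) none) (λ h → contradiction h (¬⊥′ {w}))
    definable {ℓ} (l ∷ ls) K saturated =
      let φ , bφ , Kφ = definable {ℓ} ls (Near Occurs) (λ {u} {v} → near-saturated Occurs {u} {v})
          ψ , bψ , Kψ = definable {ℓ} ls (Near (¬_ ∘ Occurs)) (λ {u} {v} → near-saturated (¬_ ∘ Occurs) {u} {v})
      in (occurs l ∧′ φ) ∨′ ((¬′ occurs l) ∧′ ψ) ,
         (occurs-booleanExistential l ∧′ bφ) ∨′ ((¬′ occurs-booleanExistential l) ∧′ bψ) ,
         λ w → mk⇔ (to-⊨ w (Kφ w) (Kψ w)) (from-⊨ w (Kφ w) (Kψ w))
      where
      Occurs : Pred (Word A) 0ℓ
      Occurs = Embedding (fromList l)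
      Near : Pred (Word A) 0ℓ → Pred (Word A) (lsuc 0ℓ ⊔ ℓ)
      Near P w = ∃ λ v → K v × P v × AgreeOn ls v w
      near-saturated : ∀ P {u v} → AgreeOn ls u v → Near P u → Near P v
      near-saturated P agree (v , k , p , agree′) = v , k , p , λ m → ⇔.trans (agree′ m) (agree m)
      to-⊨ : ∀ w {X Y : Set} → Near Occurs w ⇔ X → Near (¬_ ∘ Occurs) w ⇔ Y → K w →
             (w , V.[] ⊨ occurs l × X) ⊎ (¬ (w , V.[] ⊨ occurs l) × Y)
      to-⊨ w eφ eψ k with em {P = Occurs w}
      ... | yes h = inj₁ (Equivalence.from (occurs-⊨ l) h , Equivalence.to eφ (w , k , h , λ _ → ⇔.refl))
      ... | no ¬h = inj₂ (¬h ∘ Equivalence.to (occurs-⊨ l) , Equivalence.to eψ (w , k , ¬h , λ _ → ⇔.refl))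
      from-⊨ : ∀ w {X Y : Set} → Near Occurs w ⇔ X → Near (¬_ ∘ Occurs) w ⇔ Y →
               (w , V.[] ⊨ occurs l × X) ⊎ (¬ (w , V.[] ⊨ occurs l) × Y) → K w
      from-⊨ w eφ eψ (inj₁ (h , x)) = let v , k , p , agree = Equivalence.from eφ x in
        saturated {v} (λ { (here refl) → mk⇔ (λ _ → Equivalence.to (occurs-⊨ l) h) (λ _ → p) ; (there m) → agree m }) k
      from-⊨ w eφ eψ (inj₂ (¬h , y)) = let v , k , ¬p , agree = Equivalence.from eψ y in
        saturated {v} (λ { (here refl) → mk⇔ (λ p → contradiction p ¬p) (λ h → contradiction (Equivalence.from (occurs-⊨ l) h) ¬h)
                         ; (there m) → agree m }) k

  module _ {A : Set} {ℓ} (L : Language A ℓ) where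
    open Language L

    quotient⇒definable : IsFinite (≡.setoid A) → RecognizedByQuotient L → DefinableInBooleanExistential L
    quotient⇒definable finite (n , L⊆ , ⊆L) =
      let φ , bφ , Kφ = definable {ℓ = ℓ} (lists≤ finite n) K (λ {u} {v} → saturated {u} {v})
      in φ , bφ , (λ {w} h → Equivalence.to (Kφ w) (L⊆ h)) , λ {w} h → ⊆L (Equivalence.from (Kφ w) h)
      where
      K : Pred (Word A) (lsuc 0ℓ ⊔ ℓ)
      K w = ∃ λ v → member v × v ∼[ n ] w
      saturated : ∀ {u v} → AgreeOn (lists≤ finite n) u v → K u → K v
      saturated {u} {v} agree (x , x∈L , x∼u) = x , x∈L , λ s len → ⇔.trans (x∼u s len) (∼-fromLists {u = u} {v} (λ l l≤n →
        let e = agree (∈-lists≤ finite l l≤n) in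
        mk⇔ (embedding⇒⊑ ∘ Equivalence.to e ∘ ⊑⇒embedding) (embedding⇒⊑ ∘ Equivalence.from e ∘ ⊑⇒embedding)) s len)

    definable⇒quotient : DefinableInBooleanExistential L → RecognizedByQuotient L
    definable⇒quotient (φ , bφ , L⊆ , ⊆L) = let n , h = booleanExistential-invariant bφ in
      n , (λ {w} w∈L → w , w∈L , λ _ _ → ⇔.refl) , λ {w} (v , v∈L , v∼w) → ⊆L (h {v} {w} v∼w (L⊆ v∈L))

  -- Images, subalgebras and small copies of algebras

  module _ {c₁ ℓ₁ c₂ ℓ₂} {M : ⊛Monoid c₁ ℓ₁} {N : ⊛Monoid c₂ ℓ₂} (f : Morphism M N) where
    private
      module M = ⊛Monoid M
      module N = ⊛Monoid N
      module ML = MonoidLaws M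
      module NL = MonoidLaws N
    open NL using (module S)
    open Morphism f
    open MorphismLaws f

    shufflePowerTrivial-image : (∀ y → ∃ λ x → ⟦ x ⟧ N.≈ y) → M.ShufflePowerTrivial → N.ShufflePowerTrivial
    shufflePowerTrivial-image surj spt y = NL.isIdempotentPower-cong
      (NL.product-cong (proj₂ ∘ surj ∘ y)) (NL.π-letterwise λ _ → proj₂ (surj _))
      (shufflePower-homo (proj₁ ∘ surj ∘ y) (spt (proj₁ ∘ surj ∘ y)))

    shufflePowerTrivial-embedded : (∀ {x y} → ⟦ x ⟧ N.≈ ⟦ y ⟧ → x M.≈ y) → N.ShufflePowerTrivial → M.ShufflePowerTrivial
    shufflePowerTrivial-embedded injective spt x = record
      { exponent   = exponent
      ; isPower    = injective (S.trans (π-homo _) (S.trans isPower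
          (S.trans (NL.×-congʳ (suc exponent) (S.sym (product-homo x))) (S.sym (power-homo (suc exponent) (M.product x))))))
      ; idempotent = injective (S.trans (∙-homo (M.κ x) (M.κ x)) (S.trans (NL.∙-cong (π-homo _) (π-homo _)) (S.trans idempotent (S.sym (π-homo _)))))
      }
      where open N.IsIdempotentPower (spt (⟦_⟧ ∘ x))

  infixr 9 _∘ᵐ_
  _∘ᵐ_ : ∀ {c₁ ℓ₁ c₂ ℓ₂ c₃ ℓ₃} {K : ⊛Monoid c₁ ℓ₁} {M : ⊛Monoid c₂ ℓ₂} {N : ⊛Monoid c₃ ℓ₃} →
         Morphism M N → Morphism K M → Morphism K N
  _∘ᵐ_ {N = N} g f = record
    { ⟦_⟧     = g.⟦_⟧ ∘ f.⟦_⟧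
    ; ⟦⟧-cong = g.⟦⟧-cong ∘ f.⟦⟧-cong
    ; π-homo  = λ w → Setoid.trans (⊛Monoid.setoid N) (g.⟦⟧-cong (f.π-homo w)) (g.π-homo _)
    }
    where
    module g = Morphism g
    module f = Morphism f

  module _ {c ℓ} (M : ⊛Monoid c ℓ) (finite : IsFinite (⊛Monoid.setoid M)) where
    open ⊛Monoid M
    open MonoidLaws M
    private module e = Inverse (proj₂ finite)

    -- `𝐒 A n` and the syntactic algebra are made of words and live in a higher universe than
    -- recognising algebras may; their finiteness gives a copy on `Fin`.
    skeleton : ⊛Monoid 0ℓ 0ℓ
    skeleton = record
      { setoid      = ≡.setoid (Fin (proj₁ finite))
      ; π           = λ w → e.to (π (mapʷ e.from w))
      ; π-cong      = λ p → e.to-cong (π-cong (map-iso setoid e.from p))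
      ; π-singleton = λ a → trans (e.to-cong (π-one zero (λ { zero → refl }))) (e.strictlyInverseˡ a)
      ; π-assoc     = λ α u → e.to-cong (S.trans (π-assoc α (mapʷ e.from ∘ u))
                        (π-letterwise λ i → S.sym (e.strictlyInverseʳ _)))
      }

    skeleton-finite : IsFinite (⊛Monoid.setoid skeleton)
    skeleton-finite = proj₁ finite , Identity.inverse (≡.setoid (Fin (proj₁ finite)))

    toSkeleton : Morphism M skeleton
    toSkeleton = record
      { ⟦_⟧     = e.to
      ; ⟦⟧-cong = e.to-cong
      ; π-homo  = λ w → e.to-cong (π-letterwise λ i → S.sym (e.strictlyInverseʳ _))
      }

    toSkeleton-injective : ∀ {x y} → e.to x ≡ e.to y → x ≈ y
    toSkeleton-injective eq = S.trans (S.sym (e.strictlyInverseʳ _)) (S.trans (e.from-cong eq) (e.strictlyInverseʳ _))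

    toSkeleton-surjective : ∀ y → ∃ λ x → e.to x ≡ y
    toSkeleton-surjective y = e.from y , e.strictlyInverseˡ y

  divides-shufflePowerTrivial : ∀ {c₁ ℓ₁ c₂ ℓ₂} {M : ⊛Monoid c₁ ℓ₁} {N : ⊛Monoid c₂ ℓ₂} → M Divides N →
    ⊛Monoid.ShufflePowerTrivial N → ⊛Monoid.ShufflePowerTrivial M
  divides-shufflePowerTrivial {N = N} d spt = shufflePowerTrivial-image morphism
    (λ y → let x , h = surjective y in x , h (Setoid.refl (⊛Monoid.setoid (Sub⊛Monoid.⊛monoid sub)) {x}))
    (shufflePowerTrivial-embedded inclusion id spt)
    where
    open _Divides_ d
    inclusion : Morphism (Sub⊛Monoid.⊛monoid sub) N
    inclusion = record { ⟦_⟧ = proj₁ ; ⟦⟧-cong = id ; π-homo = λ _ → Setoid.refl (⊛Monoid.setoid N) }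

  -- Contexts and the syntactic algebra

  module _ {A : Set} where

    fill : Word (Maybe A) → Word A → Word A
    fill C w = concat (mapʷ (maybe′ singleton w) C)

    hole : Word (Maybe A)
    hole = finWord (nothing V.∷ V.[])

    concat-constant : (w : Word A) → concat (word (finOrder 1) (λ _ → w)) ≅ w
    concat-constant w = ≅-trans _
      (concat-cong (letterwise (wordSetoid (≡.setoid A)) λ { zero → ≅-refl _ })) (concat-singleton w)

    fill-hole : ∀ w → fill hole w ≅ w
    fill-hole w = ≅-trans _
      (concat-cong (letterwise (wordSetoid (≡.setoid A)) λ { zero → ≅-refl _ })) (concat-singleton w)

    -- Being an image quantifies over words, so `Small` brings it down to the universe that
    -- `_Divides_` prescribes.
    image : ∀ {M : ⊛Monoid 0ℓ 0ℓ} → Morphism (Free A) M → Sub⊛Monoid M 0ℓ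
    image {M} h = record
      { member   = λ m → Small (∃ λ w → ⟦ w ⟧ ≈ m)
      ; respects = λ e s → let w , p = unsmall s in small (w , S.trans p e)
      ; π-closed = λ W hs → small (concat (word (dom W) (proj₁ ∘ unsmall ∘ hs)) ,
          S.trans (π-homo _) (π-letterwise (proj₂ ∘ unsmall ∘ hs)))
      }
      where
      open ⊛Monoid M
      open MonoidLaws M
      open Morphism h

  module _ {A : Set} {ℓ} (L : Language A ℓ) where
    open Language L

    Saturated : ∀ {c ℓ′} {M : ⊛Monoid c ℓ′} → Morphism (Free A) M → Set (lsuc 0ℓ ⊔ ℓ ⊔ ℓ′)
    Saturated {M = M} h = ∀ {u v} → ⟦ u ⟧ ≈ ⟦ v ⟧ → member u → member v
      where
      open Morphism h
      open ⊛Monoid M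

    saturated⇒recognizes : ∀ {c ℓ′} {M : ⊛Monoid c ℓ′} (h : Morphism (Free A) M) → Saturated h → RecognizedVia L h
    saturated⇒recognizes {M = M} h sat =
      (λ {w} w∈L → w , w∈L , Setoid.refl (⊛Monoid.setoid M)) , λ (v , v∈L , e) → sat e v∈L

    recognizes⇒saturated : ∀ {c ℓ′} {M : ⊛Monoid c ℓ′} (h : Morphism (Free A) M) → RecognizedVia L h → Saturated h
    recognizes⇒saturated h (_ , ⊆L) e u∈L = ⊆L (_ , u∈L , e)

    infix 4 _≈ˢ_
    -- Contexts have arbitrarily many holes, filled with copies of the same word.
    record _≈ˢ_ (u v : Word A) : Set (lsuc 0ℓ ⊔ ℓ) where
      constructor indistinguishable
      field
        within : ∀ C → member (fill C u) ⇔ member (fill C v)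

    open _≈ˢ_

    ≈ˢ-refl : ∀ {u} → u ≈ˢ u
    ≈ˢ-refl = indistinguishable λ _ → ⇔.refl

    ≈ˢ-sym : ∀ {u v} → u ≈ˢ v → v ≈ˢ u
    ≈ˢ-sym h = indistinguishable λ C → ⇔.sym (within h C)

    ≈ˢ-trans : ∀ {u v w} → u ≈ˢ v → v ≈ˢ w → u ≈ˢ w
    ≈ˢ-trans h k = indistinguishable λ C → ⇔.trans (within h C) (within k C)

    ≈ˢ-member : ∀ {u v} → u ≈ˢ v → member u → member v
    ≈ˢ-member h = respects (fill-hole _) ∘ Equivalence.to (within h hole) ∘ respects (≅-sym _ (fill-hole _))

    module Kernel {c ℓ′} {M : ⊛Monoid c ℓ′} (h : Morphism (Free A) M) (saturated : Saturated h) where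
      open ⊛Monoid M using (_≈_)
      open MonoidLaws M
      open Morphism h

      concat-homo : ∀ {α} {U V : Pos α → Word A} → (∀ i → ⟦ U i ⟧ ≈ ⟦ V i ⟧) → ⟦ concat (word α U) ⟧ ≈ ⟦ concat (word α V) ⟧
      concat-homo eq = S.trans (π-homo _) (S.trans (π-letterwise eq) (S.sym (π-homo _)))

      -- Filling a context is a countable product, which the morphism respects. For one finite
      -- recogniser this makes `≈ˢ` of finite index; for an arbitrary one it gives the division.
      kernel⊆≈ˢ : ∀ {u v} → ⟦ u ⟧ ≈ ⟦ v ⟧ → u ≈ˢ v
      kernel⊆≈ˢ e = indistinguishable λ C → mk⇔ (saturated (fill-cong C e)) (saturated (fill-cong C (S.sym e)))
        where
        fill-cong : ∀ C {u v} → ⟦ u ⟧ ≈ ⟦ v ⟧ → ⟦ fill C u ⟧ ≈ ⟦ fill C v ⟧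
        fill-cong C {u} {v} e = concat-homo λ i → lemma (letter C i)
          where
          lemma : ∀ m → ⟦ maybe′ singleton u m ⟧ ≈ ⟦ maybe′ singleton v m ⟧
          lemma (just _) = S.refl
          lemma nothing = e

    module Syntactic {c ℓ′} {M : ⊛Monoid c ℓ′} (h : Morphism (Free A) M) (saturated : Saturated h)
                     (finite : IsFinite (⊛Monoid.setoid M)) where
      open ⊛Monoid M using (_≈_)
      open MonoidLaws M
      open Morphism h
      open Kernel h saturated
      private module e = Inverse (proj₂ finite)

      -- All factors of one type are replaced at once, through a context with a hole for each of them.
      -- Only finitely many types occur, although there may be infinitely many factors.
      replace : ∀ α {T : Pos α → Set} (T? : ∀ i → Dec (T i)) {U V : Pos α → Word A} →
                (∀ {i j} → T i → T j → ⟦ U i ⟧ ≈ ⟦ U j ⟧ × ⟦ V i ⟧ ≈ ⟦ V j ⟧) →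
                (∀ {i} → T i → U i ≈ˢ V i) → (∀ {i} → ¬ T i → ⟦ U i ⟧ ≈ ⟦ V i ⟧) →
                member (concat (word α U)) → member (concat (word α V))
      replace α {T} T? {U} {V} uniform equivalent same mem with em {P = ∃ T}
      ... | no none = saturated (concat-homo λ i → same λ t → none (i , t)) mem
      ... | yes (i₀ , t₀) =
        saturated (S.trans (⟦⟧-cong (fill-C (V i₀))) (concat-homo λ i → V≈ i (T? i)))
          (Equivalence.to (within (equivalent t₀) C)
            (saturated (S.sym (S.trans (⟦⟧-cong (fill-C (U i₀))) (concat-homo λ i → U≈ i (T? i)))) mem))
        where
        piece : ∀ i → Dec (T i) → Word (Maybe A)
        piece i (yes _) = hole
        piece i (no _) = mapʷ just (U i)
        filled : Word A → ∀ i → Dec (T i) → Word A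
        filled w i (yes _) = w
        filled w i (no _) = U i
        C : Word (Maybe A)
        C = ∏ α (λ i → piece i (T? i))
        fill-piece : ∀ w i d → fill (piece i d) w ≅ filled w i d
        fill-piece w i (yes _) = fill-hole w
        fill-piece w i (no _) = concat-singletons (U i)
        fill-C : ∀ w → fill C w ≅ concat (word α (λ i → filled w i (T? i)))
        fill-C w = ≅-trans _ (concat-∏ α (λ i → mapʷ (maybe′ singleton w) (piece i (T? i))))
          (concat-cong (letterwise (wordSetoid (≡.setoid A)) λ i → fill-piece w i (T? i)))
        U≈ : ∀ i d → ⟦ filled (U i₀) i d ⟧ ≈ ⟦ U i ⟧
        U≈ i (yes t) = proj₁ (uniform t₀ t)
        U≈ i (no _) = S.refl
        V≈ : ∀ i d → ⟦ filled (V i₀) i d ⟧ ≈ ⟦ V i ⟧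
        V≈ i (yes t) = proj₂ (uniform t₀ t)
        V≈ i (no ¬t) = same ¬t

      -- From `U` to `V` one type at a time: `X` already agrees with `V` on type `c` and still with
      -- `U` elsewhere. Outside the types listed in `ts` the two families have the same images.
      replace* : ∀ α {k} (t : Pos α → Fin k) (ts : List (Fin k)) {U V : Pos α → Word A} →
                 (∀ {i j} → t i ≡ t j → ⟦ U i ⟧ ≈ ⟦ U j ⟧ × ⟦ V i ⟧ ≈ ⟦ V j ⟧) →
                 (∀ i → U i ≈ˢ V i) → (∀ i → t i ∈ ts ⊎ ⟦ U i ⟧ ≈ ⟦ V i ⟧) →
                 member (concat (word α U)) → member (concat (word α V))
      replace* α t [] uniform equivalent rest = saturated (concat-homo λ i → done (rest i))
        where
        done : ∀ {i} {X : Set ℓ′} → i ∈ [] ⊎ X → X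
        done (inj₂ x) = x
      replace* α t (c ∷ ts) {U} {V} uniform equivalent rest mem =
        replace* α t ts {X} {V}
          (λ {i} {j} e → X-uniform e (t i Fin.≟ c) (t j Fin.≟ c) , proj₂ (uniform e))
          (λ i → X≈ˢV i (t i Fin.≟ c)) (λ i → X-rest i (t i Fin.≟ c) (rest i))
          (replace α (λ i → t i Fin.≟ c) {U} {X}
            (λ {i} {j} p q → proj₁ (uniform (trans p (sym q))) , X-uniform (trans p (sym q)) (t i Fin.≟ c) (t j Fin.≟ c))
            (λ {i} _ → U≈ˢX i (t i Fin.≟ c)) (λ {i} ¬p → U≈X i (t i Fin.≟ c) ¬p) mem)
        where
        mix : ∀ i → Dec (t i ≡ c) → Word A
        mix i (yes _) = V i
        mix i (no _) = U i
        X : Pos α → Word A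
        X i = mix i (t i Fin.≟ c)
        X-uniform : ∀ {i j} → t i ≡ t j → ∀ d d′ → ⟦ mix i d ⟧ ≈ ⟦ mix j d′ ⟧
        X-uniform e (yes p) (yes q) = proj₂ (uniform e)
        X-uniform e (yes p) (no ¬q) = contradiction (trans (sym e) p) ¬q
        X-uniform e (no ¬p) (yes q) = contradiction (trans e q) ¬p
        X-uniform e (no ¬p) (no ¬q) = proj₁ (uniform e)
        X≈ˢV : ∀ i d → mix i d ≈ˢ V i
        X≈ˢV i (yes _) = ≈ˢ-refl
        X≈ˢV i (no _) = equivalent i
        U≈ˢX : ∀ i d → U i ≈ˢ mix i d
        U≈ˢX i (yes _) = equivalent i
        U≈ˢX i (no _) = ≈ˢ-refl
        U≈X : ∀ i d → ¬ t i ≡ c → ⟦ U i ⟧ ≈ ⟦ mix i d ⟧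
        U≈X i (yes p) ¬p = contradiction p ¬p
        U≈X i (no _) _ = S.refl
        X-rest : ∀ i d → t i ∈ c ∷ ts ⊎ ⟦ U i ⟧ ≈ ⟦ V i ⟧ → t i ∈ ts ⊎ ⟦ mix i d ⟧ ≈ ⟦ V i ⟧
        X-rest i (yes _) _ = inj₂ S.refl
        X-rest i (no ¬p) (inj₁ (here p)) = contradiction p ¬p
        X-rest i (no ¬p) (inj₁ (there m)) = inj₁ m
        X-rest i (no ¬p) (inj₂ e) = inj₂ e

      -- The type of an index is the pair of images of `U i` and `V i`; there are finitely many, and
      -- factors of one type are interchangeable.
      concat-member : ∀ α {U V : Pos α → Word A} → (∀ i → U i ≈ˢ V i) →
                      member (concat (word α U)) → member (concat (word α V))
      concat-member α {U} {V} equivalent = replace* α (λ i → Fin.combine (e.to ⟦ U i ⟧) (e.to ⟦ V i ⟧)) (List.allFin _)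
        (λ eq → let p , q = Fin.combine-injective _ _ _ _ eq in toSkeleton-injective M finite p , toSkeleton-injective M finite q)
        equivalent (λ i → inj₁ (∈-allFin _))

      -- A context filled with a product is itself one product: a hole contributes all the factors,
      -- a letter just itself. So `concat-member` covers contexts as well.
      concat-≈ˢ : ∀ α {U V : Pos α → Word A} → (∀ i → U i ≈ˢ V i) → concat (word α U) ≈ˢ concat (word α V)
      concat-≈ˢ α equivalent = indistinguishable λ C → mk⇔ (go C equivalent) (go C (≈ˢ-sym ∘ equivalent))
        where
        order : Maybe A → CountableOrder
        order (just _) = finOrder 1
        order nothing = α
        factor : (Pos α → Word A) → ∀ m → Pos (order m) → Word A
        factor U (just a) _ = singleton a
        factor U nothing i = U i
        flatten : ∀ C U → concat (∏ (dom C) (λ j → word (order (letter C j)) (factor U (letter C j)))) ≅ fill C (concat (word α U))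
        flatten C U = ≅-trans _ (concat-∏ (dom C) (λ j → word (order (letter C j)) (factor U (letter C j))))
          (concat-cong (letterwise (wordSetoid (≡.setoid A)) λ j → factors (letter C j)))
          where
          factors : ∀ m → concat (word (order m) (factor U m)) ≅ maybe′ singleton (concat (word α U)) m
          factors (just a) = concat-constant (singleton a)
          factors nothing = ≅-refl _
        factor-≈ˢ : ∀ {U V} → (∀ i → U i ≈ˢ V i) → ∀ m x → factor U m x ≈ˢ factor V m x
        factor-≈ˢ eq (just a) _ = ≈ˢ-refl
        factor-≈ˢ eq nothing i = eq i
        go : ∀ C {U V} → (∀ i → U i ≈ˢ V i) → member (fill C (concat (word α U))) → member (fill C (concat (word α V)))
        go C {U} {V} eq mem = respects (flatten C V)
          (concat-member (∑ᵒ (dom C) (order ∘ letter C)) (λ (j , x) → factor-≈ˢ eq (letter C j) x)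
            (respects (≅-sym _ (flatten C U)) mem))

      syntacticSetoid : Setoid (lsuc 0ℓ) (lsuc 0ℓ ⊔ ℓ)
      syntacticSetoid = record
        { Carrier       = Word A
        ; _≈_           = _≈ˢ_
        ; isEquivalence = record
            { refl = ≈ˢ-refl ; sym = ≈ˢ-sym ; trans = ≈ˢ-trans }
        }

      ≅⇒≈ˢ : ∀ {u v} → u ≅ v → u ≈ˢ v
      ≅⇒≈ˢ p = kernel⊆≈ˢ (⟦⟧-cong p)

      syntactic : ⊛Monoid (lsuc 0ℓ) (lsuc 0ℓ ⊔ ℓ)
      syntactic = record
        { setoid      = syntacticSetoid
        ; π           = concat
        ; π-cong      = λ {U} {V} p → let module p = WordIso p in
            ≈ˢ-trans (concat-≈ˢ (dom U) p.letters)
              (≅⇒≈ˢ (concat-cong record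
                { to = p.to ; isOrderIsomorphism = p.isOrderIsomorphism ; letters = λ _ → ≅-refl _ }))
        ; π-singleton = λ w → ≅⇒≈ˢ (concat-singleton w)
        ; π-assoc     = λ α U → ≅⇒≈ˢ (concat-∏ α U)
        }

      syntactic-finite : IsFinite syntacticSetoid
      syntactic-finite = classified⇒finite syntacticSetoid (λ w → e.to ⟦ w ⟧) ε
        λ eq → kernel⊆≈ˢ (toSkeleton-injective M finite eq)

      syntacticMorphism : Morphism (Free A) syntactic
      syntacticMorphism = record { ⟦_⟧ = id ; ⟦⟧-cong = ≅⇒≈ˢ ; π-homo = λ w → ≈ˢ-refl }

      module _ {N : ⊛Monoid 0ℓ 0ℓ} (h′ : Morphism (Free A) N) (saturated′ : Saturated h′) where
        private
          module h′ = Morphism h′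
          module N = ⊛Monoid N
          module N′ = MonoidLaws N

          -- The choice of a preimage does not matter: two of them have the same image, hence are
          -- related by `≈ˢ`.
          origin : ∃ (Sub⊛Monoid.member (image h′)) → Word A
          origin (_ , s) = proj₁ (unsmall s)

          origin-image : ∀ x → h′.⟦ origin x ⟧ N.≈ proj₁ x
          origin-image (_ , s) = proj₂ (unsmall s)

          image→syntactic : Morphism (Sub⊛Monoid.⊛monoid (image h′)) syntactic
          image→syntactic = record
            { ⟦_⟧     = origin
            ; ⟦⟧-cong = λ {x} {y} e → Kernel.kernel⊆≈ˢ h′ saturated′
                (N′.S.trans (origin-image x) (N′.S.trans e (N′.S.sym (origin-image y))))
            ; π-homo  = λ W → Kernel.kernel⊆≈ˢ h′ saturated′ (N′.S.trans (origin-image _)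
                (N′.S.sym (N′.S.trans (h′.π-homo _) (N′.π-letterwise (origin-image ∘ letter W)))))
            }

        syntactic-divides : skeleton syntactic syntactic-finite Divides N
        syntactic-divides = record
          { sub        = image h′
          ; morphism   = toSkeleton syntactic syntactic-finite ∘ᵐ image→syntactic
          ; surjective = λ y → let w , w↦y = toSkeleton-surjective syntactic syntactic-finite y in
              (h′.⟦ w ⟧ , small (w , N′.S.refl)) , λ {x} e → trans
                (Morphism.⟦⟧-cong (toSkeleton syntactic syntactic-finite)
                  (Kernel.kernel⊆≈ˢ h′ saturated′ (N′.S.trans (origin-image x) e))) w↦y
          }

      skeleton-isSyntactic : IsSyntactic L (skeleton syntactic syntactic-finite)
      skeleton-isSyntactic = record
        { finite     = skeleton-finite syntactic syntactic-finite
        ; recognizes = toSkeleton syntactic syntactic-finite ∘ᵐ syntacticMorphism ,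
            saturated⇒recognizes (toSkeleton syntactic syntactic-finite ∘ᵐ syntacticMorphism)
              (≈ˢ-member ∘ toSkeleton-injective syntactic syntactic-finite)
        ; divides    = λ N (h′ , recognizes) → syntactic-divides h′ (recognizes⇒saturated h′ recognizes)
        }

    regular⇒syntactic : Regular L → ∃ (IsSyntactic L)
    regular⇒syntactic (M , finite , h , recognizes) =
      _ , Syntactic.skeleton-isSyntactic h (recognizes⇒saturated h recognizes) finite

    -- The implications between the four conditions

    module _ (finite : IsFinite (≡.setoid A)) where

      finite⇒quotient : RecognizedByFiniteShufflePowerTrivial L → RecognizedByQuotient L
      finite⇒quotient (M , M-finite , spt , h , recognizes) =
        let n , determined = shufflePowerTrivial-∼ h M-finite spt (𝐒-finite finite)
        in n , saturated⇒recognizes (quotientMorphism A n)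
             λ {u} {v} u∼v → recognizes⇒saturated h recognizes (determined {u} {v} u∼v)

      quotient⇒finite : RecognizedByQuotient L → RecognizedByFiniteShufflePowerTrivial L
      quotient⇒finite (n , recognizes) =
        skeleton S S-finite , skeleton-finite S S-finite ,
        shufflePowerTrivial-image (toSkeleton S S-finite) (toSkeleton-surjective S S-finite) (𝐒-shufflePowerTrivial n) ,
        toSkeleton S S-finite ∘ᵐ quotientMorphism A n ,
        saturated⇒recognizes (toSkeleton S S-finite ∘ᵐ quotientMorphism A n) λ {u} {v} e →
          recognizes⇒saturated (quotientMorphism A n) recognizes {u} {v} (toSkeleton-injective S S-finite e)
        where
        S = 𝐒 A n
        S-finite = 𝐒-finite finite n

      -- Whatever fits the description of the syntactic algebra divides `N`, and divisors inherit
      -- the property; regularity supplies existence.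
      finite⇒syntactic : Regular L → RecognizedByFiniteShufflePowerTrivial L → SyntacticShufflePowerTrivial L
      finite⇒syntactic regular (N , _ , spt , recognized) = regular⇒syntactic regular ,
        λ M syn → divides-shufflePowerTrivial (IsSyntactic.divides syn N recognized) spt

      syntactic⇒finite : SyntacticShufflePowerTrivial L → RecognizedByFiniteShufflePowerTrivial L
      syntactic⇒finite ((M , syn) , spt) = M , IsSyntactic.finite syn , spt M syn , IsSyntactic.recognizes syn

open import Relation.Binary.PropositionalEquality using (setoid)

theorem3 : (∀ {i} → ExcludedMiddle i) →
    ∀ {A : Set} → IsFinite (setoid A) →
    ∀ {ℓ} (L : Language A ℓ) → Regular L →
    (RecognizedByFiniteShufflePowerTrivial L ⇔ RecognizedByQuotient L) ×
    (RecognizedByQuotient L ⇔ DefinableInBooleanExistential L) ×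
    (DefinableInBooleanExistential L ⇔ SyntacticShufflePowerTrivial L)
theorem3 em finite L regular =
  mk⇔ 1⇒2 2⇒1 ,
  mk⇔ 2⇒3 3⇒2 ,
  mk⇔ (finite⇒syntactic em L finite regular ∘ 2⇒1 ∘ 3⇒2) (2⇒3 ∘ 1⇒2 ∘ syntactic⇒finite em L finite)
  where
  1⇒2 = finite⇒quotient em L finite
  2⇒1 = quotient⇒finite em L finite
  2⇒3 = quotient⇒definable em L finite
  3⇒2 = definable⇒quotient em L
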